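{- Let $k \ge 2$ be a fixed integer. For every $\epsilon > 0$, there exists a deterministic algorithm which solves the problem Promise-Ball-$k$-SAT in time $O^*\left((k-1+\epsilon)^r\right)$, where $r$ is the radius given in the input.
   Context: A literal is a Boolean variable $x$ or its complement $\bar x$. A clause is a finite set of literals over pairwise distinct variables (read as a disjunction), and a CNF formula is a finite set of clauses (read as a conjunction). A $(\le k)$-CNF formula is a CNF formula all of whose clauses have size at most $k$. A truth assignment $\alpha : V \to \{0,1\}$ on the variable set $V$ satisfies $x$ if $\alpha(x)=1$ and satisfies $\bar x$ if $\alpha(x)=0$; it satisfies a clause if it satisfies at least one of its literals, and a formula if it satisfies all its clauses. The Hamming distance $d_H(\alpha,\beta)$ is the number of $x\in V$ with $\alpha(x)\ne\beta(x)$, and $B_r(\alpha) := \{\beta : V\to\{0,1\} \mid d_H(\alpha,\beta)\le r\}$. Promise-Ball-$k$-SAT: given a $(\le k)$-CNF formula $F$ over $n$ variables, an assignment $\alpha$ to these variables, a natural number $r$, and the promise that $B_r(\alpha)$ contains a satisfying assignment of $F$, find any satisfying assignment of $F$. An algorithm solves this problem if, whenever $B_r(\alpha)$ contains a satisfying assignment of $F$, it returns some satisfying assignment of $F$ (not necessarily lying in $B_r(\alpha)$); if the promise is violated its behavior is unspecified. $O^*$ suppresses factors polynomial in $n$; $k$ and $\epsilon$ are constants, and the algorithm may depend on them. -}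

module Defs where

open import Data.Bool using (Bool; true; false; _≟_)
open import Data.Fin using (Fin; toℕ)
open import Data.Integer using (+_)
open import Data.List using (List; []; _∷_; length; map; replicate)
open import Data.List.Relation.Binary.BagAndSetEquality using (_∼[_]_; set)
open import Data.List.Relation.Unary.All using (All)
open import Data.List.Relation.Unary.AllPairs using (AllPairs)
open import Data.List.Relation.Unary.Any using (Any)
open import Data.List.Relation.Unary.Unique.Propositional using (Unique)
open import Data.Nat using (ℕ; suc; _+_; _≤_)
open import Data.Product using (∃; ∃₂; _×_; _,_; proj₁; proj₂)
open import Data.Rational using (ℚ; _/_; +-*-rawSemiring) renaming (_≤_ to _≤ℚ_)
open import Data.Vec using (Vec; []; _∷_; lookup; zip; count; toList)
open import Relation.Binary.PropositionalEquality using (_≡_; refl)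
open import Relation.Nullary using (¬_; ¬?)

open import Algebra.Definitions.RawSemiring +-*-rawSemiring public
  using () renaming (_^_ to _^ℚ_)

fromℕ : ℕ → ℚ
fromℕ n = + n / 1

-- The variable set V is Fin n.

record Literal (n : ℕ) : Set where
  constructor literal
  field
    index : Fin n
    polarity  : Bool      -- true for x, false for its complement

open Literal public

-- Finite sets are lists without repetition; that two literals of a clause
-- are never equal already follows from their variables being distinct.

record Clause (n : ℕ) : Set where
  constructor clause
  field
    literals : List (Literal n)
    distinct : Unique (map index literals)

open Clause public

-- The same set of literals listed in two orders is the same clause, so the
-- absence of repetitions in a formula is up to set equality.

record CNF (n : ℕ) : Set where
  constructor cnf
  field
    clauses  : List (Clause n)
    distinct : AllPairs (λ C D → ¬ (literals C ∼[ set ] literals D)) clauses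

open CNF public using (clauses)

WidthAtMost : ∀ {n} → ℕ → CNF n → Set
WidthAtMost k F = All (λ C → length (literals C) ≤ k) (clauses F)

Assignment : ℕ → Set
Assignment n = Vec Bool n

module _ {n : ℕ} where

  infix 4 _⊨ˡ_ _⊨ᶜ_ _⊨_

  _⊨ˡ_ : Assignment n → Literal n → Set
  α ⊨ˡ l = lookup α (index l) ≡ polarity l

  _⊨ᶜ_ : Assignment n → Clause n → Set
  α ⊨ᶜ C = Any (α ⊨ˡ_) (literals C)

  _⊨_ : Assignment n → CNF n → Set
  α ⊨ F = All (α ⊨ᶜ_) (clauses F)

  hamming : Assignment n → Assignment n → ℕ
  hamming α β = count (λ p → ¬? (proj₁ p ≟ proj₂ p)) (zip α β)

  Ball : ℕ → Assignment n → Assignment n → Set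
  Ball r α β = hamming α β ≤ r

-- Algorithms: a first-order functional language over binary trees (in the
-- style of Jones, "Computability and Complexity from a Programming
-- Perspective").  A program is a finite table of mutually recursive unary
-- functions, one of which is its entry point.  Every evaluation step is
-- an elementary pointer operation (no arithmetic, no comparison of whole
-- trees), so unit cost is realistic: such a program runs on a pointer
-- machine or RAM with only constant-factor overhead.

data Tree : Set where
  leaf : Tree
  _∙_  : Tree → Tree → Tree

infixr 5 _∙_

-- Exp m n: expressions calling m functions, with n variables in scope.

data Exp (m n : ℕ) : Set where
  var   : Fin n → Exp m n
  nil   : Exp m n
  cons  : Exp m n → Exp m n → Exp m n
  let′  : Exp m n → Exp m (1 + n) → Exp m n
  case′ : Exp m n → Exp m n → Exp m (2 + n) → Exp m n
  call  : Fin m → Exp m n → Exp m n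

record Program : Set where
  constructor program
  field
    {size} : ℕ
    bodies : Vec (Exp size 1) size
    main   : Fin size

open Program public

-- bs , ρ ⊢ e ⇓ v ∣ t: with function bodies bs and environment ρ, the
-- call-by-value evaluation of e yields v in t steps.

infix 4 _,_⊢_⇓_∣_

data _,_⊢_⇓_∣_ {m : ℕ} (bs : Vec (Exp m 1) m) {n : ℕ} (ρ : Vec Tree n) :
               Exp m n → Tree → ℕ → Set where

  ⇓var  : ∀ {x} → bs , ρ ⊢ var x ⇓ lookup ρ x ∣ 1

  ⇓nil  : bs , ρ ⊢ nil ⇓ leaf ∣ 1

  ⇓cons : ∀ {a b u v s t} →
          bs , ρ ⊢ a ⇓ u ∣ s →
          bs , ρ ⊢ b ⇓ v ∣ t →
          bs , ρ ⊢ cons a b ⇓ u ∙ v ∣ suc (s + t)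

  ⇓let  : ∀ {a b u v s t} →
          bs , ρ ⊢ a ⇓ u ∣ s →
          bs , u ∷ ρ ⊢ b ⇓ v ∣ t →
          bs , ρ ⊢ let′ a b ⇓ v ∣ suc (s + t)

  ⇓leaf : ∀ {a b c v s t} →
          bs , ρ ⊢ a ⇓ leaf ∣ s →
          bs , ρ ⊢ b ⇓ v ∣ t →
          bs , ρ ⊢ case′ a b c ⇓ v ∣ suc (s + t)

  ⇓node : ∀ {a b c u₁ u₂ v s t} →
          bs , ρ ⊢ a ⇓ u₁ ∙ u₂ ∣ s →
          bs , u₁ ∷ u₂ ∷ ρ ⊢ c ⇓ v ∣ t →
          bs , ρ ⊢ case′ a b c ⇓ v ∣ suc (s + t)

  ⇓call : ∀ {f a u v s t} →
          bs , ρ ⊢ a ⇓ u ∣ s →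
          bs , u ∷ [] ⊢ lookup bs f ⇓ v ∣ t →
          bs , ρ ⊢ call f a ⇓ v ∣ suc (s + t)

deterministic : ∀ {m} {bs : Vec (Exp m 1) m} {n} {ρ : Vec Tree n}
                {e v v′ t t′} →
                bs , ρ ⊢ e ⇓ v ∣ t → bs , ρ ⊢ e ⇓ v′ ∣ t′ →
                v ≡ v′ × t ≡ t′
deterministic ⇓var ⇓var = refl , refl
deterministic ⇓nil ⇓nil = refl , refl
deterministic (⇓cons p q) (⇓cons p′ q′)
  with refl , refl ← deterministic p p′
     | refl , refl ← deterministic q q′ = refl , refl
deterministic (⇓let p q) (⇓let p′ q′)
  with refl , refl ← deterministic p p′
  with refl , refl ← deterministic q q′ = refl , refl
deterministic (⇓leaf p q) (⇓leaf p′ q′)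
  with refl , refl ← deterministic p p′
     | refl , refl ← deterministic q q′ = refl , refl
deterministic (⇓leaf p q) (⇓node p′ q′)
  with () , _ ← deterministic p p′
deterministic (⇓node p q) (⇓leaf p′ q′)
  with () , _ ← deterministic p p′
deterministic (⇓node p q) (⇓node p′ q′)
  with refl , refl ← deterministic p p′
  with refl , refl ← deterministic q q′ = refl , refl
deterministic (⇓call p q) (⇓call p′ q′)
  with refl , refl ← deterministic p p′
  with refl , refl ← deterministic q q′ = refl , refl

infix 4 _on_⇓_∣_

_on_⇓_∣_ : Program → Tree → Tree → ℕ → Set
P on u ⇓ v ∣ t =
  bodies P , u ∷ [] ⊢ lookup (bodies P) (main P) ⇓ v ∣ t

encodeList : {A : Set} → (A → Tree) → List A → Tree
encodeList enc []       = leaf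
encodeList enc (x ∷ xs) = enc x ∙ encodeList enc xs

-- Numbers are unary.  Running times below are measured in n and r rather
-- than in the length of the encoded input, so this gives no extra time.

encodeℕ : ℕ → Tree
encodeℕ n = encodeList (λ t → t) (replicate n leaf)

encodeBool : Bool → Tree
encodeBool false = leaf
encodeBool true  = leaf ∙ leaf

encodeLiteral : ∀ {n} → Literal n → Tree
encodeLiteral l = encodeBool (polarity l) ∙ encodeℕ (toℕ (index l))

encodeCNF : ∀ {n} → CNF n → Tree
encodeCNF F = encodeList (λ C → encodeList encodeLiteral (literals C)) (clauses F)

encodeAssignment : ∀ {n} → Assignment n → Tree
encodeAssignment α = encodeList encodeBool (toList α)

encodeInput : ∀ {n} → CNF n → Assignment n → ℕ → Tree
encodeInput F α r = encodeCNF F ∙ encodeAssignment α ∙ encodeℕ r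

-- T n r bounds the number of steps on inputs with n variables and radius r.
-- Nothing is required, not even termination, when the promise fails.

SolvesPromiseBallSAT : (k : ℕ) → Program → (T : ℕ → ℕ → ℚ) → Set
SolvesPromiseBallSAT k P T =
  ∀ {n} (F : CNF n) (α : Assignment n) (r : ℕ) →
  WidthAtMost k F →
  (∃ λ β → Ball r α β × β ⊨ F) →
  ∃₂ λ γ t → P on encodeInput F α r ⇓ encodeAssignment γ ∣ t
           × γ ⊨ F
           × fromℕ t ≤ℚ T n r

{-# OPTIONS --safe #-}
module Submission where

-- The algorithm is that of Moser and Scheder.  Greedily collect disjoint
-- clauses violated by the current assignment σ.  If t of them are found, a
-- satisfying assignment β makes one literal of each true, which spells a word
-- w* of length t over k letters.  Setting the literals selected by a word w
-- brings σ closer to β by t − 2 d if w and w* differ in d places.  With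
-- t = k s, some word of a covering code of radius s gains Δ = (k − 2) s, and
-- (k − 1)^Δ · poly(t) codewords suffice, since C(t,s) (k − 1)^(t − s) is the
-- largest of the t + 1 terms of the binomial expansion of k^t.  For large
-- constant t, the factor poly(t)^(r/Δ) is absorbed by ε.  If fewer than t
-- clauses are found, guess and freeze the values of their variables.  By
-- maximality every violated clause now has at most k − 1 unfrozen literals,
-- and this persists when a violated clause is repaired by setting and freezing
-- one of them; branching thus finds β within (k − 1)^r attempts.
--
-- For k = 2 there is no gain, Δ = 0.  But then, started on the empty partial
-- assignment, the same branching procedure is unit propagation, and an
-- assumption whose propagation meets no conflict never has to be revised.

open import Defs
open import Algebra using (CommutativeRing)
open import Data.Bool using (Bool; true; false; T; if_then_else_; not)
open import Data.Bool.ListAction using (any)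
open import Data.Bool.Properties using (¬-not) renaming (_≟_ to _≟ᵇ_)
open import Data.Empty using (⊥; ⊥-elim)
open import Data.Fin using (Fin; zero; suc; inject≤; toℕ)
open import Data.Fin.Properties using (toℕ-inject≤) renaming (_≟_ to _≟ᶠ_)
import Data.Integer as ℤ
import Data.Integer.Properties as ℤ
open import Data.List as List
  using (List; []; _∷_; _++_; allFin; cartesianProductWith; length; replicate)
open import Data.List.Membership.Propositional using (_∈_; lose) renaming (find to witness)
open import Data.List.Membership.Propositional.Properties
  using (∈-++⁺ˡ; ∈-++⁺ʳ; ∈-++⁻; ∈-allFin; ∈-cartesianProductWith⁺; ∈-∃++)
open import Data.List.Properties
  using (length-++; length-map; length-replicate; length-tabulate)
open import Data.List.Relation.Binary.BagAndSetEquality using (_∼[_]_; set)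
open import Data.List.Relation.Unary.All as All using (All; []; _∷_)
import Data.List.Relation.Unary.All.Properties as All
open import Data.List.Relation.Unary.AllPairs as AllPairs using (AllPairs; []; _∷_)
import Data.List.Relation.Unary.AllPairs.Properties as AllPairs
open import Data.List.Relation.Unary.Any as Any using (Any; here; there)
open import Data.Maybe using (Maybe; just; nothing; fromMaybe; is-just; maybe)
open import Data.Nat hiding (_≟_; _/_)
open import Data.Nat.DivMod using (_/_; m%n<n; m/n*n≤m; m≡m%n+[m/n]*n)
open import Data.Nat.ListAction using (sum)
open import Data.Nat.ListAction.Properties using (sum-++)
open import Data.Nat.Properties
open import Data.Nat.Tactic.RingSolver using (solve-∀)
open import Data.Product using (Σ; ∃; ∃₂; _×_; _,_; proj₁; proj₂)
open import Data.Rational as ℚ using (ℚ; 0ℚ; 1ℚ; mkℚ; toℚᵘ)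
import Data.Rational.Properties as ℚ
open import Data.Rational.Unnormalised as ℚᵘ using (mkℚᵘ; *≡*; *≤*)
import Data.Rational.Unnormalised.Properties as ℚᵘ
open import Data.Sum using (_⊎_; inj₁; inj₂; fromInj₂)
open import Data.Vec as Vec using (Vec; []; _∷_; lookup; toList; zipWith; _[_]≔_)
open import Data.Vec.Properties
  using (length-toList; lookup-map; lookup-replicate; lookup-zipWith; lookup∘updateAt;
      lookup∘updateAt′)
open import Function using (_∘_)
open import Function.Related.Propositional using (K-refl)
open import Relation.Binary.PropositionalEquality
open import Relation.Nullary using (yes; no)
open import Relation.Nullary.Decidable using (True; toWitness)
open import Algebra.Properties.CommutativeSemiring.Exp
  (CommutativeRing.commutativeSemiring ℚ.+-*-commutativeRing) using (^-distrib-*; ^-homo-*)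
open import Algebra.Properties.CommutativeSemigroup +-commutativeSemigroup
  using (interchange; x∙yz≈y∙xz)

-- The program

private variable fs vs : ℕ

infixr 5 _▹_
pattern _▹_ a b = cons a b

v0 : Exp fs (1 + vs)
v0 = var zero
v1 : Exp fs (2 + vs)
v1 = var (suc zero)
v2 : Exp fs (3 + vs)
v2 = var (suc (suc zero))
v3 : Exp fs (4 + vs)
v3 = var (suc (suc (suc zero)))
v4 : Exp fs (5 + vs)
v4 = var (suc (suc (suc (suc zero))))
v5 : Exp fs (6 + vs)
v5 = var (suc (suc (suc (suc (suc zero)))))
v6 : Exp fs (7 + vs)
v6 = var (suc (suc (suc (suc (suc (suc zero))))))
v7 : Exp fs (8 + vs)
v7 = var (suc (suc (suc (suc (suc (suc (suc zero)))))))
v8 : Exp fs (9 + vs)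
v8 = var (suc (suc (suc (suc (suc (suc (suc (suc zero))))))))
v10 : Exp fs (11 + vs)
v10 = var (suc (suc (suc (suc (suc (suc (suc (suc (suc (suc zero))))))))))

-- The argument is a tuple a₁ ∙ … ∙ aⱼ; afterwards aⱼ is variable 0,
-- aⱼ₋₁ is variable 1, and aⱼ₋₂, …, a₁ are the variables 2, 4, 6, ….
unpack₂ : Exp fs (3 + vs) → Exp fs (1 + vs)
unpack₂ e = case′ v0 nil e
unpack₃ : Exp fs (5 + vs) → Exp fs (1 + vs)
unpack₃ e = unpack₂ (case′ v1 nil e)
unpack₄ : Exp fs (7 + vs) → Exp fs (1 + vs)
unpack₄ e = unpack₃ (case′ v1 nil e)
unpack₅ : Exp fs (9 + vs) → Exp fs (1 + vs)
unpack₅ e = unpack₄ (case′ v1 nil e)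

yes′ no′ : Exp fs vs
no′  = nil
yes′ = cons nil nil

cell′ : Exp fs vs → Exp fs vs
cell′ b = case′ b (yes′ ▹ no′) (no′ ▹ yes′)

negate′ : Exp fs vs → Exp fs vs
negate′ l = case′ l nil (case′ v0 yes′ no′ ▹ v1)

mark′ : Exp fs vs
mark′ = yes′ ▹ yes′

quoteTree : Tree → Exp fs vs
quoteTree leaf    = nil
quoteTree (s ∙ t) = quoteTree s ▹ quoteTree t

pattern #get    = zero
pattern #put    = suc #get
pattern #lit    = suc #put
pattern #sat    = suc #lit
pattern #free   = suc #sat
pattern #find   = suc #free
pattern #assume = suc #find
pattern #mark   = suc #assume
pattern #search = suc #mark
pattern #branch = suc #search
pattern #enum   = suc #branch
pattern #greedy = suc #enum
pattern #codes  = suc #greedy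
pattern #apply  = suc #codes
pattern #minus  = suc #apply
pattern #phase  = suc #minus
pattern #fill   = suc #phase
pattern #cells  = suc #fill
pattern #finish = suc #cells
pattern #loop   = suc #finish
pattern #mainₖ  = suc #loop
pattern #main₂  = suc #mainₖ

-- Above each function: the shape of its argument, with F the formula, S the
-- marks of frozen variables, σ the partial assignment, r the remaining
-- radius, G disjoint violated clauses and W codewords.  A failed search
-- returns leaf, a successful one the final S ∙ σ.

module Table (tT ΔT codeT : Tree) where

  get put lit sat free find assume mark search branch enum greedy codes apply
    minus phase fill cells finish loop mainₖ main₂ : Exp 22 1

  -- xs ∙ i
  get = unpack₂ (case′ v0 nil (case′ v3 v0 (call #get (v3 ▹ v1))))

  -- xs ∙ i ∙ a
  put = unpack₃ (case′ v2 nil (case′ v2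
    (v3 ▹ v1)
    (v2 ▹ call #put (v3 ▹ v1 ▹ v5))))

  -- cells ∙ literal
  lit = unpack₂ (case′ v1 nil (case′ (call #get (v2 ▹ v1)) nil (case′ v2 v0 v3)))

  -- cells ∙ clause
  sat = unpack₂ (case′ v1 no′ (case′ (call #lit (v2 ▹ v0))
    (call #sat (v2 ▹ v1))
    yes′))

  -- S ∙ clause
  free = unpack₂ (case′ v1 nil (case′ (call #lit (v2 ▹ v0))
    (v0 ▹ call #free (v2 ▹ v1))
    (call #free (v4 ▹ v3))))

  -- b ∙ F ∙ S ∙ σ: the first violated clause that has (b true) or has not
  -- (b false) a frozen variable
  find = unpack₄ (case′ v2 nil (case′ (call #sat (v3 ▹ v0))
      (case′ (call #sat (v2 ▹ v0))
        (case′ v6 (nil ▹ v0) (call #find (v8 ▹ v3 ▹ v4 ▹ v5)))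
        (case′ v8 (call #find (v8 ▹ v3 ▹ v4 ▹ v5)) (nil ▹ v4)))
      (call #find (v8 ▹ v3 ▹ v4 ▹ v5))))

  -- literal ∙ S ∙ σ
  assume = unpack₂ (case′ v0 nil (case′ v3 nil
    (call #put (v0 ▹ v3 ▹ mark′) ▹ call #put (v1 ▹ v3 ▹ cell′ v2))))

  -- clause ∙ S
  mark = unpack₂ (case′ v0 v1 (case′ v0 nil
    (call #mark (v3 ▹ call #put (v5 ▹ v1 ▹ mark′)))))

  -- F ∙ r ∙ S ∙ σ
  search = unpack₃ (case′ (call #find (yes′ ▹ v2 ▹ v1)) v1 (case′ v2 nil (case′ v5 nil
    (call #branch (call #free (v0 ▹ v5) ▹ v8 ▹ v3 ▹ v7)))))

  -- clause ∙ F ∙ r ∙ S ∙ σ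
  branch = unpack₄ (case′ v4 nil (case′
    (call #search (v4 ▹ v2 ▹ call #assume (v0 ▹ v3)))
    (call #branch (v1 ▹ v4 ▹ v2 ▹ v3))
    (v0 ▹ v1)))

  -- G ∙ F ∙ r ∙ S ∙ σ
  enum = unpack₄ (case′ v4
    (call #search (v2 ▹ v0 ▹ v1))
    (case′ v0
      (call #enum (v1 ▹ v4 ▹ v2 ▹ v3))
      (case′ (call #enum ((v1 ▹ v3) ▹ v6 ▹ v4 ▹ call #assume (v0 ▹ v5)))
        (call #enum ((v1 ▹ v3) ▹ v6 ▹ v4 ▹
           call #assume (negate′ v0 ▹ v5)))
        (v0 ▹ v1))))

  -- j ∙ G ∙ F ∙ r ∙ S ∙ σ
  greedy = unpack₅ (case′ v6
    (case′ (call #minus (quoteTree ΔT ▹ v0)) nil (case′ v3 nil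
      (call #codes (quoteTree codeT ▹ v8 ▹ v6 ▹ v3 ▹ v1))))
    (case′ (call #find (no′ ▹ v4 ▹ v3))
      (call #enum (v6 ▹ v4 ▹ v2 ▹ v3))
      (case′ v5 nil
        (call #greedy (v5 ▹ (v3 ▹ v10) ▹ v8 ▹ v6 ▹ call #mark (v3 ▹ v0) ▹ v1)))))

  -- W ∙ G ∙ F ∙ r ∙ σ
  codes = unpack₅ (case′ v6 nil (case′
    (call #phase (v4 ▹ v2 ▹ call #apply (v0 ▹ v6 ▹ v3)))
    (call #codes (v1 ▹ v6 ▹ v4 ▹ v2 ▹ v3))
    (v0 ▹ v1)))

  -- w ∙ G ∙ σ
  apply = unpack₃ (case′ v2 v1 (case′ v2 v3 (case′ (call #get (v0 ▹ v2))
    (call #apply (v3 ▹ v1 ▹ v5))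
    (call #apply (v5 ▹ v3 ▹ call #put (v7 ▹ v1 ▹ cell′ v0))))))

  -- d ∙ r
  minus = unpack₂ (case′ v0 (nil ▹ v1) (case′ v3 nil (call #minus (v3 ▹ v1))))

  -- F ∙ r ∙ σ
  phase = unpack₃ (call #greedy (quoteTree tT ▹ nil ▹ v2 ▹ v0 ▹ call #fill v1 ▹ v1))

  -- a list, whose entries are replaced by empty cells
  fill = case′ v0 nil ((no′ ▹ no′) ▹ call #fill v1)

  -- α
  cells = case′ v0 nil (cell′ v0 ▹ call #cells v1)

  -- σ
  finish = case′ v0 nil (case′ v0 nil (v1 ▹ call #finish v3))

  -- F ∙ S ∙ σ
  loop = unpack₂ (case′ (call #find (no′ ▹ v0 ▹ v1))
    (case′ v1 nil (call #finish v1))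
    (case′ v3 nil (case′ (call #branch (v3 ▹ v4 ▹ v1 ▹ v5)) nil
      (call #loop (v6 ▹ v0 ▹ v1)))))

  -- F ∙ α ∙ r
  mainₖ = unpack₃ (case′ (call #phase (v2 ▹ v1 ▹ call #cells v0)) nil (call #finish v1))

  -- F ∙ α ∙ r
  main₂ = unpack₃ (call #loop (v2 ▹ call #fill v0 ▹ call #fill v0))

  table : Vec (Exp 22 1) 22
  table = get ∷ put ∷ lit ∷ sat ∷ free ∷ find ∷ assume ∷ mark ∷ search ∷ branch
    ∷ enum ∷ greedy ∷ codes ∷ apply ∷ minus ∷ phase ∷ fill ∷ cells ∷ finish
    ∷ loop ∷ mainₖ ∷ main₂ ∷ []

-- Evaluation with costs

-- The steps of a function body, calls of cheaper functions included, and
-- the cost of a loop of N rounds; opaque to keep unification from unfolding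
-- multiplications by numerals.

opaque

  once : ℕ → ℕ
  once A = 64 * A

  level : ℕ → ℕ → ℕ
  level N A = suc N * (64 * A)

  ≤once : ∀ {c} A → c ≤ 64 → c * A ≤ once A
  ≤once A = *-monoˡ-≤ A

  once≤level : ∀ N A → once A ≤ level N A
  once≤level N A = m≤m+n (64 * A) _

  level-mono : ∀ {N M} A → N ≤ M → level N A ≤ level M A
  level-mono A N≤M = *-monoˡ-≤ (64 * A) (s≤s N≤M)

  level-suc : ∀ N A → level (suc N) A ≡ once A + level N A
  level-suc N A = refl

  level-def : ∀ N A → level N A ≡ suc N * (64 * A)
  level-def N A = refl

  once-def : ∀ A → once A ≡ 64 * A
  once-def A = refl

≤level : ∀ N A → A ≤ level N A
≤level N A = ≤-trans (≤-trans (m≤m+n A 0) (≤once A (s≤s z≤n))) (once≤level N A)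

module Cost {m : ℕ} (bs : Vec (Exp m 1) m) where

  Within : ∀ {n} → Vec Tree n → Exp m n → Tree → ℕ → Set
  Within ρ e v T = ∃ λ t → (bs , ρ ⊢ e ⇓ v ∣ t) × t ≤ T

  infix 4 _⟨_⟩⇓_within_
  _⟨_⟩⇓_within_ : Fin m → Tree → Tree → ℕ → Set
  f ⟨ u ⟩⇓ v within T = Within (u ∷ []) (lookup bs f) v T

  weaken : ∀ {n} {ρ : Vec Tree n} {e v T T′} → T ≤ T′ → Within ρ e v T → Within ρ e v T′
  weaken T≤T′ (t , d , t≤T) = t , d , ≤-trans t≤T T≤T′

  module Unit (A : ℕ) (1≤A : 1 ≤ A) where

    -- Elementary steps and calls of cheaper functions count one unit A each;
    -- the costs of recursive calls are collected in Rs.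
    infix 4 _⊢_⇓_[_▸_]
    record _⊢_⇓_[_▸_] {n : ℕ} (ρ : Vec Tree n) (e : Exp m n) (v : Tree)
                      (c : ℕ) (Rs : List ℕ) : Set where
      constructor counted
      field within : Within ρ e v (c * A + sum Rs)
    open _⊢_⇓_[_▸_]

    private variable
      ρ : Vec Tree vs
      e e₁ e₂ e₃ : Exp m vs
      u v u₁ u₂ : Tree
      c d : ℕ
      Rs Qs : List ℕ

    private
      combine : ∀ {s t} → s ≤ c * A + sum Rs → t ≤ d * A + sum Qs →
                suc (s + t) ≤ suc (c + d) * A + sum (Rs ++ Qs)
      combine {c} {Rs} {d} {Qs} {s} {t} p q = begin
        suc (s + t)                                  ≤⟨ +-mono-≤ 1≤A (+-mono-≤ p q) ⟩
        A + (c * A + sum Rs + (d * A + sum Qs))      ≡⟨ cong (A +_) (+-assoc (c * A) (sum Rs) _) ⟩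
        A + (c * A + (sum Rs + (d * A + sum Qs)))    ≡⟨ cong (λ z → A + (c * A + z))
            (x∙yz≈y∙xz (sum Rs) (d * A) (sum Qs)) ⟩
        A + (c * A + (d * A + (sum Rs + sum Qs)))    ≡⟨ cong (A +_) (+-assoc (c * A) (d * A) _) ⟨
        A + (c * A + d * A + (sum Rs + sum Qs))      ≡⟨ +-assoc A (c * A + d * A) _ ⟨
        A + (c * A + d * A) + (sum Rs + sum Qs)      ≡⟨ cong₂ (λ y z → A + y + z)
            (*-distribʳ-+ A c d) (sum-++ Rs Qs) ⟨
        suc (c + d) * A + sum (Rs ++ Qs)             ∎
        where open ≤-Reasoning

    one : ∀ {t} → t ≤ A → t ≤ 1 * A + sum []
    one t≤A = ≤-trans t≤A (≤-trans (m≤m+n A 0) (m≤m+n (A + 0) 0))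

    var° : ∀ {x} → ρ ⊢ var x ⇓ lookup ρ x [ 1 ▸ [] ]
    var° = counted (1 , ⇓var , one 1≤A)

    nil° : ρ ⊢ nil ⇓ leaf [ 1 ▸ [] ]
    nil° = counted (1 , ⇓nil , one 1≤A)

    infixr 5 _▹°_
    _▹°_ : ρ ⊢ e₁ ⇓ u [ c ▸ Rs ] → ρ ⊢ e₂ ⇓ v [ d ▸ Qs ] →
           ρ ⊢ cons e₁ e₂ ⇓ u ∙ v [ suc (c + d) ▸ Rs ++ Qs ]
    _▹°_ {c = c} {Rs = Rs} {d = d} {Qs = Qs} (counted (_ , p , p≤)) (counted (_ , q , q≤)) =
      counted (_ , ⇓cons p q , combine {c} {Rs} {d} {Qs} p≤ q≤)

    leaf° : ρ ⊢ e₁ ⇓ leaf [ c ▸ Rs ] → ρ ⊢ e₂ ⇓ v [ d ▸ Qs ] →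
            ρ ⊢ case′ e₁ e₂ e₃ ⇓ v [ suc (c + d) ▸ Rs ++ Qs ]
    leaf° {c = c} {Rs = Rs} {d = d} {Qs = Qs} (counted (_ , p , p≤)) (counted (_ , q , q≤)) =
      counted (_ , ⇓leaf p q , combine {c} {Rs} {d} {Qs} p≤ q≤)

    node° : ρ ⊢ e₁ ⇓ u₁ ∙ u₂ [ c ▸ Rs ] → u₁ ∷ u₂ ∷ ρ ⊢ e₃ ⇓ v [ d ▸ Qs ] →
            ρ ⊢ case′ e₁ e₂ e₃ ⇓ v [ suc (c + d) ▸ Rs ++ Qs ]
    node° {c = c} {Rs = Rs} {d = d} {Qs = Qs} (counted (_ , p , p≤)) (counted (_ , q , q≤)) =
      counted (_ , ⇓node p q , combine {c} {Rs} {d} {Qs} p≤ q≤)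

    rec° : ∀ {f T} → ρ ⊢ e ⇓ u [ c ▸ Rs ] → f ⟨ u ⟩⇓ v within T →
           ρ ⊢ call f e ⇓ v [ suc c ▸ Rs ++ T ∷ [] ]
    rec° {c = c} {Rs = Rs} {T = T} (counted (s , p , p≤)) (t , q , q≤) =
      counted (_ , ⇓call p q ,
          subst (λ x → suc (s + t) ≤ suc x * A + sum (Rs ++ T ∷ [])) (+-identityʳ c)
        (combine {c} {Rs} {0} {T ∷ []} p≤ (≤-trans q≤ (m≤m+n T 0))))

    call° : ∀ {f T} → T ≤ A → f ⟨ u ⟩⇓ v within T → ρ ⊢ e ⇓ u [ c ▸ Rs ] →
            ρ ⊢ call f e ⇓ v [ suc (c + 1) ▸ Rs ++ [] ]
    call° {c = c} {Rs = Rs} {T = T} T≤A (t , q , q≤) (counted (s , p , p≤)) =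
      counted (_ , ⇓call p q , combine {c} {Rs} {1} {[]} p≤
        (one (≤-trans q≤ T≤A)))

    atMost : c ≤ d → ρ ⊢ e ⇓ v [ c ▸ Rs ] → ρ ⊢ e ⇓ v [ d ▸ Rs ]
    atMost {Rs = Rs} c≤d (counted p) = counted (weaken (+-monoˡ-≤ (sum Rs) (*-monoˡ-≤ A c≤d)) p)

    total : ρ ⊢ e ⇓ v [ c ▸ Rs ] → {True (c ≤? 64)} → Within ρ e v (once A + sum Rs)
    total {Rs = Rs} p {c≤} = weaken (+-monoˡ-≤ (sum Rs) (≤once A (toWitness c≤))) (p .within)

    total₀ : ρ ⊢ e ⇓ v [ c ▸ [] ] → {True (c ≤? 64)} → Within ρ e v (once A)
    total₀ p {c≤} = weaken (≤-reflexive (+-identityʳ _)) (total p {c≤})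

    total₁ : ∀ {x} → ρ ⊢ e ⇓ v [ c ▸ x ∷ [] ] → {True (c ≤? 64)} → Within ρ e v (once A + x)
    total₁ p {c≤} = weaken (≤-reflexive (cong (once A +_) (+-identityʳ _))) (total p {c≤})

    total₂ : ∀ {x y} → ρ ⊢ e ⇓ v [ c ▸ x ∷ y ∷ [] ] → {True (c ≤? 64)} →
             Within ρ e v (once A + (x + y))
    total₂ {x = x} p {c≤} =
      weaken (≤-reflexive (cong (λ z → once A + (x + z)) (+-identityʳ _))) (total p {c≤})

    single : ∀ {N} → ρ ⊢ e ⇓ v [ c ▸ [] ] → {True (c ≤? 64)} → Within ρ e v (level N A)
    single {N = N} p {c≤} = weaken (once≤level N A) (total₀ p {c≤})

    iterated : ∀ {N} → ρ ⊢ e ⇓ v [ c ▸ level N A ∷ [] ] → {True (c ≤? 64)} →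
               Within ρ e v (level (suc N) A)
    iterated {N = N} p {c≤} = weaken (≤-reflexive (sym (level-suc N A))) (total₁ p {c≤})

    unpack₂° : (u₁ ∷ u₂ ∷ (u₁ ∙ u₂) ∷ ρ) ⊢ e ⇓ v [ c ▸ Rs ] →
               ((u₁ ∙ u₂) ∷ ρ) ⊢ unpack₂ e ⇓ v [ 2 + c ▸ Rs ]
    unpack₂° = node° var°

    unpack₃° : ∀ {u₃} →
               (u₂ ∷ u₃ ∷ u₁ ∷ (u₂ ∙ u₃) ∷ (u₁ ∙ u₂ ∙ u₃) ∷ ρ) ⊢ e ⇓ v [ c ▸ Rs ] →
               ((u₁ ∙ u₂ ∙ u₃) ∷ ρ) ⊢ unpack₃ e ⇓ v [ 4 + c ▸ Rs ]
    unpack₃° p = unpack₂° (node° var° p)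

    unpack₄° : ∀ {u₃ u₄} →
               (u₃ ∷ u₄ ∷ u₂ ∷ (u₃ ∙ u₄) ∷ u₁ ∷ (u₂ ∙ u₃ ∙ u₄) ∷ (u₁ ∙ u₂ ∙ u₃ ∙ u₄) ∷ ρ) ⊢ e
                   ⇓ v [ c ▸ Rs ] →
               ((u₁ ∙ u₂ ∙ u₃ ∙ u₄) ∷ ρ) ⊢ unpack₄ e ⇓ v [ 6 + c ▸ Rs ]
    unpack₄° p = unpack₃° (node° var° p)

    unpack₅° : ∀ {u₃ u₄ u₅} →
               (u₄ ∷ u₅ ∷ u₃ ∷ (u₄ ∙ u₅) ∷ u₂ ∷ (u₃ ∙ u₄ ∙ u₅) ∷ u₁ ∷ (u₂ ∙ u₃ ∙ u₄ ∙ u₅) ∷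
                   (u₁ ∙ u₂ ∙ u₃ ∙ u₄ ∙ u₅) ∷ ρ) ⊢ e ⇓ v [ c ▸ Rs ] →
               ((u₁ ∙ u₂ ∙ u₃ ∙ u₄ ∙ u₅) ∷ ρ) ⊢ unpack₅ e ⇓ v [ 8 + c ▸ Rs ]
    unpack₅° p = unpack₄° (node° var° p)

private variable
  n : ℕ
  A : Set

_!?_ : List A → ℕ → Maybe A
[]       !? i     = nothing
(x ∷ xs) !? zero  = just x
(x ∷ xs) !? suc i = xs !? i

RawClause RawCNF : ℕ → Set
RawClause n = List (Literal n)
RawCNF n = List (RawClause n)

encodeClause : RawClause n → Tree
encodeClause = encodeList encodeLiteral

encodeRaw : RawCNF n → Tree
encodeRaw = encodeList encodeClause

-- A cell is a predicate on polarities; it is stored as its two values.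
encodeCell : (A → Bool → Bool) → A → Tree
encodeCell h a = encodeBool (h a false) ∙ encodeBool (h a true)

encodeVec : (A → Tree) → Vec A n → Tree
encodeVec enc xs = encodeList enc (toList xs)

encodeCells : (A → Bool → Bool) → Vec A n → Tree
encodeCells h = encodeVec (encodeCell h)

matches : Maybe Bool → Bool → Bool
matches nothing      _     = false
matches (just false) false = true
matches (just false) true  = false
matches (just true)  b     = b

marked : Bool → Bool → Bool
marked b _ = b

holds : (A → Bool → Bool) → Vec A n → Literal n → Bool
holds h xs l = h (lookup xs (index l)) (polarity l)

meets : (A → Bool → Bool) → Vec A n → RawClause n → Bool
meets h xs = any (holds h xs)

Partial : ℕ → Set
Partial n = Vec (Maybe Bool) n

Marks : ℕ → Set
Marks n = Vec Bool n

satisfied : Partial n → RawClause n → Bool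
satisfied = meets matches

touched : Marks n → RawClause n → Bool
touched = meets marked

encodePartial : Partial n → Tree
encodePartial = encodeCells matches

encodeMarks : Marks n → Tree
encodeMarks = encodeCells marked

State : ℕ → Set
State n = Marks n × Partial n

encodeState : State n → Tree
encodeState (S , σ) = encodeMarks S ∙ encodePartial σ

wanted : Bool → State n → RawClause n → Bool
wanted b (S , σ) C =
  if satisfied σ C then false else (if touched S C then b else not b)

findWanted : Bool → State n → RawCNF n → Maybe (RawClause n)
findWanted b s []      = nothing
findWanted b s (C ∷ F) = if wanted b s C then just C else findWanted b s F

openLiterals : Marks n → RawClause n → RawClause n
openLiterals S []      = []
openLiterals S (l ∷ C) = if holds marked S l then openLiterals S C else l ∷ openLiterals S C

assumed : Literal n → State n → State n
assumed l (S , σ) = S [ index l ]≔ true , σ [ index l ]≔ just (polarity l)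

markAll : RawClause n → Marks n → Marks n
markAll []      S = S
markAll (l ∷ C) S = markAll C (S [ index l ]≔ true)

applyWord : List ℕ → RawCNF n → Partial n → Partial n
applyWord []      G       σ = σ
applyWord (a ∷ w) []      σ = σ
applyWord (a ∷ w) (C ∷ G) σ = applyWord w G
  (maybe (λ l → σ [ index l ]≔ just (polarity l)) σ (C !? a))

negated : Literal n → Literal n
negated l = literal (index l) (not (polarity l))

encodeMaybe : (A → Tree) → Maybe A → Tree
encodeMaybe enc nothing  = leaf
encodeMaybe enc (just a) = leaf ∙ enc a

treeSize : Tree → ℕ
treeSize leaf    = 1
treeSize (s ∙ t) = suc (treeSize s + treeSize t)

module Run (tT ΔT codeT : Tree) where

  open Table tT ΔT codeT using (table)
  open Cost table public

  module _ where

    quoteTree⇓ : ∀ {ρ : Vec Tree n} t → table , ρ ⊢ quoteTree t ⇓ t ∣ treeSize t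
    quoteTree⇓ leaf    = ⇓nil
    quoteTree⇓ (s ∙ t) = ⇓cons (quoteTree⇓ s) (quoteTree⇓ t)

  module Basic (A : ℕ) (1≤A : 1 ≤ A) where
    open Unit A 1≤A public

    private variable ρ : Vec Tree n

    quote° : ∀ {t} → treeSize t ≤ A → ρ ⊢ quoteTree t ⇓ t [ 1 ▸ [] ]
    quote° {t = t} size≤A = counted (_ , quoteTree⇓ t , one size≤A)

    no° : ρ ⊢ no′ ⇓ encodeBool false [ 1 ▸ [] ]
    no° = nil°

    yes° : ρ ⊢ yes′ ⇓ encodeBool true [ 3 ▸ [] ]
    yes° = nil° ▹° nil°

    mark° : ρ ⊢ mark′ ⇓ encodeCell marked true [ 7 ▸ [] ]
    mark° = yes° ▹° yes°

    cell° : ∀ {e b c Rs} → ρ ⊢ e ⇓ encodeBool b [ c ▸ Rs ] →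
            ρ ⊢ cell′ e ⇓ encodeCell matches (just b) [ suc (c + 5) ▸ Rs ++ [] ]
    cell° {b = false} p = leaf° p (yes° ▹° no°)
    cell° {b = true}  p = node° p (no° ▹° yes°)

    negate° : ∀ {e l c Rs} → ρ ⊢ e ⇓ encodeLiteral {n} l [ c ▸ Rs ] →
              ρ ⊢ negate′ e ⇓ encodeLiteral (negated l) [ suc (c + 7) ▸ Rs ++ [] ]
    negate° {l = literal i false} p = node° p (leaf° var° yes° ▹° var°)
    negate° {l = literal i true}  p = node° p (atMost (m≤m+n 5 2) (node° var° no° ▹° var°))

  module _ where
    open Basic 1 ≤-refl

    get⇓ : (enc : A → Tree) (xs : List A) (i : ℕ) →
           #get ⟨ encodeList enc xs ∙ encodeℕ i ⟩⇓ maybe enc leaf (xs !? i)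
               within level (length xs) 1
    get⇓ enc []       i       = single (unpack₂° (leaf° var° nil°))
    get⇓ enc (x ∷ xs) zero    = single (unpack₂° (node° var° (leaf° var° var°)))
    get⇓ enc (x ∷ xs) (suc i) =
        iterated (unpack₂° (node° var° (node° var° (rec° (var° ▹° var°) (get⇓ enc xs i)))))

    put⇓ : (enc : A → Tree) (xs : Vec A n) (i : Fin n) (a : A) →
           #put ⟨ encodeVec enc xs ∙ encodeℕ (toℕ i) ∙ enc a ⟩⇓ encodeVec enc (xs [ i ]≔ a)
               within level n 1
    put⇓ enc (x ∷ xs) zero    a = single (unpack₃° (node° var° (leaf° var° (var° ▹° var°))))
    put⇓ enc (x ∷ xs) (suc i) a = iterated (unpack₃° (node° var° (node° var°
      (var° ▹° rec° (var° ▹° var° ▹° var°) (put⇓ enc xs i a)))))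

  module Sized (N : ℕ) where

    A₁ A₂ A₃ A₄ : ℕ
    A₁ = level N 1
    A₂ = level N A₁
    A₃ = level N A₂
    A₄ = level N A₃

    1≤A₁ : 1 ≤ A₁
    1≤A₁ = ≤level N 1
    1≤A₂ : 1 ≤ A₂
    1≤A₂ = ≤-trans 1≤A₁ (≤level N A₁)
    1≤A₃ : 1 ≤ A₃
    1≤A₃ = ≤-trans 1≤A₂ (≤level N A₂)

    module _ {n} (n≤N : n ≤ N) where

      open Basic A₁ 1≤A₁

      cellGet⇓ : (h : A → Bool → Bool) (xs : Vec A n) (i : Fin n) →
        #get ⟨ encodeCells h xs ∙ encodeℕ (toℕ i) ⟩⇓ encodeCell h (lookup xs i) within A₁
      cellGet⇓ h xs i = weaken (level-mono 1 (subst (_≤ N) (sym (length-toList xs)) n≤N))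
        (subst (λ v → #get ⟨ encodeCells h xs ∙ encodeℕ (toℕ i) ⟩⇓ v within _)
          (cong (maybe _ _) (toList-!? xs i)) (get⇓ (encodeCell h) (toList xs) (toℕ i)))
        where
        toList-!? : ∀ {m} (xs : Vec A m) i → toList xs !? toℕ i ≡ just (lookup xs i)
        toList-!? (x ∷ xs) zero    = refl
        toList-!? (x ∷ xs) (suc i) = toList-!? xs i

      cellPut⇓ : (h : A → Bool → Bool) (xs : Vec A n) (i : Fin n) (a : A) →
        #put ⟨ encodeCells h xs ∙ encodeℕ (toℕ i) ∙ encodeCell h a ⟩⇓ encodeCells h (xs [ i ]≔ a)
            within A₁
      cellPut⇓ h xs i a = weaken (level-mono 1 n≤N) (put⇓ (encodeCell h) xs i a)

      lit⇓ : (h : A → Bool → Bool) (xs : Vec A n) (l : Literal n) →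
        #lit ⟨ encodeCells h xs ∙ encodeLiteral l ⟩⇓ encodeBool (holds h xs l) within A₂
      lit⇓ h xs (literal i false) =
          single (unpack₂° (node° var°
              (node° (call° ≤-refl (cellGet⇓ h xs i) (var° ▹° var°)) (leaf° var° var°))))
      lit⇓ h xs (literal i true)  =
          single (unpack₂° (node° var°
              (node° (call° ≤-refl (cellGet⇓ h xs i) (var° ▹° var°)) (node° var° var°))))

      assume⇓ : (l : Literal n) (s : State n) →
        #assume ⟨ encodeLiteral l ∙ encodeState s ⟩⇓ encodeState (assumed l s) within A₂
      assume⇓ (literal i b) (S , σ) = single (unpack₂° (node° var° (node° var°
          (call° ≤-refl (cellPut⇓ marked S i true) (var° ▹° var° ▹° mark°) ▹°
           call° ≤-refl (cellPut⇓ matches σ i (just b)) (var° ▹° var° ▹° cell° {b = b} var°)))))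

      mark⇓ : (C : RawClause n) (S : Marks n) →
        #mark ⟨ encodeClause C ∙ encodeMarks S ⟩⇓ encodeMarks (markAll C S)
            within level (length C) A₁
      mark⇓ []      S = single (unpack₂° (leaf° var° var°))
      mark⇓ (l ∷ C) S = iterated (unpack₂° (node° var° (node° var°
        (rec° (var° ▹° call° ≤-refl (cellPut⇓ marked S (index l) true) (var° ▹° var° ▹° mark°))
            (mark⇓ C _)))))

      applyWord⇓ : ∀ w (G : RawCNF n) (σ : Partial n) → All (λ C → length C ≤ N) G →
        #apply ⟨ encodeList encodeℕ w ∙ encodeRaw G ∙ encodePartial σ ⟩⇓ encodePartial
            (applyWord w G σ)
          within level (length w) A₁
      applyWord⇓ []      G       σ ok = single (unpack₃° (leaf° var° var°))
      applyWord⇓ (a ∷ w) []      σ ok = single (unpack₃° (node° var° (leaf° var° var°)))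
      applyWord⇓ (a ∷ w) (C ∷ G) σ (C≤N ∷ ok) with C !? a | weaken (level-mono 1 C≤N)
          (get⇓ encodeLiteral C a)
      ... | nothing | got = iterated (unpack₃° (node° var° (node° var° (leaf°
            (call° ≤-refl got (var° ▹° var°))
            (rec° (var° ▹° var° ▹° var°) (applyWord⇓ w G σ ok))))))
      ... | just l  | got = iterated (unpack₃° (node° var° (node° var° (node°
            (call° ≤-refl got (var° ▹° var°))
            (rec° (var° ▹° var° ▹° call° ≤-refl (cellPut⇓ matches σ (index l) (just (polarity l)))
                (var° ▹° var° ▹° cell° {b = polarity l} var°))
              (applyWord⇓ w G _ ok))))))

identity : Tree → Tree
identity t = t

subtract : ℕ → List Tree → Maybe (List Tree)
subtract zero    r       = just r
subtract (suc d) []      = nothing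
subtract (suc d) (_ ∷ r) = subtract d r

module Run₃ (tT ΔT codeT : Tree) where
  open Run tT ΔT codeT public

  module _ where
    open Basic 1 ≤-refl

    minus⇓ : ∀ d r → #minus ⟨ encodeℕ d ∙ encodeList identity r ⟩⇓
             encodeMaybe (encodeList identity) (subtract d r) within level d 1
    minus⇓ zero    r       = single (unpack₂° (leaf° var° (nil° ▹° var°)))
    minus⇓ (suc d) []      = single (unpack₂° (node° var° (leaf° var° nil°)))
    minus⇓ (suc d) (_ ∷ r) = iterated (unpack₂° (node° var° (node° var°
      (rec° (var° ▹° var°) (minus⇓ d r)))))

    fill⇓ : ∀ {B : Set} {enc : B → Tree} (xs : Vec B n) →
            #fill ⟨ encodeVec enc xs ⟩⇓ encodeList identity (replicate n (leaf ∙ leaf))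
                within level n 1
    fill⇓ []       = single (leaf° var° nil°)
    fill⇓ (x ∷ xs) = iterated (node° var° ((no° ▹° no°) ▹° rec° var° (fill⇓ xs)))

    cells⇓ : (α : Assignment n) →
             #cells ⟨ encodeAssignment α ⟩⇓ encodePartial (Vec.map just α) within level n 1
    cells⇓ []      = single (leaf° var° nil°)
    cells⇓ (b ∷ α) = iterated (node° var° (cell° {b = b} var° ▹° rec° var° (cells⇓ α)))

    finish⇓ : (σ : Partial n) →
      #finish ⟨ encodePartial σ ⟩⇓ encodeAssignment (Vec.map (fromMaybe false) σ) within level n 1
    finish⇓ []                  = single (leaf° var° nil°)
    finish⇓ (nothing ∷ σ)      =
        iterated (node° var° (node° var° (var° ▹° rec° var° (finish⇓ σ))))
    finish⇓ (just false ∷ σ)   =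
        iterated (node° var° (node° var° (var° ▹° rec° var° (finish⇓ σ))))
    finish⇓ (just true ∷ σ)    =
        iterated (node° var° (node° var° (var° ▹° rec° var° (finish⇓ σ))))

  module Sized₃ (N : ℕ) where
    open Sized N public

    module _ {n} (n≤N : n ≤ N) where
      open Basic A₂ 1≤A₂

      sat⇓ : (h : A → Bool → Bool) (xs : Vec A n) (C : RawClause n) →
        #sat ⟨ encodeCells h xs ∙ encodeClause C ⟩⇓ encodeBool (meets h xs C)
            within level (length C) A₂
      sat⇓ h xs []      = single (unpack₂° (leaf° var° no°))
      sat⇓ h xs (l ∷ C) with holds h xs l | lit⇓ n≤N h xs l
      ... | false | l⇓ = iterated (unpack₂° (node° var° (leaf° (call° ≤-refl l⇓ (var° ▹° var°))
                           (rec° (var° ▹° var°) (sat⇓ h xs C)))))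
      ... | true  | l⇓ = single
          (unpack₂° (node° var° (node° (call° ≤-refl l⇓ (var° ▹° var°)) yes°)))

      free⇓ : (S : Marks n) (C : RawClause n) →
        #free ⟨ encodeMarks S ∙ encodeClause C ⟩⇓ encodeClause (openLiterals S C)
            within level (length C) A₂
      free⇓ S []      = single (unpack₂° (leaf° var° nil°))
      free⇓ S (l ∷ C) with holds marked S l | lit⇓ n≤N marked S l
      ... | false | l⇓ = iterated (unpack₂° (node° var° (leaf° (call° ≤-refl l⇓ (var° ▹° var°))
                           (var° ▹° rec° (var° ▹° var°) (free⇓ S C)))))
      ... | true  | l⇓ = iterated (unpack₂° (node° var° (node° (call° ≤-refl l⇓ (var° ▹° var°))
                           (rec° (var° ▹° var°) (free⇓ S C)))))

    module _ {n} (n≤N : n ≤ N) where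
      open Basic A₃ 1≤A₃

      find⇓ : ∀ b (F : RawCNF n) (s : State n) → All (λ C → length C ≤ N) F →
        #find ⟨ encodeBool b ∙ encodeRaw F ∙ encodeState s ⟩⇓
          encodeMaybe encodeClause (findWanted b s F) within level (length F) A₃
      find⇓ b []      (S , σ) []         = single (unpack₄° (leaf° var° nil°))
      find⇓ b (C ∷ F) (S , σ) (C≤N ∷ ok)
        with satisfied σ C | weaken (level-mono A₂ C≤N) (sat⇓ n≤N matches σ C)
           | touched S C   | weaken (level-mono A₂ C≤N) (sat⇓ n≤N marked S C)
      ... | true  | p | _     | _ =
          iterated (unpack₄° (node° var° (node° (call° ≤-refl p (var° ▹° var°))
              (rec° (var° ▹° var° ▹° var° ▹° var°) (find⇓ b F (S , σ) ok)))))
      find⇓ false (C ∷ F) (S , σ) (C≤N ∷ ok) | false | p | false | q =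
        single (unpack₄° (node° var°
            (leaf° (call° ≤-refl p (var° ▹° var°)) (leaf° (call° ≤-refl q (var° ▹° var°))
          (leaf° var° (nil° ▹° var°))))))
      find⇓ true (C ∷ F) (S , σ) (C≤N ∷ ok) | false | p | false | q =
        iterated (unpack₄° (node° var°
            (leaf° (call° ≤-refl p (var° ▹° var°)) (leaf° (call° ≤-refl q (var° ▹° var°))
          (node° var° (rec° (var° ▹° var° ▹° var° ▹° var°) (find⇓ true F (S , σ) ok)))))))
      find⇓ false (C ∷ F) (S , σ) (C≤N ∷ ok) | false | p | true | q =
        iterated (unpack₄° (node° var°
            (leaf° (call° ≤-refl p (var° ▹° var°)) (node° (call° ≤-refl q (var° ▹° var°))
          (leaf° var° (rec° (var° ▹° var° ▹° var° ▹° var°) (find⇓ false F (S , σ) ok)))))))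
      find⇓ true (C ∷ F) (S , σ) (C≤N ∷ ok) | false | p | true | q =
        single (unpack₄° (node° var°
            (leaf° (call° ≤-refl p (var° ▹° var°)) (node° (call° ≤-refl q (var° ▹° var°))
          (node° var° (nil° ▹° var°))))))

-- Partial assignments and distance

any-false : (p : A → Bool) {xs : List A} → any p xs ≡ false → ∀ {x} → x ∈ xs → p x ≡ false
any-false p {x ∷ xs} eq (here refl) with p x
... | false = refl
any-false p {x ∷ xs} eq (there x∈xs) with p x
... | false = any-false p eq x∈xs

any-true : (p : A → Bool) {xs : List A} → any p xs ≡ true → ∃ λ x → x ∈ xs × p x ≡ true
any-true p {x ∷ xs} eq with p x in px
... | true  = x , here refl , px
... | false with y , y∈xs , py ← any-true p {xs} eq = y , there y∈xs , py

any-intro : (p : A → Bool) {xs : List A} → ∀ {x} → x ∈ xs → p x ≡ true → any p xs ≡ true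
any-intro p {xs} x∈xs px with any p xs in eq
... | true  = refl
... | false with () ← trans (sym px) (any-false p eq x∈xs)

matches-refl : ∀ b → matches (just b) b ≡ true
matches-refl false = refl
matches-refl true  = refl

matches-true : ∀ {c b} → matches c b ≡ true → c ≡ just b
matches-true {just false} {false} _ = refl
matches-true {just true}  {true}  _ = refl

_⊨ʳ_ : Assignment n → RawCNF n → Set
β ⊨ʳ F = All (Any (β ⊨ˡ_)) F

true-literal : ∀ {β : Assignment n} {F C} → β ⊨ʳ F → C ∈ F → ∃ λ l → l ∈ C × β ⊨ˡ l
true-literal βF C∈F = witness (All.lookup βF C∈F)

wanted-true : ∀ {b} {S : Marks n} {σ C} → wanted b (S , σ) C ≡ true →
              satisfied σ C ≡ false × touched S C ≡ b
wanted-true {b = b} {S} {σ} {C} eq with satisfied σ C | touched S C | b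
... | false | false | false = refl , refl
... | false | true  | true  = refl , refl

wanted-false : ∀ {b} {S : Marks n} {σ C} → wanted b (S , σ) C ≡ false →
               satisfied σ C ≡ false → touched S C ≡ not b
wanted-false {b = b} {S} {σ} {C} eq unsat with satisfied σ C | touched S C | b
... | false | false | true  = refl
... | false | true  | false = refl

findWanted-just : ∀ b s (F : RawCNF n) {C} → findWanted b s F ≡ just C →
    C ∈ F × wanted b s C ≡ true
findWanted-just b s (C ∷ F) eq with wanted b s C in w
findWanted-just b s (C ∷ F) refl | true = here refl , w
... | false with C∈F , w′ ← findWanted-just b s F eq = there C∈F , w′

findWanted-nothing : ∀ b s (F : RawCNF n) → findWanted b s F ≡ nothing → ∀ {C} → C ∈ F →
    wanted b s C ≡ false
findWanted-nothing b s (C ∷ F) eq C∈F with wanted b s C in w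
findWanted-nothing b s (C ∷ F) eq (here refl) | false = w
findWanted-nothing b s (C ∷ F) eq (there C∈F) | false = findWanted-nothing b s F eq C∈F

openLiterals-∈ : ∀ {S : Marks n} {C l} → l ∈ C → holds marked S l ≡ false → l ∈ openLiterals S C
openLiterals-∈ {S = S} {l ∷ C} (here refl) eq with holds marked S l
openLiterals-∈ {S = S} {l ∷ C} (here refl) eq | false = here refl
openLiterals-∈ {S = S} {m ∷ C} (there l∈C) eq with holds marked S m
... | false = there (openLiterals-∈ l∈C eq)
... | true  = openLiterals-∈ l∈C eq

openLiterals-≤ : ∀ (S : Marks n) C → length (openLiterals S C) ≤ length C
openLiterals-≤ S []      = z≤n
openLiterals-≤ S (l ∷ C) with holds marked S l
... | false = s≤s (openLiterals-≤ S C)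
... | true  = m≤n⇒m≤1+n (openLiterals-≤ S C)

openLiterals-< : ∀ (S : Marks n) C → touched S C ≡ true → length (openLiterals S C) < length C
openLiterals-< S (l ∷ C) eq with holds marked S l
... | false = s≤s (openLiterals-< S C eq)
... | true  = s≤s (openLiterals-≤ S C)

dist : Partial n → Assignment n → ℕ
dist []      []      = 0
dist (c ∷ σ) (b ∷ β) = if matches c b then dist σ β else suc (dist σ β)

dist-≤ : (σ : Partial n) (β : Assignment n) → dist σ β ≤ n
dist-≤ []      []      = z≤n
dist-≤ (c ∷ σ) (b ∷ β) with matches c b
... | false = s≤s (dist-≤ σ β)
... | true  = m≤n⇒m≤1+n (dist-≤ σ β)

private
  dist-here : ∀ c b {x} → x ≤ (if matches c b then x else suc x)
  dist-here c b with matches c b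
  ... | false = n≤1+n _
  ... | true  = ≤-refl

  dist-there : ∀ c b {x y} → x ≤ y →
      (if matches c b then x else suc x) ≤ (if matches c b then y else suc y)
  dist-there c b x≤y with matches c b
  ... | false = s≤s x≤y
  ... | true  = x≤y

  dist-here′ : ∀ c b {x} → (if matches c b then x else suc x) ≤ suc x
  dist-here′ c b with matches c b
  ... | false = ≤-refl
  ... | true  = n≤1+n _

dist-correct : ∀ (σ : Partial n) β l → β ⊨ˡ l →
               dist (σ [ index l ]≔ just (polarity l)) β ≤ dist σ β
dist-correct (c ∷ σ) (b ∷ β) (literal zero b)    refl rewrite matches-refl b = dist-here c b
dist-correct (c ∷ σ) (b ∷ β) (literal (suc i) a) eq =
    dist-there c b (dist-correct σ β (literal i a) eq)

dist-repair : ∀ (σ : Partial n) β l → β ⊨ˡ l → holds matches σ l ≡ false →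
              dist (σ [ index l ]≔ just (polarity l)) β < dist σ β
dist-repair (c ∷ σ) (b ∷ β) (literal zero b)    refl eq rewrite matches-refl b | eq = ≤-refl
dist-repair (c ∷ σ) (b ∷ β) (literal (suc i) a) eq   h with matches c b
... | false = s≤s (dist-repair σ β (literal i a) eq h)
... | true  = dist-repair σ β (literal i a) eq h

dist-change : ∀ (σ : Partial n) β i c → dist (σ [ i ]≔ c) β ≤ suc (dist σ β)
dist-change (d ∷ σ) (b ∷ β) zero    c = ≤-trans (dist-here′ c b) (s≤s (dist-here d b))
dist-change (d ∷ σ) (b ∷ β) (suc i) c with matches d b
... | false = s≤s (dist-change σ β i c)
... | true  = dist-change σ β i c

dist-hamming : ∀ (α β : Assignment n) → dist (Vec.map just α) β ≡ hamming α β
dist-hamming []          []          = refl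
dist-hamming (false ∷ α) (false ∷ β) = dist-hamming α β
dist-hamming (false ∷ α) (true  ∷ β) = cong suc (dist-hamming α β)
dist-hamming (true  ∷ α) (false ∷ β) = cong suc (dist-hamming α β)
dist-hamming (true  ∷ α) (true  ∷ β) = dist-hamming α β

lookup-set : ∀ (xs : Vec A n) i {a} → lookup (xs [ i ]≔ a) i ≡ a
lookup-set xs i = lookup∘updateAt i xs

lookup-unset : ∀ (xs : Vec A n) {i j a} → j ≢ i → lookup (xs [ i ]≔ a) j ≡ lookup xs j
lookup-unset xs {i} {j} j≢i = lookup∘updateAt′ j i j≢i xs

set-true : ∀ (S : Marks n) i {j} → lookup S j ≡ true → lookup (S [ i ]≔ true) j ≡ true
set-true S i {j} eq with j ≟ᶠ i
... | yes refl = lookup-set S i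
... | no j≢i   = trans (lookup-unset S j≢i) eq

Agree : State n → Assignment n → Set
Agree (S , σ) β = ∀ i → lookup S i ≡ true → lookup σ i ≡ just (lookup β i)

agree-assumed : ∀ {s : State n} {β} l → β ⊨ˡ l → Agree s β → Agree (assumed l s) β
agree-assumed {s = S , σ} l βl agree i Si with i ≟ᶠ index l
... | yes refl = trans (lookup-set σ i) (cong just (sym βl))
... | no i≢l   = trans (lookup-unset σ i≢l) (agree i (trans (sym (lookup-unset S i≢l)) Si))

-- A literal that a satisfying assignment uses in an unsatisfied clause is
-- unmarked, for on marked variables the two assignments agree.
agree-open : ∀ {S : Marks n} {σ β l} → Agree (S , σ) β → β ⊨ˡ l → holds matches σ l ≡ false →
             holds marked S l ≡ false
agree-open {S = S} {σ} {β} {l} agree βl h with lookup S (index l) in Sl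
... | false = refl
... | true rewrite agree (index l) Sl | βl with () ← trans (sym h) (matches-refl (polarity l))

data Reach {n} : State n → State n → Set where
  start : ∀ {s} → Reach s s
  assuming : ∀ {s s′} l → Reach (assumed l s) s′ → Reach s s′

reach-invariant : ∀ {n} (I : State n → Set) → (∀ l s → I s → I (assumed l s)) →
                  ∀ {s s′} → Reach s s′ → I s → I s′
reach-invariant I pres start       Is = Is
reach-invariant I pres (assuming l r) Is = reach-invariant I pres r (pres l _ Is)

module _ (F : RawCNF n) where

  Closed Covered : State n → Set
  Closed  (S , σ) = ∀ {C} → C ∈ F → satisfied σ C ≡ false → touched S C ≡ false
  Covered (S , σ) = ∀ {C} → C ∈ F → satisfied σ C ≡ false → touched S C ≡ true

  covered-assumed : ∀ l s → Covered s → Covered (assumed l s)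
  covered-assumed l (S , σ) cov {C} C∈F unsat with satisfied σ C in eq
  ... | false with m , m∈C , Sm ← any-true (holds marked S) {C} (cov C∈F eq) =
          any-intro (holds marked S′) m∈C (set-true S (index l) Sm)
    where S′ = S [ index l ]≔ true
  ... | true with m , m∈C , σm ← any-true (holds matches σ) {C} eq with index m ≟ᶠ index l
  ...   | yes refl = any-intro (holds marked (S [ index l ]≔ true)) m∈C (lookup-set S (index l))
  ...   | no m≢l with () ← trans (sym unsat)
      (any-intro (holds matches (σ [ index l ]≔ just (polarity l))) m∈C
                     (trans (cong (λ c → matches c (polarity m)) (lookup-unset σ m≢l)) σm))

  closed-covered : ∀ {s} → Closed s → Covered s → ∀ {C} → C ∈ F → satisfied (proj₂ s) C ≡ true
  closed-covered {S , σ} clo cov {C} C∈F with satisfied σ C in eq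
  ... | true  = refl
  ... | false with () ← trans (sym (clo C∈F eq)) (cov C∈F eq)

-- Searching, with frozen variables

branchCost : ℕ → ℕ → ℕ → ℕ
branchCost A zero    x = once A
branchCost A (suc m) x = once A + (x + branchCost A m x)

branchCost-mono : ∀ A {m m′} x → m ≤ m′ → branchCost A m x ≤ branchCost A m′ x
branchCost-mono A {m′ = zero}   x z≤n     = ≤-refl
branchCost-mono A {m′ = suc m′} x z≤n     = m≤m+n (once A) _
branchCost-mono A {m′ = suc m′} x (s≤s p) =
    +-monoʳ-≤ (once A) (+-monoʳ-≤ x (branchCost-mono A x p))

searchCost : ℕ → ℕ → ℕ → ℕ
searchCost A κ zero    = once A
searchCost A κ (suc r) = once A + branchCost A κ (searchCost A κ r)

enumCost : ℕ → ℕ → ℕ → ℕ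
enumCost A x zero    = once A + x
enumCost A x (suc m) = once A + (enumCost A x m + enumCost A x m)

weight : ∀ {n} → RawCNF n → ℕ
weight []            = 0
weight ([]      ∷ G) = suc (weight G)
weight ((l ∷ C) ∷ G) = suc (weight (C ∷ G))

encodeResult : ∀ {n} → Maybe (State n) → Tree
encodeResult nothing  = leaf
encodeResult (just s) = encodeState s

module Searching (tT ΔT codeT : Tree) (N : ℕ) {n} (n≤N : n ≤ N) (F : RawCNF n) (κ : ℕ)
                 (κ<N : κ < N) (F≤N : length F ≤ N) (width : All (λ C → length C ≤ suc κ) F) where

  open Run₃ tT ΔT codeT public
  open Sized₃ N public

  A₄-unit : 1 ≤ A₄
  A₄-unit = ≤-trans 1≤A₃ (≤level N A₃)

  open Basic A₄ A₄-unit public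

  short : All (λ C → length C ≤ N) F
  short = All.map (λ C≤ → ≤-trans C≤ κ<N) width

  A₁≤A₄ : A₁ ≤ A₄
  A₁≤A₄ = ≤-trans (≤level N A₁) (≤-trans (≤level N A₂) (≤level N A₃))

  A₂≤A₄ : A₂ ≤ A₄
  A₂≤A₄ = ≤-trans (≤level N A₂) (≤level N A₃)

  A₃≤A₄ : A₃ ≤ A₄
  A₃≤A₄ = ≤level N A₃

  found⇓ : ∀ b s → #find ⟨ encodeBool b ∙ encodeRaw F ∙ encodeState s ⟩⇓
           encodeMaybe encodeClause (findWanted b s F) within A₄
  found⇓ b s = weaken (level-mono A₃ F≤N) (find⇓ n≤N b F s short)

  Unsolvable : ℕ → State n → Set
  Unsolvable r s = ∀ β → β ⊨ʳ F → Agree s β → dist (proj₂ s) β ≤ r → ⊥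

  SearchSpec : ℕ → State n → Maybe (State n) → Set
  SearchSpec r s nothing   = Unsolvable r s
  SearchSpec r s (just s′) = Reach s s′ × Closed F s′

  BranchSpec : RawClause n → ℕ → State n → Maybe (State n) → Set
  BranchSpec L r s nothing   = ∀ {l} → l ∈ L → Unsolvable r (assumed l s)
  BranchSpec L r s (just s′) = ∃ λ l → l ∈ L × Reach (assumed l s) s′ × Closed F s′

  unsat-false : ∀ {σ : Partial n} {C} → satisfied σ C ≡ false → ∀ {l} → l ∈ C →
      holds matches σ l ≡ false
  unsat-false {σ} {C} unsat = any-false (holds matches σ) {C} unsat

  mutual

    search⇓ : ∀ rs s → ∃ λ res → SearchSpec (length rs) s res ×
      #search ⟨ encodeRaw F ∙ encodeList identity rs ∙ encodeState s ⟩⇓ encodeResult res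
        within searchCost A₄ κ (length rs)
    search⇓ rs s@(S , σ) with findWanted true s F in eq | found⇓ true s
    ... | nothing | found = just s , (start , closed) ,
          weaken (searchCost-once rs)
              (total₀ (unpack₃° (leaf° (call° ≤-refl found (yes° ▹° var° ▹° var°)) var°)))
      where
      closed : Closed F s
      closed {C} C∈F unsat =
          wanted-false {S = S} {σ} {C} (findWanted-nothing true s F eq C∈F) unsat
      searchCost-once : ∀ rs → once A₄ ≤ searchCost A₄ κ (length rs)
      searchCost-once []       = ≤-refl
      searchCost-once (_ ∷ rs) = m≤m+n _ _
    search⇓ [] s@(S , σ) | just C | found = nothing , impossible ,
          total₀ (unpack₃° (node° (call° ≤-refl found (yes° ▹° var° ▹° var°)) (leaf° var° nil°)))
      where
      impossible : Unsolvable 0 s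
      impossible β βF agree d≤0
        with C∈F , w ← findWanted-just true s F eq
        with l , l∈C , βl ← true-literal {β = β} βF C∈F =
        n≮0 (≤-trans (dist-repair σ β l βl
            (unsat-false {σ} {C} (proj₁ (wanted-true {S = S} {σ} {C} w)) l∈C)) d≤0)
    search⇓ (x ∷ rs) s@(S , σ) | just C | found
      with C∈F , w ← findWanted-just true s F eq
      with unsat , touch ← wanted-true {S = S} {σ} {C} w
      with branch⇓ (openLiterals S C) rs s
    ... | res , spec , run = res , reduce res spec ,
          weaken (+-monoʳ-≤ (once A₄) (branchCost-mono A₄ _ few))
            (total₁ (unpack₃° (node° (call° ≤-refl found (yes° ▹° var° ▹° var°))
                (node° var° (node° var°
              (rec° (call° free≤ (free⇓ n≤N S C) (var° ▹° var°) ▹° var° ▹° var° ▹° var°) run))))))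
      where
      few : length (openLiterals S C) ≤ κ
      few = ≤-pred (≤-trans (openLiterals-< S C touch) (All.lookup width C∈F))
      free≤ : level (length C) A₂ ≤ A₄
      free≤ = ≤-trans (level-mono A₂ (All.lookup short C∈F)) A₃≤A₄
      reduce : ∀ res → BranchSpec (openLiterals S C) (length rs) s res →
          SearchSpec (suc (length rs)) s res
      reduce (just s′) (l , _ , reach , closed) = assuming l reach , closed
      reduce nothing none β βF agree d≤
        with l , l∈C , βl ← true-literal {β = β} βF C∈F =
        none (openLiterals-∈ l∈C (agree-open {S = S} {σ} {β} {l} agree βl l-false)) β βF
            (agree-assumed {s = s} {β} l βl agree)
          (≤-pred (≤-trans (dist-repair σ β l βl l-false) d≤))
        where l-false = unsat-false {σ} {C} unsat l∈C

    branch⇓ : ∀ L rs s → ∃ λ res → BranchSpec L (length rs) s res ×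
      #branch ⟨ encodeClause L ∙ encodeRaw F ∙ encodeList identity rs ∙ encodeState s ⟩⇓
          encodeResult res
        within branchCost A₄ (length L) (searchCost A₄ κ (length rs))
    branch⇓ []      rs s = nothing , (λ ()) , total₀ (unpack₄° (leaf° var° nil°))
    branch⇓ (l ∷ L) rs s with search⇓ rs (assumed l s)
    ... | just s′ , (reach , closed) , run = just s′ , (l , here refl , reach , closed) ,
          weaken (+-monoʳ-≤ (once A₄) (m≤m+n _ _))
            (total₁ (unpack₄° (node° var° (node°
              (rec° (var° ▹° var° ▹° call° A₂≤A₄ (assume⇓ n≤N l s) (var° ▹° var°)) run)
                  (var° ▹° var°)))))
    ... | nothing , none , run with branch⇓ L rs s
    ...   | res , spec , run′ = res , extend res spec ,
          total₂ (unpack₄° (node° var° (leaf°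
              (rec° (var° ▹° var° ▹° call° A₂≤A₄ (assume⇓ n≤N l s) (var° ▹° var°)) run)
              (rec° (var° ▹° var° ▹° var° ▹° var°) run′))))
      where
      extend : ∀ res → BranchSpec L (length rs) s res → BranchSpec (l ∷ L) (length rs) s res
      extend (just s′) (m , m∈L , p) = m , there m∈L , p
      extend nothing   none′ (here refl) = none
      extend nothing   none′ (there m∈L) = none′ m∈L

  AgreeOff : RawCNF n → State n → Assignment n → Set
  AgreeOff G (S , σ) β = ∀ i → lookup S i ≡ true →
    Any (Any (λ l → index l ≡ i)) G ⊎ lookup σ i ≡ just (lookup β i)

  agreeOff-assumed : ∀ {l C G s β} m → index m ≡ index l → β ⊨ˡ m →
                     AgreeOff ((l ∷ C) ∷ G) s β → AgreeOff (C ∷ G) (assumed m s) β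
  agreeOff-assumed {s = S , σ} m m≡l βm agree i Si with i ≟ᶠ index m
  ... | yes refl = inj₂ (trans (lookup-set σ i) (cong just (sym βm)))
  ... | no i≢m with agree i (trans (sym (lookup-unset S i≢m)) Si)
  ...   | inj₁ (here (here l≡i)) = ⊥-elim (i≢m (sym (trans m≡l l≡i)))
  ...   | inj₁ (here (there p))  = inj₁ (here p)
  ...   | inj₁ (there p)         = inj₁ (there p)
  ...   | inj₂ eq                = inj₂ (trans (lookup-unset σ i≢m) eq)

  EnumSpec : RawCNF n → ℕ → State n → Maybe (State n) → Set
  EnumSpec G r s nothing   = ∀ β → β ⊨ʳ F → AgreeOff G s β → dist (proj₂ s) β ≤ r → ⊥
  EnumSpec G r s (just s′) = Reach s s′ × Closed F s′

  mutual

    enum⇓ : ∀ G rs s → ∃ λ res → EnumSpec G (length rs) s res ×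
      #enum ⟨ encodeRaw G ∙ encodeRaw F ∙ encodeList identity rs ∙ encodeState s ⟩⇓ encodeResult
          res
        within enumCost A₄ (searchCost A₄ κ (length rs)) (weight G)
    enumClause⇓ : ∀ C G rs s → ∃ λ res → EnumSpec (C ∷ G) (length rs) s res ×
      #enum ⟨ encodeRaw (C ∷ G) ∙ encodeRaw F ∙ encodeList identity rs ∙ encodeState s ⟩⇓
          encodeResult res
        within enumCost A₄ (searchCost A₄ κ (length rs)) (weight (C ∷ G))

    enum⇓ [] rs s with search⇓ rs s
    ... | res , spec , run = res , reduce res spec ,
          total₁ (unpack₄° (leaf° var° (rec° (var° ▹° var° ▹° var°) run)))
      where
      reduce : ∀ res → SearchSpec (length rs) s res → EnumSpec [] (length rs) s res
      reduce (just s′) spec = spec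
      reduce nothing none β βF agree = none β βF λ i Si → fromInj₂ (λ ()) (agree i Si)
    enum⇓ (C ∷ G) rs s = enumClause⇓ C G rs s

    enumClause⇓ [] G rs s with enum⇓ G rs s
    ... | res , spec , run = res , reduce res spec ,
          weaken (+-monoʳ-≤ (once A₄) (m≤m+n _ _))
            (total₁ (unpack₄° (node° var°
                (leaf° var° (rec° (var° ▹° var° ▹° var° ▹° var°) run)))))
      where
      reduce : ∀ res → EnumSpec G (length rs) s res → EnumSpec ([] ∷ G) (length rs) s res
      reduce (just s′) spec = spec
      reduce nothing none β βF agree = none β βF λ i Si → drop (agree i Si)
        where
        drop : ∀ {i} {Q : Set} → Any (Any (λ l → index l ≡ i)) ([] ∷ G) ⊎ Q →
               Any (Any (λ l → index l ≡ i)) G ⊎ Q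
        drop (inj₁ (there p)) = inj₁ p
        drop (inj₂ q)         = inj₂ q
    enumClause⇓ (l ∷ C) G rs s with enumClause⇓ C G rs (assumed l s)
    ... | just s′ , (reach , closed) , run = just s′ , (assuming l reach , closed) ,
          weaken (+-monoʳ-≤ (once A₄) (m≤m+n _ _))
            (total₁ (unpack₄° (node° var° (node° var° (node°
              (rec° ((var° ▹° var°) ▹° var° ▹° var° ▹° call° A₂≤A₄ (assume⇓ n≤N l s)
                  (var° ▹° var°)) run)
              (var° ▹° var°))))))
    ... | nothing , none , run with enumClause⇓ C G rs (assumed (negated l) s)
    ...   | res , spec , run′ = res , reduce res spec ,
          total₂ (unpack₄° (node° var° (node° var° (leaf°
              (rec° ((var° ▹° var°) ▹° var° ▹° var° ▹° call° A₂≤A₄ (assume⇓ n≤N l s)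
                  (var° ▹° var°)) run)
              (rec° ((var° ▹° var°) ▹° var° ▹° var° ▹°
                call° A₂≤A₄ (assume⇓ n≤N (negated l) s) (negate° {l = l} var° ▹° var°)) run′)))))
      where
      reduce : ∀ res → EnumSpec (C ∷ G) (length rs) (assumed (negated l) s) res →
               EnumSpec ((l ∷ C) ∷ G) (length rs) s res
      reduce (just s′) (reach , closed) = assuming (negated l) reach , closed
      reduce nothing none′ β βF agree d≤ with lookup β (index l) ≟ᵇ polarity l
      ... | yes βl = none β βF (agreeOff-assumed {l} {s = s} {β} l refl βl agree)
                       (≤-trans (dist-correct (proj₂ s) β l βl) d≤)
      ... | no ¬βl = none′ β βF
          (agreeOff-assumed {l} {s = s} {β} (negated l) refl (¬-not ¬βl) agree)
                       (≤-trans (dist-correct (proj₂ s) β (negated l) (¬-not ¬βl)) d≤)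

-- Code steps

Word : ℕ → ℕ → Set
Word k t = Vec (Fin k) t

mismatches : ∀ {k t} → Word k t → Word k t → ℕ
mismatches []      []        = 0
mismatches (a ∷ w) (a′ ∷ w′) with a ≟ᶠ a′
... | yes _ = mismatches w w′
... | no  _ = suc (mismatches w w′)

positions : ∀ {k t} → Word k t → List ℕ
positions w = toList (Vec.map toℕ w)

encodeCode : ∀ {k t} → List (Word k t) → Tree
encodeCode = encodeList (λ w → encodeList encodeℕ (positions w))

Disjoint : RawClause n → RawClause n → Set
Disjoint C D = ∀ {l m} → l ∈ C → m ∈ D → index l ≢ index m

data Hits {n k} (β : Assignment n) : ∀ {t} → Word k t → RawCNF n → Set where
  []  : Hits β [] []
  hit : ∀ {t a l C G} {w : Word k t} → C !? toℕ a ≡ just l → β ⊨ˡ l → Hits β w G →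
      Hits β (a ∷ w) (C ∷ G)

!?-∈ : ∀ (xs : List A) i {x} → xs !? i ≡ just x → x ∈ xs
!?-∈ (x ∷ xs) zero    refl = here refl
!?-∈ (x ∷ xs) (suc i) eq   = there (!?-∈ xs i eq)

∈-!? : ∀ {xs : List A} {x} (x∈xs : x ∈ xs) → xs !? toℕ (Any.index x∈xs) ≡ just x
∈-!? (here refl) = refl
∈-!? (there x∈)  = ∈-!? x∈

unsat-disjoint : ∀ {σ : Partial n} {C} i c → (∀ {l} → l ∈ C → index l ≢ i) →
                 satisfied σ C ≡ false → satisfied (σ [ i ]≔ c) C ≡ false
unsat-disjoint {σ = σ} {[]}    i c away unsat = refl
unsat-disjoint {σ = σ} {l ∷ C} i c away unsat
  rewrite lookup-unset σ {a = c} (away (here refl)) with holds matches σ l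
... | false = unsat-disjoint {σ = σ} {C} i c (λ m∈C → away (there m∈C)) unsat

applyWord-dist : ∀ {k t} (w w* : Word k t) G σ (β : Assignment n) → AllPairs Disjoint G →
  All (λ C → satisfied σ C ≡ false) G → Hits β w* G →
  dist (applyWord (positions w) G σ) β + t ≤ dist σ β + 2 * mismatches w w*
applyWord-dist [] [] [] σ β _ _ _ = ≤-refl
applyWord-dist {t = suc t} (a ∷ w) (a* ∷ w*) (C ∷ G) σ β (disj ∷ pairs) (unsat ∷ unsats)
    (hit {l = l} C!a βl hits)
  with a ≟ᶠ a*
... | yes refl rewrite C!a = begin
    dist σ″ β + suc t            ≡⟨ +-suc _ t ⟩
    suc (dist σ″ β + t)          ≤⟨ s≤s (applyWord-dist w w* G _ β pairs unsats′ hits) ⟩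
    suc (dist σ′ β) + 2 * m      ≤⟨ +-monoˡ-≤ (2 * m)
        (dist-repair σ β l βl (any-false (holds matches σ) {C} unsat l∈C)) ⟩
    dist σ β + 2 * m             ∎
  where
  open ≤-Reasoning
  m  = mismatches w w*
  σ′ = σ [ index l ]≔ just (polarity l)
  σ″ = applyWord (positions w) G σ′
  l∈C = !?-∈ C (toℕ a) C!a
  unsats′ : All (λ D → satisfied σ′ D ≡ false) G
  unsats′ = All.zipWith
      (λ {D} (d , u) → unsat-disjoint {σ = σ} {D} (index l) _ (λ m∈D → ≢-sym (d l∈C m∈D)) u)
          (disj , unsats)
... | no _ with C !? toℕ a in C!a′
...   | nothing = begin
    dist σ″ β + suc t                       ≡⟨ +-suc _ t ⟩
    suc (dist σ″ β + t)                     ≤⟨ s≤s (applyWord-dist w w* G σ β pairs unsats hits) ⟩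
    suc (dist σ β + 2 * m)                  ≤⟨ n≤1+n _ ⟩
    2 + (dist σ β + 2 * m)                  ≡⟨ x∙yz≈y∙xz 2 (dist σ β) (2 * m) ⟩
    dist σ β + (2 + 2 * m)                  ≡⟨ cong (dist σ β +_) (*-suc 2 m) ⟨
    dist σ β + 2 * suc m                    ∎
  where
  open ≤-Reasoning
  m = mismatches w w*
  σ″ = applyWord (positions w) G σ
...   | just l′ = begin
    dist σ″ β + suc t                       ≡⟨ +-suc _ t ⟩
    suc (dist σ″ β + t)                     ≤⟨ s≤s (applyWord-dist w w* G _ β pairs unsats′ hits)
        ⟩
    suc (dist σ′ β + 2 * m)                 ≤⟨ s≤s
        (+-monoˡ-≤ (2 * m) (dist-change σ β (index l′) _)) ⟩
    2 + (dist σ β + 2 * m)                  ≡⟨ x∙yz≈y∙xz 2 (dist σ β) (2 * m) ⟩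
    dist σ β + (2 + 2 * m)                  ≡⟨ cong (dist σ β +_) (*-suc 2 m) ⟨
    dist σ β + 2 * suc m                    ∎
  where
  open ≤-Reasoning
  m = mismatches w w*
  σ′ = σ [ index l′ ]≔ just (polarity l′)
  σ″ = applyWord (positions w) G σ′
  l′∈C = !?-∈ C (toℕ a) C!a′
  unsats′ : All (λ D → satisfied σ′ D ≡ false) G
  unsats′ = All.zipWith
      (λ {D} (d , u) → unsat-disjoint {σ = σ} {D} (index l′) _ (λ m∈D → ≢-sym (d l′∈C m∈D)) u)
          (disj , unsats)

hits : ∀ {k t} {β : Assignment n} G → length G ≡ t → All (λ C → length C ≤ k) G → β ⊨ʳ G →
       ∃ λ (w : Word k t) → Hits β w G
hits []      refl []        []        = [] , []
hits {k = k} {β = β} (C ∷ G) refl (C≤k ∷ ≤k) (βC ∷ βG)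
  with w , ws ← hits G refl ≤k βG | l , l∈C , βl ← witness βC =
  inject≤ (Any.index l∈C) C≤k ∷ w ,
  hit (trans (cong (C !?_) (toℕ-inject≤ _ C≤k)) (∈-!? l∈C)) βl ws

markAll-marked : ∀ C {S : Marks n} {i} → lookup S i ≡ true → lookup (markAll C S) i ≡ true
markAll-marked []      Si = Si
markAll-marked (l ∷ C) {S} Si = markAll-marked C (set-true S (index l) Si)

markAll-∈ : ∀ {C l} {S : Marks n} → l ∈ C → lookup (markAll C S) (index l) ≡ true
markAll-∈ {C = l ∷ C} {S = S} (here refl) = markAll-marked C (lookup-set S (index l))
markAll-∈ {C = m ∷ C} (there l∈C)         = markAll-∈ l∈C

markAll-only : ∀ C {S : Marks n} {i} → lookup (markAll C S) i ≡ true →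
               Any (λ l → index l ≡ i) C ⊎ lookup S i ≡ true
markAll-only []      eq = inj₂ eq
markAll-only (l ∷ C) {S} {i} eq with markAll-only C eq
... | inj₁ p = inj₁ (there p)
... | inj₂ q with i ≟ᶠ index l
...   | yes refl = inj₁ (here refl)
...   | no i≢l   = inj₂ (trans (sym (lookup-unset S i≢l)) q)

subtract-just : ∀ d rs {rs′} → subtract d rs ≡ just rs′ → length rs ≡ d + length rs′
subtract-just zero    rs       refl = refl
subtract-just (suc d) (_ ∷ rs) eq   = cong suc (subtract-just d rs eq)

subtract-nothing : ∀ d rs → subtract d rs ≡ nothing → length rs < d
subtract-nothing (suc d) []       eq = s≤s z≤n
subtract-nothing (suc d) (_ ∷ rs) eq = s≤s (subtract-nothing d rs eq)

weight-≤ : ∀ {k} (G : RawCNF n) → All (λ C → length C ≤ k) G → weight G ≤ length G * suc k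
weight-≤ []      []       = z≤n
weight-≤ {k = k} (C ∷ G) (C≤ ∷ ≤k) = bound C C≤
  where
  exact : ∀ C → weight (C ∷ G) ≡ suc (length C) + weight G
  exact []      = refl
  exact (l ∷ C) = cong suc (exact C)
  bound : ∀ C → length C ≤ k → weight (C ∷ G) ≤ suc k + length G * suc k
  bound C C≤k = ≤-trans (≤-reflexive (exact C)) (+-mono-≤ (s≤s C≤k) (weight-≤ G ≤k))

enumCost-mono : ∀ A {x x′ m m′} → x ≤ x′ → m ≤ m′ → enumCost A x m ≤ enumCost A x′ m′
enumCost-mono A {m′ = zero}   x≤ z≤n = +-monoʳ-≤ (once A) x≤
enumCost-mono A {m′ = suc m′} x≤ z≤n =
    ≤-trans (enumCost-mono A {m = 0} {m′} x≤ z≤n) (≤-trans (m≤m+n _ _) (m≤n+m _ (once A)))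
enumCost-mono A {m′ = suc m′} x≤ (s≤s m≤) =
    +-monoʳ-≤ (once A) (+-mono-≤ (enumCost-mono A x≤ m≤) (enumCost-mono A x≤ m≤))

branchCost-monoʳ : ∀ A m {x x′} → x ≤ x′ → branchCost A m x ≤ branchCost A m x′
branchCost-monoʳ A zero    x≤ = ≤-refl
branchCost-monoʳ A (suc m) x≤ = +-monoʳ-≤ (once A) (+-mono-≤ x≤ (branchCost-monoʳ A m x≤))

searchCost-mono : ∀ A κ {r r′} → r ≤ r′ → searchCost A κ r ≤ searchCost A κ r′
searchCost-mono A κ {r′ = zero}   z≤n     = ≤-refl
searchCost-mono A κ {r′ = suc r′} z≤n     = m≤m+n _ _
searchCost-mono A κ {r′ = suc r′} (s≤s p) =
    +-monoʳ-≤ (once A) (branchCost-monoʳ A κ (searchCost-mono A κ p))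

greedyCost : (A c x e j : ℕ) → ℕ
greedyCost A c x e zero    = once A + branchCost A c x
greedyCost A c x e (suc j) = once A + (e + greedyCost A c x e j)

module Phase (t Δ : ℕ) {κ : ℕ} (code : List (Word (suc κ) t))
  (cover : ∀ w* → ∃ λ w → w ∈ code × 2 * mismatches w w* + Δ ≤ t)
  (N : ℕ) {n} (n≤N : n ≤ N) (F : RawCNF n)
  (κ<N : κ < N) (F≤N : length F ≤ N) (width : All (λ C → length C ≤ suc κ) F)
  (t≤N : treeSize (encodeℕ t) + t ≤ N) (Δ≤N : treeSize (encodeℕ Δ) + Δ ≤ N)
      (code≤N : treeSize (encodeCode code) ≤ N)
  where

  open Searching (encodeℕ t) (encodeℕ Δ) (encodeCode code) N n≤N F κ κ<N F≤N width public

  N≤A₄ : N ≤ A₄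
  N≤A₄ = ≤-trans N≤A₁ A₁≤A₄
    where
    N≤A₁ : N ≤ A₁
    N≤A₁ = ≤-trans (m≤m*n N 64)
        (≤-trans (n≤1+n _) (≤-trans (s≤s (m≤n+m _ 63)) (≤-reflexive (sym (level-def N 1)))))

  Solved : State n → Set
  Solved (S , σ) = ∀ {C} → C ∈ F → satisfied σ C ≡ true

  PhaseSpec : ℕ → Partial n → Maybe (State n) → Set
  PhaseSpec r σ nothing  = ∀ β → β ⊨ʳ F → dist σ β ≤ r → ⊥
  PhaseSpec r σ (just s) = Solved s

  PhaseResult : ℕ → List Tree → Partial n → Set
  PhaseResult T rs σ = ∃ λ res → PhaseSpec (length rs) σ res ×
    #phase ⟨ encodeRaw F ∙ encodeList identity rs ∙ encodePartial σ ⟩⇓ encodeResult res within T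

  CodesSpec : List (Word (suc κ) t) → RawCNF n → ℕ → Partial n → Maybe (State n) → Set
  CodesSpec W G r σ nothing  = ∀ {w} → w ∈ W → PhaseSpec r (applyWord (positions w) G σ) nothing
  CodesSpec W G r σ (just s) = Solved s

  codes⇓ : ∀ {T} rs → (∀ σ → PhaseResult T rs σ) → ∀ W G σ → All (λ C → length C ≤ N) G →
    ∃ λ res → CodesSpec W G (length rs) σ res ×
    #codes ⟨ encodeCode W ∙ encodeRaw G ∙ encodeRaw F ∙ encodeList identity rs ∙ encodePartial σ
        ⟩⇓
      encodeResult res within branchCost A₄ (length W) T
  codes⇓ rs phase []      G σ G≤N = nothing , (λ ()) , total₀ (unpack₅° (leaf° var° nil°))
  codes⇓ rs phase (w ∷ W) G σ G≤N with phase (applyWord (positions w) G σ)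
     | weaken (≤-trans (level-mono A₁
         (≤-trans (≤-reflexive (length-positions w)) (m+n≤o⇒n≤o _ t≤N))) A₂≤A₄)
             (applyWord⇓ n≤N (positions w) G σ G≤N)
    where
    length-positions : ∀ {t} (w : Word (suc κ) t) → length (positions w) ≡ t
    length-positions []      = refl
    length-positions (a ∷ w) = cong suc (length-positions w)
  ... | just s , spec , run | applied = just s , spec ,
        weaken (+-monoʳ-≤ (once A₄) (m≤m+n _ _))
          (total₁ (unpack₅° (node° var° (node°
            (rec° (var° ▹° var° ▹° call° ≤-refl applied (var° ▹° var° ▹° var°)) run)
                (var° ▹° var°)))))
  ... | nothing , none , run | applied with codes⇓ rs phase W G σ G≤N
  ...   | res , spec , run′ = res , extend res spec ,
        total₂ (unpack₅° (node° var° (leaf°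
            (rec° (var° ▹° var° ▹° call° ≤-refl applied (var° ▹° var° ▹° var°)) run)
            (rec° (var° ▹° var° ▹° var° ▹° var° ▹° var°) run′))))
    where
    extend : ∀ res → CodesSpec W G (length rs) σ res → CodesSpec (w ∷ W) G (length rs) σ res
    extend (just s) spec                = spec
    extend nothing  none′ (here refl) = none
    extend nothing  none′ (there w∈W) = none′ w∈W

  record Packing (G : RawCNF n) (S : Marks n) (σ : Partial n) : Set where
    field
      chosen   : All (_∈ F) G
      unsat    : All (λ C → satisfied σ C ≡ false) G
      disjoint : AllPairs Disjoint G
      marks    : All (λ C → ∀ l → l ∈ C → lookup S (index l) ≡ true) G
      only     : ∀ i → lookup S i ≡ true → Any (Any (λ l → index l ≡ i)) G

  open Packing

  extendPacking : ∀ {G S σ C} → Packing G S σ → C ∈ F → satisfied σ C ≡ false →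
      touched S C ≡ false →
                  Packing (C ∷ G) (markAll C S) σ
  extendPacking {G} {S} {σ} {C} p C∈F un untouched = record
    { chosen   = C∈F ∷ p .chosen
    ; unsat    = un ∷ p .unsat
    ; disjoint = All.map apart (p .marks) ∷ p .disjoint
    ; marks    = (λ l → markAll-∈) ∷ All.map (λ m l l∈D → markAll-marked C (m l l∈D)) (p .marks)
    ; only     = λ i Si → only′ i (markAll-only C Si)
    }
    where
    apart : ∀ {D} → (∀ l → l ∈ D → lookup S (index l) ≡ true) → Disjoint C D
    apart marked-D {l} {m} l∈C m∈D l≡m
      with () ← trans (sym (any-false (holds marked S) {C} untouched l∈C))
                      (trans (cong (lookup S) l≡m) (marked-D m m∈D))
    only′ : ∀ i → Any (λ l → index l ≡ i) C ⊎ lookup S i ≡ true →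
        Any (Any (λ l → index l ≡ i)) (C ∷ G)
    only′ i (inj₁ q)  = here q
    only′ i (inj₂ Si) = there (p .only i Si)

  cost : ℕ → ℕ
  cost r = enumCost A₄ (searchCost A₄ κ r) (t * suc (suc κ))

  progress : ∀ {G S σ} → Packing G S σ → length G ≡ t → ∀ β → β ⊨ʳ F →
             ∃ λ w → w ∈ code × dist (applyWord (positions w) G σ) β + Δ ≤ dist σ β
  progress {G} {S} {σ} p G≡t β βF
    with w* , ws ← hits {β = β} G G≡t (All.map (All.lookup width) (p .chosen))
        (All.map (All.lookup βF) (p .chosen))
    with w , w∈code , near ← cover w* = w , w∈code , +-cancelʳ-≤ (2 * m) _ _ (begin
      d + Δ + 2 * m     ≡⟨ +-assoc d Δ _ ⟩
      d + (Δ + 2 * m)   ≡⟨ cong (d +_) (+-comm Δ _) ⟩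
      d + (2 * m + Δ)   ≤⟨ +-monoʳ-≤ d near ⟩
      d + t             ≤⟨ applyWord-dist w w* G σ β (p .disjoint) (p .unsat) ws ⟩
      dist σ β + 2 * m  ∎)
    where
    open ≤-Reasoning
    m = mismatches w w*
    d = dist (applyWord (positions w) G σ) β

  greedy⇓ : ∀ {T} rs → (∀ rs′ → subtract Δ rs ≡ just rs′ → ∀ σ → PhaseResult T rs′ σ) →
    ∀ j G S σ → Packing G S σ → length G + j ≡ t →
    ∃ λ res → PhaseSpec (length rs) σ res ×
    #greedy ⟨ encodeℕ j ∙ encodeRaw G ∙ encodeRaw F ∙ encodeList identity rs ∙ encodeState
        (S , σ) ⟩⇓
      encodeResult res within greedyCost A₄ (length code) T (cost (length rs)) j
  greedy⇓ {T} rs phase zero G S σ p G≡t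
    with subtract Δ rs in eq | weaken (≤-trans (level-mono 1 (m+n≤o⇒n≤o _ Δ≤N)) A₁≤A₄)
        (minus⇓ Δ rs)
  ... | nothing | minus = nothing , none ,
        weaken (m≤m+n _ _) (total₀
            (unpack₅° (leaf° var° (leaf° (call° ≤-refl minus (Δ° ▹° var°)) nil°))))
    where
    Δ° : ∀ {m} {ρ : Vec Tree m} → ρ ⊢ quoteTree (encodeℕ Δ) ⇓ encodeℕ Δ [ 1 ▸ [] ]
    Δ° = quote° (≤-trans (m+n≤o⇒m≤o _ Δ≤N) N≤A₄)
    none : PhaseSpec (length rs) σ nothing
    none β βF d≤ with w , _ , closer ← progress p (trans (sym (+-identityʳ _)) G≡t) β βF =
      <-irrefl refl (≤-trans (subtract-nothing Δ rs eq) (≤-trans (m≤n+m Δ _) (≤-trans closer d≤)))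
  ... | just rs′ | minus with codes⇓ rs′ (phase rs′ eq) code G σ
      (All.map (All.lookup short) (p .chosen))
  ...   | res , spec , run = res , reduce res spec ,
        total₁ (unpack₅° (leaf° var° (node° (call° ≤-refl minus (Δ° ▹° var°)) (node° var°
          (rec° (code° ▹° var° ▹° var° ▹° var° ▹° var°) run)))))
    where
    Δ° : ∀ {m} {ρ : Vec Tree m} → ρ ⊢ quoteTree (encodeℕ Δ) ⇓ encodeℕ Δ [ 1 ▸ [] ]
    Δ° = quote° (≤-trans (m+n≤o⇒m≤o _ Δ≤N) N≤A₄)
    code° : ∀ {m} {ρ : Vec Tree m} → ρ ⊢ quoteTree (encodeCode code) ⇓ encodeCode code [ 1 ▸ [] ]
    code° = quote° (≤-trans code≤N N≤A₄)
    reduce : ∀ res → CodesSpec code G (length rs′) σ res → PhaseSpec (length rs) σ res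
    reduce (just s) spec = spec
    reduce nothing none β βF d≤ with w , w∈code ,
        closer ← progress p (trans (sym (+-identityʳ _)) G≡t) β βF =
      none w∈code β βF (+-cancelʳ-≤ Δ _ _ (≤-trans closer (≤-trans d≤
        (≤-reflexive (trans (subtract-just Δ rs eq) (+-comm Δ _))))))
  greedy⇓ rs phase (suc j) G S σ p G≡t with findWanted false (S , σ) F in eq | found⇓ false
      (S , σ)
  ... | just C | found = res , spec , weaken (+-monoʳ-≤ (once A₄) (m≤n+m _ _))
        (total₁ (unpack₅° (node° var°
            (node° (call° ≤-refl found (no° ▹° var° ▹° var°)) (node° var°
          (rec° (var° ▹° (var° ▹° var°) ▹° var° ▹° var° ▹° call° marks≤ (mark⇓ n≤N C S)
              (var° ▹° var°) ▹° var°) run))))))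
    where
    C∈F = proj₁ (findWanted-just false (S , σ) F eq)
    C-wanted = wanted-true {S = S} {σ} {C} (proj₂ (findWanted-just false (S , σ) F eq))
    marks≤ : level (length C) A₁ ≤ A₄
    marks≤ = ≤-trans (level-mono A₁ (All.lookup short C∈F)) A₂≤A₄
    later = greedy⇓ rs phase j (C ∷ G) (markAll C S) σ
      (extendPacking p C∈F (proj₁ C-wanted) (proj₂ C-wanted)) (trans (sym (+-suc _ j)) G≡t)
    res = proj₁ later
    spec = proj₁ (proj₂ later)
    run = proj₂ (proj₂ later)
  ... | nothing | found with enum⇓ G rs (S , σ)
  ...   | res , spec , run =
      res , reduce res spec , weaken (+-monoʳ-≤ (once A₄) (≤-trans enum≤ (m≤m+n _ _)))
        (total₁ (unpack₅° (node° var° (leaf° (call° ≤-refl found (no° ▹° var° ▹° var°))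
          (rec° (var° ▹° var° ▹° var° ▹° var°) run)))))
    where
    enum≤ : enumCost A₄ (searchCost A₄ κ (length rs)) (weight G) ≤ cost (length rs)
    enum≤ = enumCost-mono A₄ ≤-refl (≤-trans (weight-≤ G (All.map (All.lookup width) (p .chosen)))
      (*-monoˡ-≤ (suc (suc κ)) (≤-trans (m≤m+n _ (suc j)) (≤-reflexive G≡t))))
    covered : Covered F (S , σ)
    covered {C} C∈F un =
        wanted-false {S = S} {σ} {C} (findWanted-nothing false (S , σ) F eq C∈F) un
    reduce : ∀ res → EnumSpec G (length rs) (S , σ) res → PhaseSpec (length rs) σ res
    reduce (just s) (reach , closed) =
      closed-covered F {s} closed (reach-invariant (Covered F) (covered-assumed F) reach covered)
    reduce nothing none β βF d≤ = none β βF (λ i Si → inj₁ (p .only i Si)) d≤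

  phaseCost : ℕ → ℕ
  phaseCost zero    = once A₄ + greedyCost A₄ (length code) 0 (cost Δ) t
  phaseCost (suc q) = once A₄ + greedyCost A₄ (length code) (phaseCost q)
      (cost (suc (suc q) * Δ)) t

  greedyCost-mono : ∀ T {e e′} j → e ≤ e′ →
      greedyCost A₄ (length code) T e j ≤ greedyCost A₄ (length code) T e′ j
  greedyCost-mono T zero    e≤ = ≤-refl
  greedyCost-mono T (suc j) e≤ = +-monoʳ-≤ (once A₄) (+-mono-≤ e≤ (greedyCost-mono T j e≤))

  fillCells⇓ : ∀ {B C : Set} {enc : B → Tree} (h : C → Bool → Bool) c →
      encodeCell h c ≡ leaf ∙ leaf → (xs : Vec B n) →
               #fill ⟨ encodeVec enc xs ⟩⇓ encodeCells h (Vec.replicate n c) within A₄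
  fillCells⇓ h c eq xs = weaken (≤-trans (level-mono 1 n≤N) A₁≤A₄)
    (subst (λ v → #fill ⟨ _ ⟩⇓ v within _) (sym (uniform n)) (fill⇓ xs))
    where
    uniform : ∀ m → encodeCells h (Vec.replicate m c) ≡ encodeList identity
        (replicate m (leaf ∙ leaf))
    uniform zero    = refl
    uniform (suc m) = cong₂ _∙_ eq (uniform m)

  start⇓ : ∀ {T} rs → (∀ rs′ → subtract Δ rs ≡ just rs′ → ∀ σ → PhaseResult T rs′ σ) →
           ∀ σ → PhaseResult (once A₄ + greedyCost A₄ (length code) T (cost (length rs)) t) rs σ
  start⇓ rs phase σ with greedy⇓ rs phase t [] (Vec.replicate n false) σ empty refl
    where
    empty : Packing [] (Vec.replicate n false) σ
    empty = record { chosen = [] ; unsat = [] ; disjoint = [] ; marks = []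
                   ; only = λ i Si → ⊥-elim (absurd (trans (sym (lookup-replicate i false)) Si)) }
      where
      absurd : false ≢ true
      absurd ()
  ... | res , spec , run = res , spec ,
        total₁ (unpack₃° (rec° (quote° (≤-trans (m+n≤o⇒m≤o _ t≤N) N≤A₄) ▹° nil° ▹° var° ▹° var° ▹°
          call° ≤-refl (fillCells⇓ marked false refl σ) var° ▹° var°) run))

  cost-mono : ∀ {r r′} → r ≤ r′ → cost r ≤ cost r′
  cost-mono r≤ = enumCost-mono A₄ (searchCost-mono A₄ κ r≤) (≤-refl {t * suc (suc κ)})

  cheaper : ∀ {T T′ rs σ} → T ≤ T′ → PhaseResult T rs σ → PhaseResult T′ rs σ
  cheaper T≤ (res , spec , run) = res , spec , weaken T≤ run

  phase⇓ : ∀ q rs → length rs < suc q * Δ → ∀ σ → PhaseResult (phaseCost q) rs σ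
  phase⇓ zero rs rs< σ = cheaper
    (+-monoʳ-≤ (once A₄)
        (greedyCost-mono 0 t (cost-mono (≤-trans (<⇒≤ rs<) (≤-reflexive (*-identityˡ Δ))))))
    (start⇓ rs stuck σ)
    where
    stuck : ∀ rs′ → subtract Δ rs ≡ just rs′ → ∀ σ → PhaseResult 0 rs′ σ
    stuck rs′ eq = ⊥-elim (<-irrefl refl (≤-trans rs< (≤-trans (≤-reflexive (*-identityˡ Δ))
      (≤-trans (m≤m+n Δ _) (≤-reflexive (sym (subtract-just Δ rs eq)))))))
  phase⇓ (suc q) rs rs< σ = cheaper
    (+-monoʳ-≤ (once A₄) (greedyCost-mono (phaseCost q) t (cost-mono (<⇒≤ rs<))))
    (start⇓ rs next σ)
    where
    next : ∀ rs′ → subtract Δ rs ≡ just rs′ → ∀ σ → PhaseResult (phaseCost q) rs′ σ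
    next rs′ eq = phase⇓ q rs′
      (+-cancelˡ-< Δ _ _ (subst (_< suc (suc q) * Δ) (subtract-just Δ rs eq) rs<))

-- The two main programs

unmarked : Marks n → ℕ
unmarked []          = 0
unmarked (true  ∷ S) = unmarked S
unmarked (false ∷ S) = suc (unmarked S)

unmarked-≤n : (S : Marks n) → unmarked S ≤ n
unmarked-≤n []          = z≤n
unmarked-≤n (true  ∷ S) = m≤n⇒m≤1+n (unmarked-≤n S)
unmarked-≤n (false ∷ S) = s≤s (unmarked-≤n S)

unmarked-set : ∀ (S : Marks n) i → unmarked (S [ i ]≔ true) ≤ unmarked S
unmarked-set (true  ∷ S) zero    = ≤-refl
unmarked-set (false ∷ S) zero    = n≤1+n _
unmarked-set (true  ∷ S) (suc i) = unmarked-set S i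
unmarked-set (false ∷ S) (suc i) = s≤s (unmarked-set S i)

unmarked-set-< : ∀ (S : Marks n) i → lookup S i ≡ false → unmarked (S [ i ]≔ true) < unmarked S
unmarked-set-< (false ∷ S) zero    eq = ≤-refl
unmarked-set-< (true  ∷ S) (suc i) eq = unmarked-set-< S i eq
unmarked-set-< (false ∷ S) (suc i) eq = s≤s (unmarked-set-< S i eq)

Sync : State n → Set
Sync (S , σ) = ∀ i → lookup S i ≡ is-just (lookup σ i)

sync-assumed : ∀ l (s : State n) → Sync s → Sync (assumed l s)
sync-assumed l (S , σ) sync i with i ≟ᶠ index l
... | yes refl = trans (lookup-set S i) (cong is-just (sym (lookup-set σ i)))
... | no i≢l   = trans (lookup-unset S i≢l)
    (trans (sync i) (cong is-just (sym (lookup-unset σ i≢l))))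

override : Partial n → Assignment n → Assignment n
override = zipWith (λ c b → fromMaybe b c)

lookup-override : ∀ (σ : Partial n) β i →
    lookup (override σ β) i ≡ fromMaybe (lookup β i) (lookup σ i)
lookup-override σ β i = lookup-zipWith _ i σ β

override-satisfied : ∀ {σ : Partial n} {C} β → satisfied σ C ≡ true → ∃ λ l →
    l ∈ C × override σ β ⊨ˡ l
override-satisfied {σ = σ} {C} β sat with l , l∈C , σl ← any-true (holds matches σ) {C} sat =
  l , l∈C , trans (lookup-override σ β (index l)) (cong (fromMaybe _) (matches-true σl))

override-agree : ∀ {S} {σ : Partial n} β → Sync (S , σ) → Agree (S , σ) (override σ β)
override-agree {S = S} {σ} β sync i Si
  rewrite lookup-override σ β i with lookup σ i | trans (sym (sync i)) Si
... | just b | _ = refl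

encodeList-identity : (enc : A → Tree) (xs : List A) →
    encodeList enc xs ≡ encodeList identity (List.map enc xs)
encodeList-identity enc []       = refl
encodeList-identity enc (x ∷ xs) = cong (enc x ∙_) (encodeList-identity enc xs)

module Main (t Δ : ℕ) {κ : ℕ} (code : List (Word (suc κ) t))
  (cover : ∀ w* → ∃ λ w → w ∈ code × 2 * mismatches w w* + Δ ≤ t)
  (N : ℕ) {n} (n≤N : n ≤ N) (F : RawCNF n)
  (κ<N : κ < N) (F≤N : length F ≤ N) (width : All (λ C → length C ≤ suc κ) F)
  (t≤N : treeSize (encodeℕ t) + t ≤ N) (Δ≤N : treeSize (encodeℕ Δ) + Δ ≤ N)
      (code≤N : treeSize (encodeCode code) ≤ N)
  where

  open Phase t Δ code cover N n≤N F κ<N F≤N width t≤N Δ≤N code≤N public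

  total-assignment : ∀ {S σ} → Solved (S , σ) → Vec.map (fromMaybe false) σ ⊨ʳ F
  total-assignment {S} {σ} solved = All.tabulate λ {C} C∈F →
    let l , l∈C , σl = any-true (holds matches σ) {C} (solved C∈F)
    in lose l∈C (trans (lookup-map (index l) _ σ) (cong (fromMaybe false) (matches-true σl)))

  finish≤ : level n 1 ≤ A₄
  finish≤ = ≤-trans (level-mono 1 n≤N) A₁≤A₄

  mainₖ⇓ : ∀ q (α : Assignment n) rs → length rs < suc q * Δ → ∀ β → β ⊨ʳ F →
      hamming α β ≤ length rs →
    ∃ λ γ → γ ⊨ʳ F × #mainₖ ⟨ encodeRaw F ∙ encodeAssignment α ∙ encodeList identity rs ⟩⇓
        encodeAssignment γ
      within once A₄ + phaseCost q
  mainₖ⇓ q α rs rs< β βF close = conclude (phase⇓ q rs rs< (Vec.map just α))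
    where
    conclude : PhaseResult (phaseCost q) rs (Vec.map just α) → _
    conclude (nothing , none , run) =
        ⊥-elim (none β βF (subst (_≤ length rs) (sym (dist-hamming α β)) close))
    conclude (just (S , σ) , solved , run) =
        Vec.map (fromMaybe false) σ , total-assignment {S} {σ} solved ,
        total₁ (unpack₃° (node° (rec° (var° ▹° var° ▹° call° finish≤ (cells⇓ α) var°) run)
          (call° finish≤ (finish⇓ σ) var°)))

  loopCost : ℕ → ℕ
  loopCost zero    = once A₄
  loopCost (suc m) = once A₄ + (branchCost A₄ (suc κ) (searchCost A₄ κ n) + loopCost m)

  -- Under a closed state every clause is either satisfied or untouched, so
  -- the assumptions made so far extend to a satisfying assignment.
  override-satisfies : ∀ {S σ} → Sync (S , σ) → Closed F (S , σ) → ∀ β → β ⊨ʳ F →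
      override σ β ⊨ʳ F
  override-satisfies {S} {σ} sync closed β βF = All.tabulate λ {C} C∈F → clause′ C C∈F
    where
    clause′ : ∀ C → C ∈ F → _
    clause′ C C∈F with satisfied σ C in sat
    ... | true with l , l∈C , ol ← override-satisfied {σ = σ} {C} β sat = lose l∈C ol
    ... | false with l , l∈C , βl ← true-literal {β = β} βF C∈F = lose l∈C
          (trans (lookup-override σ β (index l)) (trans (unassigned (lookup σ (index l))
            (trans (sym (sync (index l))) (any-false (holds marked S) {C} (closed C∈F sat) l∈C)))
                βl))
      where
      unassigned : ∀ {b} c → is-just c ≡ false → fromMaybe b c ≡ b
      unassigned nothing _ = refl

  encodePartial-fuel : ∀ (σ : Partial n) → ∃ λ fuel →
    length fuel ≡ n × encodePartial σ ≡ encodeList identity fuel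
  encodePartial-fuel σ = List.map (encodeCell matches) (toList σ) ,
    trans (length-map _ (toList σ)) (length-toList σ) , encodeList-identity _ (toList σ)

  branchOnClause⇓ : ∀ C S σ → length C ≤ suc κ → ∃ λ res → BranchSpec C n (S , σ) res ×
    #branch ⟨ encodeClause C ∙ encodeRaw F ∙ encodePartial σ ∙ encodeState (S , σ) ⟩⇓
        encodeResult res
      within branchCost A₄ (suc κ) (searchCost A₄ κ n)
  branchOnClause⇓ C S σ C≤ with encodePartial-fuel σ
  ... | fuel , fuel≡n , σ≡fuel with branch⇓ C fuel (S , σ)
  ...   | res , spec , run = res , subst (λ r → BranchSpec C r (S , σ) res) fuel≡n spec ,
          subst (λ v → #branch ⟨ encodeClause C ∙ encodeRaw F ∙ v ∙ encodeState (S , σ) ⟩⇓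
              encodeResult res within _) (sym σ≡fuel)
            (weaken (≤-trans (branchCost-mono A₄ _ C≤)
              (≤-reflexive (cong (λ r → branchCost A₄ (suc κ) (searchCost A₄ κ r)) fuel≡n))) run)

  loop⇓ : ∀ m s → unmarked (proj₁ s) ≤ m → Sync s → Closed F s → ∀ β → β ⊨ʳ F →
    ∃ λ γ → γ ⊨ʳ F × #loop ⟨ encodeRaw F ∙ encodeState s ⟩⇓ encodeAssignment γ within loopCost m
  loop⇓ m s@(S , σ) S≤m sync closed β βF with findWanted false s F in eq | found⇓ false s
  ... | nothing | found = Vec.map (fromMaybe false) σ , total-assignment {S} {σ} solved ,
        weaken (loopCost-once m)
            (total₀ (unpack₂° (leaf° (call° ≤-refl found (no° ▹° var° ▹° var°))
          (node° var° (call° finish≤ (finish⇓ σ) var°)))))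
    where
    solved : Solved s
    solved = closed-covered F {s} closed
      (λ {C} C∈F un → wanted-false {S = S} {σ} {C} (findWanted-nothing false s F eq C∈F) un)
    loopCost-once : ∀ m → once A₄ ≤ loopCost m
    loopCost-once zero    = ≤-refl
    loopCost-once (suc m) = m≤m+n _ _
  ... | just C | found = continue m S≤m (branchOnClause⇓ C S σ (All.lookup width C∈F))
    where
    C∈F = proj₁ (findWanted-just false s F eq)
    untouched = proj₂ (wanted-true {S = S} {σ} {C} (proj₂ (findWanted-just false s F eq)))
    fewer : ∀ {l s′} → l ∈ C → Reach (assumed l s) s′ → unmarked (proj₁ s′) < unmarked S
    fewer {l} l∈C reach =
        ≤-trans (s≤s (reach-invariant
            (λ s′ → unmarked (proj₁ s′) ≤ unmarked (S [ index l ]≔ true))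
        (λ l s p → ≤-trans (unmarked-set (proj₁ s) (index l)) p) reach ≤-refl))
      (unmarked-set-< S (index l) (any-false (holds marked S) {C} untouched l∈C))
    β′F : override σ β ⊨ʳ F
    β′F = override-satisfies {S} {σ} sync closed β βF
    continue : ∀ m → unmarked S ≤ m → (∃ λ res → BranchSpec C n s res ×
        #branch ⟨ encodeClause C ∙ encodeRaw F ∙ encodePartial σ ∙ encodeState s ⟩⇓ encodeResult
            res
          within branchCost A₄ (suc κ) (searchCost A₄ κ n)) →
      ∃ λ γ → γ ⊨ʳ F × #loop ⟨ encodeRaw F ∙ encodeState s ⟩⇓ encodeAssignment γ within loopCost m
    continue m S≤m (nothing , none , run) with true-literal {β = override σ β} β′F C∈F
    ... | l , l∈C , βl = ⊥-elim (none l∈C (override σ β) β′F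
          (agree-assumed {s = s} {override σ β} l βl (override-agree {S = S} {σ} β sync))
          (dist-≤ (σ [ index l ]≔ just (polarity l)) (override σ β)))
    continue zero    S≤m (just s′ , (l , l∈C , reach , closed′) , run) =
      ⊥-elim (n≮0 (≤-trans (fewer l∈C reach) S≤m))
    continue (suc m) S≤m (just s′ , (l , l∈C , reach , closed′) , run)
      with loop⇓ m s′ (≤-pred (≤-trans (fewer l∈C reach) S≤m))
             (reach-invariant Sync sync-assumed reach (sync-assumed l s sync)) closed′ β βF
    ... | γ , γF , run′ = γ , γF ,
        total₂ (unpack₂° (node° (call° ≤-refl found (no° ▹° var° ▹° var°)) (node° var° (node°
          (rec° (var° ▹° var° ▹° var° ▹° var°) run)
          (rec° (var° ▹° var° ▹° var°) run′)))))

  main₂⇓ : ∀ (α : Assignment n) r β → β ⊨ʳ F →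
    ∃ λ γ → γ ⊨ʳ F × #main₂ ⟨ encodeRaw F ∙ encodeAssignment α ∙ r ⟩⇓ encodeAssignment γ
      within once A₄ + loopCost n
  main₂⇓ α r β βF with loop⇓ n (Vec.replicate n false , Vec.replicate n nothing)
      (unmarked-≤n (Vec.replicate n false))
      (λ i → trans (lookup-replicate i false) (sym (cong is-just (lookup-replicate i nothing))))
          untouched β βF
    where
    none-marked : ∀ C → touched (Vec.replicate n false) C ≡ false
    none-marked []      = refl
    none-marked (l ∷ C) rewrite lookup-replicate (index l) false = none-marked C
    untouched : Closed F (Vec.replicate n false , Vec.replicate n nothing)
    untouched {C} _ _ = none-marked C
  ... | γ , γF , run = γ , γF , total₁ (unpack₃° (rec°
        (var° ▹° call° ≤-refl (fillCells⇓ marked false refl α) var° ▹°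
          call° ≤-refl (fillCells⇓ matches nothing refl α) var°) run))

-- Covering codes

-- term n j is the term C(n,j) λⁿ⁻ʲ of (1 + λ)ⁿ.

module Binomial (λ′ : ℕ) where

  term : ℕ → ℕ → ℕ
  term zero    zero    = 1
  term zero    (suc j) = 0
  term (suc n) zero    = λ′ * term n zero
  term (suc n) (suc j) = term n j + λ′ * term n (suc j)

  private
    absorb₁ : ∀ l p₀ p₁ →
        1 * l * (p₀ + l * p₁) + 0 * (l * p₀) ≡ l * p₀ + l * (1 * l * p₁ + 0 * p₀)
    absorb₁ = solve-∀
    absorb₂ : ∀ l n p₀ → l * p₀ + l * (n * p₀) ≡ suc n * (l * p₀)
    absorb₂ = solve-∀
    absorb₃ : ∀ l j p₀ p₁ p₂ → suc (suc j) * l * (p₁ + l * p₂) + suc j * (p₀ + l * p₁) ≡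
              (suc j * l * p₁ + j * p₀) + p₀ + l * (suc (suc j) * l * p₂ + suc j * p₁) + l * p₁
    absorb₃ = solve-∀
    absorb₄ : ∀ l n p₀ p₁ → n * p₀ + p₀ + l * (n * p₁) + l * p₁ ≡ suc n * (p₀ + l * p₁)
    absorb₄ = solve-∀
    sum₁ : ∀ l p₀ → l * p₀ ≡ l * p₀ + 0
    sum₁ = solve-∀
    sum₂ : ∀ l S p₀ p₁ → l * (S + p₀) + S + (p₀ + l * p₁) ≡ l * (S + p₀ + p₁) + (S + p₀)
    sum₂ = solve-∀
    ball₁ : ∀ l p₀ p₁ x →
        (p₀ + l * p₁) * (l * (l * x)) ≡ l * l * (p₀ * x) + l * (p₁ * (l * (l * x)))
    ball₁ = solve-∀
    ball₂ : ∀ l y b₀ b₁ → l * l * (y * b₀) + l * (y * b₁) ≡ l * y * (b₁ + l * b₀)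
    ball₂ = solve-∀

  absorption : ∀ n j → suc j * λ′ * term n (suc j) + j * term n j ≡ n * term n j
  absorption zero    zero    = trans (+-identityʳ _) (*-zeroʳ (λ′ + 0))
  absorption zero    (suc j) = cong₂ _+_ (*-zeroʳ (suc (suc j) * λ′)) (*-zeroʳ (suc j))
  absorption (suc n) zero    = begin
    1 * λ′ * (p₀ + λ′ * p₁) + 0 * (λ′ * p₀)   ≡⟨ absorb₁ λ′ p₀ p₁ ⟩
    λ′ * p₀ + λ′ * (1 * λ′ * p₁ + 0 * p₀)     ≡⟨ cong (λ z → λ′ * p₀ + λ′ * z)
        (absorption n zero) ⟩
    λ′ * p₀ + λ′ * (n * p₀)                   ≡⟨ absorb₂ λ′ n p₀ ⟩
    suc n * (λ′ * p₀)                         ∎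
    where
    open ≡-Reasoning
    p₀ = term n 0
    p₁ = term n 1
  absorption (suc n) (suc j) = begin
    suc (suc j) * λ′ * (p₁ + λ′ * p₂) + suc j * (p₀ + λ′ * p₁)
      ≡⟨ absorb₃ λ′ j p₀ p₁ p₂ ⟩
    (suc j * λ′ * p₁ + j * p₀) + p₀ + λ′ * (suc (suc j) * λ′ * p₂ + suc j * p₁) + λ′ * p₁
      ≡⟨ cong₂ (λ y z → y + p₀ + λ′ * z + λ′ * p₁) (absorption n j) (absorption n (suc j)) ⟩
    n * p₀ + p₀ + λ′ * (n * p₁) + λ′ * p₁
      ≡⟨ absorb₄ λ′ n p₀ p₁ ⟩
    suc n * (p₀ + λ′ * p₁) ∎
    where
    open ≡-Reasoning
    p₀ = term n j
    p₁ = term n (suc j)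
    p₂ = term n (suc (suc j))

  partialSum : ℕ → ℕ → ℕ
  partialSum n zero    = 0
  partialSum n (suc m) = partialSum n m + term n m

  partialSum-suc : ∀ n m → partialSum (suc n) (suc m) ≡ λ′ * partialSum n (suc m) + partialSum n m
  partialSum-suc n zero    = sum₁ λ′ (term n 0)
  partialSum-suc n (suc m) = begin
    partialSum (suc n) (suc m) + (p₀ + λ′ * p₁)  ≡⟨ cong (_+ (p₀ + λ′ * p₁)) (partialSum-suc n m)
        ⟩
    λ′ * (S + p₀) + S + (p₀ + λ′ * p₁)           ≡⟨ sum₂ λ′ S p₀ p₁ ⟩
    λ′ * (S + p₀ + p₁) + (S + p₀)                ∎
    where
    open ≡-Reasoning
    S = partialSum n m
    p₀ = term n m
    p₁ = term n (suc m)

  binomial-≤ : ∀ n → suc λ′ ^ n ≤ partialSum n (suc n)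
  binomial-≤ zero    = ≤-refl
  binomial-≤ (suc n) = begin
    suc λ′ * suc λ′ ^ n                                        ≤⟨ *-monoʳ-≤ (suc λ′)
        (binomial-≤ n) ⟩
    partialSum n (suc n) + λ′ * partialSum n (suc n)           ≡⟨ +-comm (partialSum n (suc n)) _
        ⟩
    λ′ * partialSum n (suc n) + partialSum n (suc n)           ≤⟨ +-monoˡ-≤ _
        (*-monoʳ-≤ λ′ (m≤m+n _ _)) ⟩
    λ′ * partialSum n (suc (suc n)) + partialSum n (suc n)     ≡⟨ partialSum-suc n (suc n) ⟨
    partialSum (suc n) (suc (suc n))                           ∎
    where open ≤-Reasoning

  -- The number of words of length n over 1 + λ′ letters with at most s
  -- mismatches to a given word.
  ball : ℕ → ℕ → ℕ
  ball zero    s       = 1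
  ball (suc n) zero    = ball n zero
  ball (suc n) (suc s) = ball n (suc s) + λ′ * ball n s

  term-ball : ∀ n j → term n j * λ′ ^ (2 * j) ≤ λ′ ^ n * ball n j
  term-ball zero    zero    = ≤-refl
  term-ball zero    (suc j) = z≤n
  term-ball (suc n) zero    = begin
    λ′ * p * 1            ≡⟨ *-assoc λ′ p 1 ⟩
    λ′ * (p * 1)          ≤⟨ *-monoʳ-≤ λ′ (term-ball n zero) ⟩
    λ′ * (λ′ ^ n * b)     ≡⟨ *-assoc λ′ (λ′ ^ n) b ⟨
    λ′ * λ′ ^ n * b       ∎
    where
    open ≤-Reasoning
    p = term n 0
    b = ball n 0
  term-ball (suc n) (suc j) = begin
    (p₀ + λ′ * p₁) * λ′ ^ (2 * suc j)
      ≡⟨ cong ((p₀ + λ′ * p₁) *_) two ⟩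
    (p₀ + λ′ * p₁) * (λ′ * (λ′ * x))
      ≡⟨ ball₁ λ′ p₀ p₁ x ⟩
    λ′ * λ′ * (p₀ * x) + λ′ * (p₁ * (λ′ * (λ′ * x)))
      ≡⟨ cong (λ z → λ′ * λ′ * (p₀ * x) + λ′ * (p₁ * z)) two ⟨
    λ′ * λ′ * (p₀ * x) + λ′ * (p₁ * λ′ ^ (2 * suc j))
      ≤⟨ +-mono-≤ (*-monoʳ-≤ (λ′ * λ′) (term-ball n j)) (*-monoʳ-≤ λ′ (term-ball n (suc j))) ⟩
    λ′ * λ′ * (y * b₀) + λ′ * (y * b₁)
      ≡⟨ ball₂ λ′ y b₀ b₁ ⟩
    λ′ * y * (b₁ + λ′ * b₀) ∎
    where
    open ≤-Reasoning
    p₀ = term n j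
    p₁ = term n (suc j)
    b₀ = ball n j
    b₁ = ball n (suc j)
    x = λ′ ^ (2 * j)
    y = λ′ ^ n
    two : λ′ ^ (2 * suc j) ≡ λ′ * (λ′ * λ′ ^ (2 * j))
    two = cong (λ′ ^_) (*-suc 2 j)

  -- Consecutive terms have ratio (n − j) / ((j + 1) λ′), which passes 1 at
  -- n / (1 + λ′): the terms increase up to j = s and decrease afterwards.
  module Mode (0<λ′ : 0 < λ′) (s : ℕ) where

    len = s * suc λ′

    private
      cancel : ∀ j {x y} → suc j * λ′ * x ≤ suc j * λ′ * y → x ≤ y
      cancel j = *-cancelˡ-≤ (suc j * λ′) {{>-nonZero (*-mono-≤ (s≤s (z≤n {j})) 0<λ′)}}

    increasing : ∀ j → j < s → term len j ≤ term len (suc j)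
    increasing j j<s = cancel j (+-cancelʳ-≤ (j * p₀) _ _ (begin
      suc j * λ′ * p₀ + j * p₀     ≡⟨ *-distribʳ-+ p₀ (suc j * λ′) j ⟨
      (suc j * λ′ + j) * p₀        ≤⟨ *-monoˡ-≤ p₀ (+-monoʳ-≤ (suc j * λ′) (n≤1+n j)) ⟩
      (suc j * λ′ + suc j) * p₀    ≡⟨ cong (_* p₀)
          (trans (+-comm (suc j * λ′) (suc j)) (sym (*-suc (suc j) λ′))) ⟩
      (suc j * suc λ′) * p₀        ≤⟨ *-monoˡ-≤ p₀ (*-monoˡ-≤ (suc λ′) j<s) ⟩
      len * p₀                       ≡⟨ absorption len j ⟨
      suc j * λ′ * term len (suc j) + j * p₀ ∎))
      where
      open ≤-Reasoning
      p₀ = term len j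

    decreasing : ∀ j → s ≤ j → term len (suc j) ≤ term len j
    decreasing j s≤j = cancel j (+-cancelʳ-≤ (j * p₀) _ _ (begin
      suc j * λ′ * term len (suc j) + j * p₀  ≡⟨ absorption len j ⟩
      len * p₀                       ≤⟨ *-monoˡ-≤ p₀ (*-monoˡ-≤ (suc λ′) s≤j) ⟩
      j * suc λ′ * p₀              ≡⟨ cong (_* p₀) (trans (*-suc j λ′) (+-comm j (j * λ′))) ⟩
      (j * λ′ + j) * p₀            ≤⟨ *-monoˡ-≤ p₀ (+-monoˡ-≤ j (m≤n+m (j * λ′) λ′)) ⟩
      (suc j * λ′ + j) * p₀        ≡⟨ *-distribʳ-+ p₀ (suc j * λ′) j ⟩
      suc j * λ′ * p₀ + j * p₀     ∎))
      where
      open ≤-Reasoning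
      p₀ = term len j

    below : ∀ d j → d + j ≡ s → term len j ≤ term len s
    below zero    j refl = ≤-refl
    below (suc d) j eq   = ≤-trans (increasing j (≤-trans (s≤s (m≤n+m j d)) (≤-reflexive eq)))
                             (below d (suc j) (trans (+-suc d j) eq))

    above : ∀ d → term len (d + s) ≤ term len s
    above zero    = ≤-refl
    above (suc d) = ≤-trans (decreasing (d + s) (m≤n+m s d)) (above d)

    mode : ∀ j → term len j ≤ term len s
    mode j with ≤-total j s
    ... | inj₁ j≤s = below (s ∸ j) j (m∸n+n≡m j≤s)
    ... | inj₂ s≤j = subst (λ z → term len z ≤ term len s) (m∸n+n≡m s≤j) (above (j ∸ s))

    partialSum-≤ : ∀ m → partialSum len m ≤ m * term len s
    partialSum-≤ zero    = z≤n
    partialSum-≤ (suc m) =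
        ≤-trans (+-mono-≤ (partialSum-≤ m) (mode m)) (≤-reflexive (+-comm (m * term len s) _))

    volume : ∀ Δ → 2 * s + Δ ≡ len → suc λ′ ^ len ≤ suc len * λ′ ^ Δ * ball len s
    volume Δ eq = begin
      suc λ′ ^ len                       ≤⟨ binomial-≤ len ⟩
      partialSum len (suc len)             ≤⟨ partialSum-≤ (suc len) ⟩
      suc len * term len s                 ≤⟨ *-monoʳ-≤ (suc len) term≤ ⟩
      suc len * (λ′ ^ Δ * ball len s)      ≡⟨ *-assoc (suc len) (λ′ ^ Δ) _ ⟨
      suc len * λ′ ^ Δ * ball len s        ∎
      where
      open ≤-Reasoning
      nz = >-nonZero (m^n>0 λ′ {{>-nonZero 0<λ′}} (2 * s))
      term≤ : term len s ≤ λ′ ^ Δ * ball len s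
      term≤ = *-cancelˡ-≤ (λ′ ^ (2 * s)) {{nz}} (begin
        λ′ ^ (2 * s) * term len s              ≡⟨ *-comm (λ′ ^ (2 * s)) _ ⟩
        term len s * λ′ ^ (2 * s)              ≤⟨ term-ball len s ⟩
        λ′ ^ len * ball len s                    ≡⟨ cong (λ z → λ′ ^ z * ball len s) eq ⟨
        λ′ ^ (2 * s + Δ) * ball len s          ≡⟨ cong (_* ball len s)
            (^-distribˡ-+-* λ′ (2 * s) Δ) ⟩
        λ′ ^ (2 * s) * λ′ ^ Δ * ball len s     ≡⟨ *-assoc (λ′ ^ (2 * s)) (λ′ ^ Δ) _ ⟩
        λ′ ^ (2 * s) * (λ′ ^ Δ * ball len s)   ∎)

sumFin : ∀ k → (Fin k → ℕ) → ℕ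
sumFin zero    f = 0
sumFin (suc k) f = f zero + sumFin k (f ∘ suc)

sumFin-cong : ∀ k {f g : Fin k → ℕ} → (∀ a → f a ≡ g a) → sumFin k f ≡ sumFin k g
sumFin-cong zero    f≡g = refl
sumFin-cong (suc k) f≡g = cong₂ _+_ (f≡g zero) (sumFin-cong k (f≡g ∘ suc))

sumFin-+ : ∀ k (f g : Fin k → ℕ) → sumFin k (λ a → f a + g a) ≡ sumFin k f + sumFin k g
sumFin-+ zero    f g = refl
sumFin-+ (suc k) f g = trans (cong (f zero + g zero +_) (sumFin-+ k (f ∘ suc) (g ∘ suc)))
  (interchange (f zero) (g zero) _ _)

sumFin-const : ∀ k c → sumFin k (λ _ → c) ≡ k * c
sumFin-const zero    c = refl
sumFin-const (suc k) c = cong (c +_) (sumFin-const k c)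

sumFin-max : ∀ k (f : Fin (suc k) → ℕ) → ∃ λ a → sumFin (suc k) f ≤ suc k * f a
sumFin-max zero    f = zero , ≤-refl
sumFin-max (suc k) f with b , rest ← sumFin-max k (f ∘ suc) with ≤-total (f zero) (f (suc b))
... | inj₁ ≤b = suc b , +-mono-≤ ≤b rest
... | inj₂ ≥b = zero , +-monoʳ-≤ (f zero) (≤-trans rest (*-monoʳ-≤ (suc k) ≥b))

sumFin-≟ : ∀ k (b : Fin (suc k)) (x y : ℕ) (f : Fin (suc k) → ℕ) → f b ≡ x →
    (∀ a → a ≢ b → f a ≡ y) →
           sumFin (suc k) f ≡ x + k * y
sumFin-≟ k       zero    x y f fb f≢ =
    cong₂ _+_ fb (trans (sumFin-cong k (λ a → f≢ (suc a) λ ())) (sumFin-const k y))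
sumFin-≟ (suc k) (suc b) x y f fb f≢ = begin
  f zero + sumFin (suc k) (f ∘ suc)  ≡⟨ cong₂ _+_ (f≢ zero λ ())
      (sumFin-≟ k b x y (f ∘ suc) fb (λ a a≢b → f≢ (suc a) (λ { refl → a≢b refl }))) ⟩
  y + (x + k * y)                    ≡⟨ x∙yz≈y∙xz y x (k * y) ⟩
  x + (y + k * y)                    ∎
  where
  open ≡-Reasoning

sumWords : ∀ k t → (Word k t → ℕ) → ℕ
sumWords k zero    f = f []
sumWords k (suc t) f = sumFin k (λ a → sumWords k t (λ w → f (a ∷ w)))

sumWords-cong : ∀ k t {f g : Word k t → ℕ} → (∀ w → f w ≡ g w) → sumWords k t f ≡ sumWords k t g
sumWords-cong k zero    f≡g = f≡g []
sumWords-cong k (suc t) f≡g = sumFin-cong k (λ a → sumWords-cong k t (λ w → f≡g (a ∷ w)))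

sumWords-+ : ∀ k t (f g : Word k t → ℕ) →
    sumWords k t (λ w → f w + g w) ≡ sumWords k t f + sumWords k t g
sumWords-+ k zero    f g = refl
sumWords-+ k (suc t) f g = trans (sumFin-cong k (λ a → sumWords-+ k t _ _)) (sumFin-+ k _ _)

sumWords-zero : ∀ k t → sumWords k t (λ _ → 0) ≡ 0
sumWords-zero k zero    = refl
sumWords-zero k (suc t) =
  trans (sumFin-cong k (λ _ → sumWords-zero k t)) (trans (sumFin-const k 0) (*-zeroʳ k))

sumWords-max : ∀ k t (f : Word (suc k) t → ℕ) → ∃ λ w → sumWords (suc k) t f ≤ suc k ^ t * f w
sumWords-max k zero    f = [] , m≤m+n _ _
sumWords-max k (suc t) f with a , best ← sumFin-max k (λ a → sumWords (suc k) t (λ w → f (a ∷ w)))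
  with w , rest ← sumWords-max k t (λ w → f (a ∷ w)) =
  a ∷ w , ≤-trans best
      (≤-trans (*-monoʳ-≤ (suc k) rest) (≤-reflexive (sym (*-assoc (suc k) (suc k ^ t) _))))

length-product : ∀ {A B C : Set} {f : A → B → C} xs ys →
                 length (cartesianProductWith f xs ys) ≡ length xs * length ys
length-product []       ys = refl
length-product {f = f} (x ∷ xs) ys = trans (length-++ (List.map (f x) ys))
  (cong₂ _+_ (length-map (f x) ys) (length-product xs ys))

words : ∀ k t → List (Word k t)
words k zero    = [] ∷ []
words k (suc t) = cartesianProductWith _∷_ (allFin k) (words k t)

∈-words : ∀ {k t} (w : Word k t) → w ∈ words k t
∈-words []      = here refl
∈-words (a ∷ w) = ∈-cartesianProductWith⁺ _∷_ (∈-allFin a) (∈-words w)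

length-words : ∀ k t → length (words k t) ≡ k ^ t
length-words k zero    = refl
length-words k (suc t) = trans (length-product (allFin k) (words k t))
  (cong₂ _*_ (length-tabulate {n = k} (λ a → a)) (length-words k t))

module _ {k t : ℕ} (s : ℕ) where

  hit? : Word k t → Word k t → ℕ
  hit? w u = if mismatches w u ≤ᵇ s then 1 else 0

  covered : Word k t → List (Word k t) → ℕ
  covered w []      = 0
  covered w (u ∷ U) = hit? w u + covered w U

  uncovered : Word k t → List (Word k t) → List (Word k t)
  uncovered w []      = []
  uncovered w (u ∷ U) = if mismatches w u ≤ᵇ s then uncovered w U else u ∷ uncovered w U

  covered+uncovered : ∀ w U → covered w U + length (uncovered w U) ≡ length U
  covered+uncovered w []      = refl
  covered+uncovered w (u ∷ U) with mismatches w u ≤ᵇ s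
  ... | true  = cong suc (covered+uncovered w U)
  ... | false = trans (+-suc _ _) (cong suc (covered+uncovered w U))

  ∈-uncovered : ∀ w {U u} → u ∈ U → mismatches w u ≤ s ⊎ u ∈ uncovered w U
  ∈-uncovered w {v ∷ U} u∈U with mismatches w v ≤ᵇ s in eq
  ∈-uncovered w {v ∷ U} (here refl) | true  = inj₁ (≤ᵇ⇒≤ _ _ (subst T (sym eq) _))
  ∈-uncovered w {v ∷ U} (there u∈U) | true  = ∈-uncovered w u∈U
  ∈-uncovered w {v ∷ U} (here refl) | false = inj₂ (here refl)
  ∈-uncovered w {v ∷ U} (there u∈U) | false with ∈-uncovered w u∈U
  ... | inj₁ near = inj₁ near
  ... | inj₂ u∈   = inj₂ (there u∈)

module Covering (κ : ℕ) where
  open Binomial κ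

  sumWords-hit? : ∀ t s u → sumWords (suc κ) t (λ w → hit? s w u) ≡ ball t s
  sumWords-hit? zero    s       []      = refl
  sumWords-hit? (suc t) zero    (b ∷ u) = trans
    (sumFin-≟ κ b (ball t 0) 0 _ (same b) other)
        (trans (cong (ball t 0 +_) (*-zeroʳ κ)) (+-identityʳ _))
    where
    same : ∀ b → sumWords (suc κ) t (λ w → hit? 0 (b ∷ w) (b ∷ u)) ≡ ball t 0
    same b with b ≟ᶠ b
    ... | yes _  = sumWords-hit? t 0 u
    ... | no b≢b with () ← b≢b refl
    other : ∀ a → a ≢ b → sumWords (suc κ) t (λ w → hit? 0 (a ∷ w) (b ∷ u)) ≡ 0
    other a a≢b with a ≟ᶠ b
    ... | yes a≡b with () ← a≢b a≡b
    ... | no _ = sumWords-zero (suc κ) t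
  sumWords-hit? (suc t) (suc s) (b ∷ u) =
      sumFin-≟ κ b (ball t (suc s)) (ball t s) _ (same b) other
    where
    same : ∀ b → sumWords (suc κ) t (λ w → hit? (suc s) (b ∷ w) (b ∷ u)) ≡ ball t (suc s)
    same b with b ≟ᶠ b
    ... | yes _  = sumWords-hit? t (suc s) u
    ... | no b≢b with () ← b≢b refl
    other : ∀ a → a ≢ b → sumWords (suc κ) t (λ w → hit? (suc s) (a ∷ w) (b ∷ u)) ≡ ball t s
    other a a≢b with a ≟ᶠ b
    ... | yes a≡b with () ← a≢b a≡b
    ... | no _ = trans (sumWords-cong (suc κ) t
        (λ w → cong (if_then 1 else 0) (suc-≤ᵇ (mismatches w u) s))) (sumWords-hit? t s u)
      where
      suc-≤ᵇ : ∀ m n → (suc m ≤ᵇ suc n) ≡ (m ≤ᵇ n)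
      suc-≤ᵇ zero    n = refl
      suc-≤ᵇ (suc m) n = refl

  sumWords-covered : ∀ t s U → sumWords (suc κ) t (λ w → covered s w U) ≡ length U * ball t s
  sumWords-covered t s []      = sumWords-zero (suc κ) t
  sumWords-covered t s (u ∷ U) = trans (sumWords-+ (suc κ) t _ _)
    (cong₂ _+_ (sumWords-hit? t s u) (sumWords-covered t s U))

  -- Greedy covering: some word covers at least a 1/q fraction of what is
  -- left, so q words at least halve it.
  module Greedy (t s q : ℕ) (0<q : 0 < q) (0<ball : 0 < ball t s) (volume : suc κ ^ t ≤ q * ball t s) where

    W = Word (suc κ) t

    best : ∀ (U : List W) → ∃ λ w → length U ≤ q * covered s w U
    best U with w , w-max ← sumWords-max κ t (λ w → covered s w U) =
      w , *-cancelʳ-≤ _ _ (ball t s) {{>-nonZero 0<ball}} (begin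
        length U * ball t s                       ≡⟨ sumWords-covered t s U ⟨
        sumWords (suc κ) t (λ w → covered s w U)  ≤⟨ w-max ⟩
        suc κ ^ t * c                             ≤⟨ *-monoˡ-≤ c volume ⟩
        q * ball t s * c                          ≡⟨ swap q (ball t s) c ⟩
        q * c * ball t s                          ∎)
      where
      open ≤-Reasoning
      c = covered s w U
      swap : ∀ x y z → x * y * z ≡ x * z * y
      swap = solve-∀

    Covers : List W → List W → List W → Set
    Covers C U U′ = ∀ {u} → u ∈ U → (∃ λ w → w ∈ C × mismatches w u ≤ s) ⊎ u ∈ U′

    shrink : ∀ m U → ∃₂ λ C U′ → length C ≤ m × Covers C U U′ ×
             (2 * length U′ ≤ length U ⊎ m * length U + 2 * q * length U′ ≤ 2 * q * length U)
    shrink zero    U = [] , U , z≤n , inj₂ , inj₂ ≤-refl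
    shrink (suc m) U with shrink m U
    ... | C , U′ , C≤ , cov , inj₁ half = C , U′ , m≤n⇒m≤1+n C≤ , cov , inj₁ half
    ... | C , U′ , C≤ , cov , inj₂ gain with 2 * length U′ ≤? length U
    ...   | yes half = C , U′ , m≤n⇒m≤1+n C≤ , cov , inj₁ half
    ...   | no ¬half with w , w-best ← best U′ = w ∷ C , uncovered s w U′ , s≤s C≤ , cov′ ,
        inj₂ (begin
        suc m * x + 2 * q * z              ≡⟨ regroup m q x z ⟩
        m * x + (x + 2 * q * z)            ≤⟨ +-monoʳ-≤ (m * x) (+-monoˡ-≤ _ (<⇒≤ (≰⇒> ¬half))) ⟩
        m * x + (2 * y + 2 * q * z)        ≤⟨ +-monoʳ-≤ (m * x)
            (+-monoˡ-≤ _ (*-monoʳ-≤ 2 w-best)) ⟩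
        m * x + (2 * (q * c) + 2 * q * z)  ≡⟨ cong (m * x +_) (collect q c z) ⟩
        m * x + 2 * q * (c + z)            ≡⟨ cong (λ v → m * x + 2 * q * v)
            (covered+uncovered s w U′) ⟩
        m * x + 2 * q * y                  ≤⟨ gain ⟩
        2 * q * x                          ∎)
      where
      open ≤-Reasoning
      x = length U
      y = length U′
      c = covered s w U′
      z = length (uncovered s w U′)
      regroup : ∀ m q x z → suc m * x + 2 * q * z ≡ m * x + (x + 2 * q * z)
      regroup = solve-∀
      collect : ∀ q c z → 2 * (q * c) + 2 * q * z ≡ 2 * q * (c + z)
      collect = solve-∀
      cov′ : Covers (w ∷ C) U (uncovered s w U′)
      cov′ u∈U with cov u∈U
      ... | inj₁ (v , v∈C , near) = inj₁ (v , there v∈C , near)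
      ... | inj₂ u∈U′ with ∈-uncovered s w u∈U′
      ...   | inj₁ near = inj₁ (w , here refl , near)
      ...   | inj₂ u∈   = inj₂ u∈

    halve : ∀ U → ∃₂ λ C U′ → length C ≤ q × Covers C U U′ × 2 * length U′ ≤ length U
    halve U with shrink q U
    ... | C , U′ , C≤ , cov , inj₁ half = C , U′ , C≤ , cov , half
    ... | C , U′ , C≤ , cov , inj₂ gain = C , U′ , C≤ , cov ,
          +-cancelˡ-≤ x _ _ (*-cancelˡ-≤ q {{>-nonZero 0<q}} (begin
            q * (x + 2 * y)    ≡⟨ expand q x y ⟩
            q * x + 2 * q * y  ≤⟨ gain ⟩
            2 * q * x          ≡⟨ contract q x ⟩
            q * (x + x)        ∎))
      where
      open ≤-Reasoning
      x = length U
      y = length U′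
      expand : ∀ q x y → q * (x + 2 * y) ≡ q * x + 2 * q * y
      expand = solve-∀
      contract : ∀ q x → 2 * q * x ≡ q * (x + x)
      contract = solve-∀

    cover : ∀ L (U : List W) → length U < 2 ^ L → ∃ λ (C : List W) → length C ≤ L * q ×
            (∀ {u : W} → u ∈ U → ∃ λ (w : W) → w ∈ C × mismatches w u ≤ s)
    cover zero    []      U< = [] , z≤n , λ ()
    cover zero    (_ ∷ _) U< with () ← ≤-pred U<
    cover (suc L) U       U< with C , U′ , C≤ , cov , half ← halve U
      with D , D≤ , cov′ ← cover L U′ (*-cancelˡ-< 2 _ _ (≤-<-trans half U<)) =
      C ++ D , ≤-trans (≤-reflexive (length-++ C)) (+-mono-≤ C≤ D≤) , both
      where
      both : ∀ {u} → u ∈ U → ∃ λ w → w ∈ C ++ D × mismatches w u ≤ s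
      both u∈U with cov u∈U
      ... | inj₁ (w , w∈C , near) = w , ∈-++⁺ˡ w∈C , near
      ... | inj₂ u∈U′ with w , w∈D , near ← cov′ u∈U′ = w , ∈-++⁺ʳ C w∈D , near

n<2^n : ∀ n → n < 2 ^ n
n<2^n zero    = s≤s z≤n
n<2^n (suc n) = ≤-trans (+-mono-≤ (m^n>0 2 n) (n<2^n n))
    (≤-reflexive (cong (2 ^ n +_) (sym (+-identityʳ _))))

-- Here k = 2 + κ, and s * κ = t − 2 s.
coveringCode : ∀ κ s → let t = s * (2 + κ) in
  ∃ λ (code : List (Word (2 + κ) t)) →
    length code ≤ suc ((2 + κ) * t) * (suc t * suc κ ^ (s * κ)) ×
    (∀ w* → ∃ λ w → w ∈ code × 2 * mismatches w w* + s * κ ≤ t)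
coveringCode κ s = code , code≤ , λ w* → weaken w* (covers (∈-words w*))
  where
  t = s * (2 + κ)
  q = suc t * suc κ ^ (s * κ)
  open Covering (suc κ)
  open Binomial (suc κ)
  open Mode (s≤s z≤n) s
  eq : 2 * s + s * κ ≡ t
  eq = trans (cong (_+ s * κ) (*-comm 2 s)) (sym (*-distribˡ-+ s 2 κ))
  vol : (2 + κ) ^ t ≤ q * ball t s
  vol = volume (s * κ) eq
  0<ball : ∀ t s → 0 < ball t s
  0<ball zero    s       = s≤s z≤n
  0<ball (suc t) zero    = 0<ball t zero
  0<ball (suc t) (suc s) = ≤-trans (0<ball t (suc s)) (m≤m+n _ _)
  few : length (words (2 + κ) t) < 2 ^ suc ((2 + κ) * t)
  few = begin-strict
    length (words (2 + κ) t)  ≡⟨ length-words (2 + κ) t ⟩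
    (2 + κ) ^ t               ≤⟨ ^-monoˡ-≤ t (<⇒≤ (n<2^n (2 + κ))) ⟩
    (2 ^ (2 + κ)) ^ t         ≡⟨ ^-*-assoc 2 (2 + κ) t ⟩
    2 ^ ((2 + κ) * t)         <⟨ ^-monoʳ-< 2 (s≤s (s≤s z≤n)) (n<1+n ((2 + κ) * t)) ⟩
    2 ^ suc ((2 + κ) * t)     ∎
    where open ≤-Reasoning
  greedy = Greedy.cover t s q (*-mono-≤ (s≤s (z≤n {t})) (m^n>0 (suc κ) (s * κ))) (0<ball t s) vol
             (suc ((2 + κ) * t)) (words (2 + κ) t) few
  code = proj₁ greedy
  code≤ = proj₁ (proj₂ greedy)
  covers = proj₂ (proj₂ greedy)
  weaken : ∀ w* → (∃ λ w → w ∈ code × mismatches w w* ≤ s) → ∃ λ w →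
      w ∈ code × 2 * mismatches w w* + s * κ ≤ t
  weaken w* (w , w∈ , near) =
      w , w∈ , ≤-trans (+-monoˡ-≤ (s * κ) (*-monoʳ-≤ 2 near)) (≤-reflexive eq)

-- Rational bounds

fromℕ-ᵘ : ∀ n → toℚᵘ (fromℕ n) ℚᵘ.≃ mkℚᵘ (ℤ.+ n) 0
fromℕ-ᵘ n = ℚ.toℚᵘ-fromℚᵘ (mkℚᵘ (ℤ.+ n) 0)

fromℕ-* : ∀ m n → fromℕ (m * n) ≡ fromℕ m ℚ.* fromℕ n
fromℕ-* m n = ℚ.toℚᵘ-injective (begin
  toℚᵘ (fromℕ (m * n))                 ≈⟨ fromℕ-ᵘ (m * n) ⟩
  mkℚᵘ (ℤ.+ (m * n)) 0                   ≈⟨ *≡* (cong (ℤ._* (ℤ.+ 1)) (ℤ.pos-* m n)) ⟩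
  mkℚᵘ (ℤ.+ m) 0 ℚᵘ.* mkℚᵘ (ℤ.+ n) 0       ≈⟨ ℚᵘ.*-cong (fromℕ-ᵘ m) (fromℕ-ᵘ n) ⟨
  toℚᵘ (fromℕ m) ℚᵘ.* toℚᵘ (fromℕ n)   ≈⟨ ℚ.toℚᵘ-homo-* (fromℕ m) (fromℕ n) ⟨
  toℚᵘ (fromℕ m ℚ.* fromℕ n)           ∎)
  where open ℚᵘ.≃-Reasoning

fromℕ-+ : ∀ m n → fromℕ (m + n) ≡ fromℕ m ℚ.+ fromℕ n
fromℕ-+ m n = ℚ.toℚᵘ-injective (begin
  toℚᵘ (fromℕ (m + n))                 ≈⟨ fromℕ-ᵘ (m + n) ⟩
  mkℚᵘ (ℤ.+ (m + n)) 0                   ≈⟨ *≡*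
      (cong (ℤ._* (ℤ.+ 1)) (sym (cong₂ ℤ._+_ (ℤ.*-identityʳ (ℤ.+ m)) (ℤ.*-identityʳ (ℤ.+ n))))) ⟩
  mkℚᵘ (ℤ.+ m) 0 ℚᵘ.+ mkℚᵘ (ℤ.+ n) 0       ≈⟨ ℚᵘ.+-cong (fromℕ-ᵘ m) (fromℕ-ᵘ n) ⟨
  toℚᵘ (fromℕ m) ℚᵘ.+ toℚᵘ (fromℕ n)   ≈⟨ ℚ.toℚᵘ-homo-+ (fromℕ m) (fromℕ n) ⟨
  toℚᵘ (fromℕ m ℚ.+ fromℕ n)           ∎)
  where open ℚᵘ.≃-Reasoning

fromℕ-mono : ∀ {m n} → m ≤ n → fromℕ m ℚ.≤ fromℕ n
fromℕ-mono {m} {n} m≤n = ℚ.toℚᵘ-cancel-≤ (begin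
  toℚᵘ (fromℕ m)   ≃⟨ fromℕ-ᵘ m ⟩
  mkℚᵘ (ℤ.+ m) 0     ≤⟨ *≤* (ℤ.*-monoʳ-≤-nonNeg (ℤ.+ 1) (ℤ.+≤+ m≤n)) ⟩
  mkℚᵘ (ℤ.+ n) 0     ≃⟨ fromℕ-ᵘ n ⟨
  toℚᵘ (fromℕ n)   ∎)
  where open ℚᵘ.≤-Reasoning

fromℕ-^ : ∀ m n → fromℕ (m ^ n) ≡ fromℕ m ^ℚ n
fromℕ-^ m zero    = refl
fromℕ-^ m (suc n) = trans (fromℕ-* m (m ^ n)) (cong (fromℕ m ℚ.*_) (fromℕ-^ m n))

0≤fromℕ : ∀ n → 0ℚ ℚ.≤ fromℕ n
0≤fromℕ n = fromℕ-mono {0} {n} z≤n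

*-mono-≤ℚ : ∀ {p q r s} → 0ℚ ℚ.≤ q → 0ℚ ℚ.≤ r → p ℚ.≤ q → r ℚ.≤ s → p ℚ.* r ℚ.≤ q ℚ.* s
*-mono-≤ℚ {p} {q} {r} {s} 0≤q 0≤r p≤q r≤s = ℚ.≤-trans
  (ℚ.*-monoʳ-≤-nonNeg r {{ℚ.nonNegative 0≤r}} p≤q)
      (ℚ.*-monoˡ-≤-nonNeg q {{ℚ.nonNegative 0≤q}} r≤s)

0≤^ : ∀ {p} n → 0ℚ ℚ.≤ p → 0ℚ ℚ.≤ p ^ℚ n
0≤^ zero    0≤p = fromℕ-mono {0} {1} z≤n
0≤^ {p} (suc n) 0≤p = ℚ.≤-trans (ℚ.≤-reflexive (sym (ℚ.*-zeroʳ p)))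
  (ℚ.*-monoˡ-≤-nonNeg p {{ℚ.nonNegative 0≤p}} (0≤^ n 0≤p))

^-mono-≤ℚ : ∀ {p q} n → 0ℚ ℚ.≤ p → p ℚ.≤ q → p ^ℚ n ℚ.≤ q ^ℚ n
^-mono-≤ℚ zero    0≤p p≤q = ℚ.≤-refl
^-mono-≤ℚ (suc n) 0≤p p≤q = *-mono-≤ℚ (ℚ.≤-trans 0≤p p≤q) (0≤^ n 0≤p) p≤q (^-mono-≤ℚ n 0≤p p≤q)

1≤^ : ∀ {p} n → 1ℚ ℚ.≤ p → 1ℚ ℚ.≤ p ^ℚ n
1≤^ zero    1≤p = ℚ.≤-refl
1≤^ {p} (suc n) 1≤p =
    *-mono-≤ℚ {1ℚ} {p} {1ℚ} (ℚ.≤-trans (fromℕ-mono {0} {1} z≤n) 1≤p) (fromℕ-mono {0} {1} z≤n) 1≤p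
        (1≤^ n 1≤p)

^-monoʳ-≤ℚ : ∀ {p m n} → 1ℚ ℚ.≤ p → m ≤ n → p ^ℚ m ℚ.≤ p ^ℚ n
^-monoʳ-≤ℚ {p} {m} {n} 1≤p m≤n = subst (λ z → p ^ℚ m ℚ.≤ p ^ℚ z) (m+[n∸m]≡n m≤n)
  (ℚ.≤-trans (ℚ.≤-reflexive (sym (ℚ.*-identityʳ _)))
    (ℚ.≤-trans (ℚ.*-monoˡ-≤-nonNeg (p ^ℚ m) {{ℚ.nonNegative (0≤^ m 0≤p)}} (1≤^ (n ∸ m) 1≤p))
      (ℚ.≤-reflexive (sym (^-homo-* p m (n ∸ m))))))
  where 0≤p = ℚ.≤-trans (fromℕ-mono {0} {1} z≤n) 1≤p

archimedean : ∀ ε → 0ℚ ℚ.< ε → (l : ℕ) → ∃ λ D → fromℕ l ℚ.≤ fromℕ (suc D) ℚ.* ε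
archimedean (mkℚ (ℤ.+ zero) _ _) (ℚ.*<* (ℤ.+<+ ())) l
archimedean ε@(mkℚ (ℤ.+ suc p) d _) _ l = l * suc d , ℚ.toℚᵘ-cancel-≤ (begin
  toℚᵘ (fromℕ l)     ≃⟨ fromℕ-ᵘ l ⟩
  mkℚᵘ (ℤ.+ l) 0       ≤⟨ *≤* (ℤ.≤-trans (ℤ.≤-reflexive (sym (ℤ.pos-* l (suc (d + 0)))))
                          (ℤ.≤-trans (ℤ.+≤+ bound)
                              (ℤ.≤-reflexive (ℤ.pos-* (suc (l * suc d) * suc p) 1)))) ⟩
  mkℚᵘ (ℤ.+ suc (l * suc d)) 0 ℚᵘ.* toℚᵘ ε ≃⟨ ℚᵘ.*-cong (fromℕ-ᵘ (suc (l * suc d))) ℚᵘ.≃-refl ⟨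
  toℚᵘ (fromℕ (suc (l * suc d))) ℚᵘ.* toℚᵘ ε ≃⟨ ℚ.toℚᵘ-homo-* (fromℕ (suc (l * suc d))) ε ⟨
  toℚᵘ (fromℕ (suc (l * suc d)) ℚ.* ε) ∎)
  where
  open ℚᵘ.≤-Reasoning
  bound : l * suc (d + 0) ≤ suc (l * suc d) * suc p * 1
  bound = ≤-trans (≤-reflexive (cong (λ z → l * suc z) (+-identityʳ d)))
    (≤-trans (n≤1+n _) (≤-trans (m≤m*n _ (suc p))
        (≤-reflexive (sym (*-identityʳ (suc (l * suc d) * suc p))))))

^-distribʳ-* : ∀ m n o → (m * n) ^ o ≡ m ^ o * n ^ o
^-distribʳ-* m n zero    = refl
^-distribʳ-* m n (suc o) =
    trans (cong (m * n *_) (^-distribʳ-* m n o)) ([m*n]*[o*p]≡[m*o]*[n*p] m n (m ^ o) (n ^ o))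

module _ (l : ℕ) (ε : ℚ) (0<ε : 0ℚ ℚ.< ε) where

  private μ = fromℕ (suc l) ℚ.- 1ℚ ℚ.+ ε

  base≡ : μ ≡ fromℕ l ℚ.+ ε
  base≡ = cong (ℚ._+ ε) (begin
    fromℕ (suc l) ℚ.- 1ℚ          ≡⟨ cong (ℚ._- 1ℚ) (trans (fromℕ-+ 1 l) (ℚ.+-comm 1ℚ (fromℕ l)))
        ⟩
    fromℕ l ℚ.+ 1ℚ ℚ.- 1ℚ         ≡⟨ ℚ.+-assoc (fromℕ l) 1ℚ (ℚ.- 1ℚ) ⟩
    fromℕ l ℚ.+ (1ℚ ℚ.- 1ℚ)       ≡⟨ ℚ.+-identityʳ (fromℕ l) ⟩
    fromℕ l                       ∎)
    where open ≡-Reasoning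

  0≤ε : 0ℚ ℚ.≤ ε
  0≤ε = ℚ.<⇒≤ 0<ε

  1≤base : 1 ≤ l → 1ℚ ℚ.≤ μ
  1≤base 1≤l = subst (1ℚ ℚ.≤_) (sym base≡) (ℚ.≤-trans (fromℕ-mono 1≤l)
    (ℚ.≤-trans (ℚ.≤-reflexive (sym (ℚ.+-identityʳ (fromℕ l)))) (ℚ.+-monoʳ-≤ (fromℕ l) 0≤ε)))

  power-≤ : 1 ≤ l → ∀ {D} → fromℕ l ℚ.≤ fromℕ (suc D) ℚ.* ε →
            ∀ {X e q r} → X * suc D ^ e ≤ (suc (suc D) * l) ^ e → q * e ≤ r →
            fromℕ (X ^ q) ℚ.≤ μ ^ℚ r
  power-≤ 1≤l {D} l≤Dε {X} {e} {q} {r} X≤ qe≤r = ℚ.≤-trans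
    (ℚ.*-cancelˡ-≤-pos (fromℕ (suc D ^ (e * q)))
        {{ℚ.positive (ℚ.<-≤-trans (ℚ.positive⁻¹ 1ℚ) (fromℕ-mono (m^n>0 (suc D) (e * q))))}} (begin
      fromℕ (suc D ^ (e * q)) ℚ.* fromℕ (X ^ q)   ≡⟨ fromℕ-* (suc D ^ (e * q)) (X ^ q) ⟨
      fromℕ (suc D ^ (e * q) * X ^ q)             ≤⟨ fromℕ-mono counts ⟩
      fromℕ ((suc (suc D) * l) ^ (e * q))         ≡⟨ fromℕ-^ (suc (suc D) * l) (e * q) ⟩
      fromℕ (suc (suc D) * l) ^ℚ (e * q)          ≤⟨ ^-mono-≤ℚ (e * q)
          (0≤fromℕ (suc (suc D) * l)) step ⟩
      (fromℕ (suc D) ℚ.* μ) ^ℚ (e * q)            ≡⟨ ^-distrib-* (fromℕ (suc D)) μ (e * q) ⟩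
      fromℕ (suc D) ^ℚ (e * q) ℚ.* μ ^ℚ (e * q)   ≡⟨ cong (ℚ._* μ ^ℚ (e * q))
          (fromℕ-^ (suc D) (e * q)) ⟨
      fromℕ (suc D ^ (e * q)) ℚ.* μ ^ℚ (e * q)    ∎))
    (^-monoʳ-≤ℚ (1≤base 1≤l) (≤-trans (≤-reflexive (*-comm e q)) qe≤r))
    where
    open ℚ.≤-Reasoning
    step : fromℕ (suc (suc D) * l) ℚ.≤ fromℕ (suc D) ℚ.* μ
    step = begin
      fromℕ (l + suc D * l)                                 ≡⟨ cong fromℕ (+-comm l (suc D * l)) ⟩
      fromℕ (suc D * l + l)                                 ≡⟨ fromℕ-+ (suc D * l) l ⟩
      fromℕ (suc D * l) ℚ.+ fromℕ l                         ≡⟨ cong (ℚ._+ fromℕ l)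
          (fromℕ-* (suc D) l) ⟩
      fromℕ (suc D) ℚ.* fromℕ l ℚ.+ fromℕ l                 ≤⟨ ℚ.+-monoʳ-≤
          (fromℕ (suc D) ℚ.* fromℕ l) l≤Dε ⟩
      fromℕ (suc D) ℚ.* fromℕ l ℚ.+ fromℕ (suc D) ℚ.* ε     ≡⟨ ℚ.*-distribˡ-+ (fromℕ (suc D))
          (fromℕ l) ε ⟨
      fromℕ (suc D) ℚ.* (fromℕ l ℚ.+ ε)                     ≡⟨ cong (fromℕ (suc D) ℚ.*_) base≡ ⟨
      fromℕ (suc D) ℚ.* μ                                   ∎
    counts : suc D ^ (e * q) * X ^ q ≤ (suc (suc D) * l) ^ (e * q)
    counts = ≤-trans (≤-reflexive (trans (cong (_* X ^ q) (sym (^-*-assoc (suc D) e q)))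
        (trans (*-comm _ (X ^ q)) (sym (^-distribʳ-* X (suc D ^ e) q)))))
      (≤-trans (^-monoˡ-≤ q X≤) (≤-reflexive (^-*-assoc (suc (suc D) * l) e q)))

-- Counting clauses and bounding costs

pigeonhole : ∀ {A : Set} {xs ys : List A} → AllPairs _≢_ xs → All (_∈ ys) xs →
    length xs ≤ length ys
pigeonhole []               []           = z≤n
pigeonhole (x≢ ∷ distinct) (x∈ys ∷ xs⊆ys) with as , bs , refl ← ∈-∃++ x∈ys = ≤-trans
  (s≤s (pigeonhole distinct (All.zipWith (λ (x≢y , y∈) → remove x≢y y∈) (x≢ , xs⊆ys))))
  (≤-reflexive (trans (cong suc (length-++ as))
      (sym (trans (length-++ as) (+-suc (length as) (length bs))))))
  where
  remove : ∀ {y} → _ ≢ y → y ∈ as ++ _ ∷ bs → y ∈ as ++ bs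
  remove x≢y y∈ with ∈-++⁻ as y∈
  ... | inj₁ y∈as         = ∈-++⁺ˡ y∈as
  ... | inj₂ (here y≡x)   = ⊥-elim (x≢y (sym y≡x))
  ... | inj₂ (there y∈bs) = ∈-++⁺ʳ as y∈bs

allLiterals : ∀ n → List (Literal n)
allLiterals n = cartesianProductWith (λ b i → literal i b) (false ∷ true ∷ []) (allFin n)

∈-allLiterals : ∀ {n} (l : Literal n) → l ∈ allLiterals n
∈-allLiterals (literal i b) =
    ∈-cartesianProductWith⁺ (λ b i → literal i b) (∈-bools b) (∈-allFin i)
  where
  ∈-bools : ∀ b → b ∈ false ∷ true ∷ []
  ∈-bools false = here refl
  ∈-bools true  = there (here refl)

length-allLiterals : ∀ n → length (allLiterals n) ≡ 2 * n
length-allLiterals n =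
    trans (length-product {f = λ b i → literal i b} (false ∷ true ∷ []) (allFin n))
        (cong (2 *_) (length-tabulate {n = n} (λ i → i)))

shortClauses : (k n : ℕ) → List (RawClause n)
shortClauses zero    n = [] ∷ []
shortClauses (suc k) n = [] ∷ cartesianProductWith _∷_ (allLiterals n) (shortClauses k n)

∈-shortClauses : (k : ℕ) → ∀ {n} (C : RawClause n) → length C ≤ k → C ∈ shortClauses k n
∈-shortClauses zero    []      _         = here refl
∈-shortClauses (suc k) []      _         = here refl
∈-shortClauses (suc k) (l ∷ C) (s≤s C≤k) =
  there (∈-cartesianProductWith⁺ _∷_ (∈-allLiterals l) (∈-shortClauses k C C≤k))

length-shortClauses : (k n : ℕ) → length (shortClauses k n) ≤ suc (2 * n) ^ k
length-shortClauses zero    n = ≤-refl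
length-shortClauses (suc k) n = begin
  suc (length (cartesianProductWith _∷_ (allLiterals n) (shortClauses k n)))
    ≡⟨ cong suc (trans (length-product {f = _∷_} (allLiterals n) (shortClauses k n))
      (cong (_* x) (length-allLiterals n))) ⟩
  1 + 2 * n * x                  ≤⟨ +-mono-≤ (m^n>0 (suc (2 * n)) k)
      (*-monoʳ-≤ (2 * n) (length-shortClauses k n)) ⟩
  suc (2 * n) ^ k + 2 * n * suc (2 * n) ^ k  ∎
  where
  open ≤-Reasoning
  x = length (shortClauses k n)

rawCNF : ∀ {n} → CNF n → RawCNF n
rawCNF F = List.map literals (clauses F)

length-rawCNF : ∀ {n k} (F : CNF n) → WidthAtMost k F → length (rawCNF F) ≤ suc (2 * n) ^ k
length-rawCNF {n} {k} F width = ≤-trans (pigeonhole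
    (AllPairs.map⁺ (AllPairs.map (λ {C} distinct C≡D →
        distinct (subst (literals C ∼[ set ]_) C≡D K-refl)) (CNF.distinct F)))
    (members (clauses F) width))
  (length-shortClauses k n)
  where
  members : ∀ Cs → All (λ C → length (literals C) ≤ k) Cs →
      All (_∈ shortClauses k n) (List.map literals Cs)
  members []       []        = []
  members (C ∷ Cs) (C≤ ∷ ≤k) = ∈-shortClauses k (literals C) C≤ ∷ members Cs ≤k

bernoulli : ∀ D m → D ^ m * (D + m) ≤ D * suc D ^ m
bernoulli D zero    =
    ≤-reflexive (trans (+-identityʳ _) (trans (+-identityʳ D) (sym (*-identityʳ D))))
bernoulli D (suc m) = begin
  D * D ^ m * (D + suc m)                ≡⟨ expand D (D ^ m) m ⟩
  D * (D ^ m * (D + m)) + D * D ^ m      ≤⟨ +-mono-≤ (*-monoʳ-≤ D (bernoulli D m))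
      (*-monoʳ-≤ D (^-monoˡ-≤ m (n≤1+n D))) ⟩
  D * (D * suc D ^ m) + D * suc D ^ m    ≡⟨ collect D (suc D ^ m) ⟩
  D * (suc D * suc D ^ m)                ∎
  where
  open ≤-Reasoning
  expand : ∀ D x m → D * x * (D + suc m) ≡ D * (x * (D + m)) + D * x
  expand = solve-∀
  collect : ∀ D y → D * (D * y) + D * y ≡ D * (suc D * y)
  collect = solve-∀

growth : ∀ D j → .{{NonZero D}} → suc j * D ^ (D * j) ≤ suc D ^ (D * j)
growth D j = *-cancelˡ-≤ D (begin
  D * (suc j * x)         ≡⟨ expand D j x ⟩
  x * (D + D * j)         ≤⟨ bernoulli D (D * j) ⟩
  D * suc D ^ (D * j)     ∎)
  where
  open ≤-Reasoning
  x = D ^ (D * j)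
  expand : ∀ D j x → D * (suc j * x) ≡ x * (D + D * j)
  expand = solve-∀

-- (1 + 1/D)ˢ ≥ (j + 1)³ for s = 3 D j, which outgrows the quadratic
-- polynomial on the left.
scale : ∀ k D → .{{NonZero D}} → .{{NonZero k}} → ∃ λ s → NonZero s × let t = s * k in
        2 * (suc (k * t) * suc t) * D ^ s ≤ suc D ^ s
scale k D {{D≢0}} = E * 3 , s≢0 , (begin
    2 * (suc (k * (E * 3 * k)) * suc (E * 3 * k)) * D ^ (E * 3)   ≤⟨ *-monoˡ-≤ (D ^ (E * 3))
        quadratic ⟩
    suc j ^ 3 * D ^ (E * 3)       ≡⟨ cong (suc j ^ 3 *_) (^-*-assoc D E 3) ⟨
    suc j ^ 3 * (D ^ E) ^ 3       ≡⟨ ^-distribʳ-* (suc j) (D ^ E) 3 ⟨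
    (suc j * D ^ E) ^ 3           ≤⟨ ^-monoˡ-≤ 3 (growth D j) ⟩
    (suc D ^ E) ^ 3               ≡⟨ ^-*-assoc (suc D) E 3 ⟩
    suc D ^ (E * 3)               ∎)
  where
  open ≤-Reasoning
  instance
    D*k≢0 : NonZero (3 * D * k)
    D*k≢0 = m*n≢0 (3 * D) k {{m*n≢0 3 D}}
    D*k*k≢0 : NonZero (3 * D * k * k)
    D*k*k≢0 = m*n≢0 (3 * D * k) k
    top≢0 : NonZero (2 * (3 * D * k * k * (3 * D * k)))
    top≢0 = m*n≢0 2 (3 * D * k * k * (3 * D * k)) {{_}} {{m*n≢0 (3 * D * k * k) (3 * D * k)}}
  top = 2 * (3 * D * k * k * (3 * D * k))
  j = pred top
  E = D * j
  suc-j : suc j ≡ top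
  suc-j = suc-pred top
  1<top : 1 < top
  1<top = *-monoʳ-≤ 2 (>-nonZero⁻¹ (3 * D * k * k * (3 * D * k))
      {{m*n≢0 (3 * D * k * k) (3 * D * k)}})
  s≢0 : NonZero (E * 3)
  s≢0 = m*n≢0 E 3 {{m*n≢0 D j {{D≢0}} {{>-nonZero (≤-pred (subst (1 <_) (sym suc-j) 1<top))}}}}
  linear : ∀ x → .{{NonZero x}} → ∀ y → y ≡ x * j → suc y ≤ x * suc j
  linear x y refl = ≤-trans (+-monoˡ-≤ (x * j) (>-nonZero⁻¹ x)) (≤-reflexive (sym (*-suc x j)))
  quadratic : 2 * (suc (k * (E * 3 * k)) * suc (E * 3 * k)) ≤ suc j ^ 3
  quadratic = begin
    2 * (suc (k * (E * 3 * k)) * suc (E * 3 * k))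
      ≤⟨ *-monoʳ-≤ 2 (*-mono-≤ (linear (3 * D * k * k) _ (eq₁ k D j))
        (linear (3 * D * k) _ (eq₂ k D j))) ⟩
    2 * (3 * D * k * k * suc j * (3 * D * k * suc j))
      ≡⟨ eq₃ (3 * D * k * k) (3 * D * k) (suc j) ⟩
    top * (suc j * (suc j * 1))
      ≡⟨ cong (_* (suc j * (suc j * 1))) suc-j ⟨
    suc j ^ 3 ∎
    where
    eq₁ : ∀ k D j → k * (D * j * 3 * k) ≡ 3 * D * k * k * j
    eq₁ = solve-∀
    eq₂ : ∀ k D j → D * j * 3 * k ≡ 3 * D * k * j
    eq₂ = solve-∀
    eq₃ : ∀ x y z → 2 * (x * z * (y * z)) ≡ 2 * (x * y) * (z * (z * 1))
    eq₃ = solve-∀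

module _ (A : ℕ) where

  private a = once A

  branchCost-closed : ∀ m x → branchCost A m x ≡ a + m * (a + x)
  branchCost-closed zero    x = sym (+-identityʳ a)
  branchCost-closed (suc m) x =
      trans (cong (λ z → a + (x + z)) (branchCost-closed m x)) (shuffle a x (m * (a + x)))
    where
    shuffle : ∀ a x y → a + (x + (a + y)) ≡ a + (a + x + y)
    shuffle = solve-∀

  searchCost-unary : ∀ r → searchCost A 1 r ≡ a + r * (a + (a + a))
  searchCost-unary zero    = sym (+-identityʳ a)
  searchCost-unary (suc r) = trans (cong (a +_) (branchCost-closed 1 (searchCost A 1 r)))
    (trans (cong (λ z → a + (a + 1 * (a + z))) (searchCost-unary r))
        (shuffle a (r * (a + (a + a)))))
    where
    shuffle : ∀ a x → a + (a + 1 * (a + (a + x))) ≡ a + (a + (a + a) + x)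
    shuffle = solve-∀

  searchCost-≤ : ∀ κ r → searchCost A (2 + κ) r + 4 * a ≤ 5 * (2 + κ) ^ r * a
  searchCost-≤ κ zero    = ≤-refl
  searchCost-≤ κ (suc r) = begin
    a + branchCost A (2 + κ) S + 4 * a         ≡⟨ cong (λ z → a + z + 4 * a)
        (branchCost-closed (2 + κ) S) ⟩
    a + (a + (2 + κ) * (a + S)) + 4 * a        ≤⟨ m≤m+n _ (3 * κ * a) ⟩
    a + (a + (2 + κ) * (a + S)) + 4 * a + 3 * κ * a   ≡⟨ regroup a S κ ⟩
    (2 + κ) * (S + 4 * a)                      ≤⟨ *-monoʳ-≤ (2 + κ) (searchCost-≤ κ r) ⟩
    (2 + κ) * (5 * (2 + κ) ^ r * a)            ≡⟨ reorder (2 + κ) ((2 + κ) ^ r) a ⟩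
    5 * ((2 + κ) * (2 + κ) ^ r) * a            ∎
    where
    open ≤-Reasoning
    S = searchCost A (2 + κ) r
    regroup : ∀ a S κ → a + (a + (2 + κ) * (a + S)) + 4 * a + 3 * κ * a ≡ (2 + κ) * (S + 4 * a)
    regroup = solve-∀
    reorder : ∀ l x a → l * (5 * x * a) ≡ 5 * (l * x) * a
    reorder = solve-∀

  enumCost-closed : ∀ x m → enumCost A x m + a ≡ 2 ^ m * (a + a + x)
  enumCost-closed x zero    = shuffle a x
    where
    shuffle : ∀ a x → a + x + a ≡ a + a + x + 0
    shuffle = solve-∀
  enumCost-closed x (suc m) = begin
    a + (e + e) + a              ≡⟨ shuffle a e ⟩
    2 * (e + a)                  ≡⟨ cong (2 *_) (enumCost-closed x m) ⟩
    2 * (2 ^ m * (a + a + x))    ≡⟨ *-assoc 2 (2 ^ m) _ ⟨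
    2 * 2 ^ m * (a + a + x)      ∎
    where
    open ≡-Reasoning
    e = enumCost A x m
    shuffle : ∀ a e → a + (e + e) + a ≡ 2 * (e + a)
    shuffle = solve-∀

  enumCost-≤ : ∀ κ r m → enumCost A (searchCost A (2 + κ) r) m ≤ 2 ^ m * 7 * a * (2 + κ) ^ r
  enumCost-≤ κ r m = begin
    enumCost A S m                           ≤⟨ m≤m+n _ a ⟩
    enumCost A S m + a                       ≡⟨ enumCost-closed S m ⟩
    2 ^ m * (a + a + S)                      ≤⟨ *-monoʳ-≤ (2 ^ m)
        (+-monoʳ-≤ (a + a) (≤-trans (m≤m+n S _) (searchCost-≤ κ r))) ⟩
    2 ^ m * (a + a + 5 * y * a)              ≤⟨ *-monoʳ-≤ (2 ^ m)
        (+-monoˡ-≤ (5 * y * a) (≤-trans (m≤m*n (a + a) y {{y≢0}}) (≤-reflexive (double a y)))) ⟩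
    2 ^ m * (2 * y * a + 5 * y * a)          ≡⟨ regroup (2 ^ m) y a ⟩
    2 ^ m * 7 * a * y                        ∎
    where
    open ≤-Reasoning
    S = searchCost A (2 + κ) r
    y = (2 + κ) ^ r
    y≢0 = >-nonZero (m^n>0 (2 + κ) r)
    double : ∀ a y → (a + a) * y ≡ 2 * y * a
    double = solve-∀
    regroup : ∀ p y a → p * (2 * y * a + 5 * y * a) ≡ p * 7 * a * y
    regroup = solve-∀

  greedyCost-closed : ∀ c x e j → greedyCost A c x e j ≡ j * (a + e) + (a + (a + c * (a + x)))
  greedyCost-closed c x e zero    = cong (a +_) (branchCost-closed c x)
  greedyCost-closed c x e (suc j) = trans (cong (λ z → a + (e + z)) (greedyCost-closed c x e j))
    (shuffle a e (j * (a + e)) (a + (a + c * (a + x))))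
    where
    shuffle : ∀ a e x y → a + (e + (x + y)) ≡ a + e + x + y
    shuffle = solve-∀

  round-≤ : ∀ c x e j p y → .{{NonZero y}} → e ≤ p * a * y →
            a + greedyCost A c x e j ≤ (3 + j + c + j * p) * a * y + c * x
  round-≤ c x e j p y e≤ = begin
    a + greedyCost A c x e j                        ≡⟨ cong (a +_) (greedyCost-closed c x e j) ⟩
    a + (j * (a + e) + (a + (a + c * (a + x))))     ≤⟨ +-monoʳ-≤ a
        (+-monoˡ-≤ _ (*-monoʳ-≤ j (+-monoʳ-≤ a e≤))) ⟩
    a + (j * (a + p * a * y) + (a + (a + c * (a + x))))    ≡⟨ regroup a j p y c x ⟩
    (3 + j + c) * a + j * p * a * y + c * x         ≤⟨ +-monoˡ-≤ (c * x)
        (+-monoˡ-≤ (j * p * a * y) (m≤m*n ((3 + j + c) * a) y)) ⟩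
    (3 + j + c) * a * y + j * p * a * y + c * x     ≡⟨ collect (3 + j + c) (j * p) a y (c * x) ⟩
    (3 + j + c + j * p) * a * y + c * x             ∎
    where
    open ≤-Reasoning
    regroup : ∀ a j p y c x →
        a + (j * (a + p * a * y) + (a + (a + c * (a + x)))) ≡ (3 + j + c) * a + j * p * a * y + c
            * x
    regroup = solve-∀
    collect : ∀ u v a y z → u * a * y + v * a * y + z ≡ (u + v) * a * y + z
    collect = solve-∀

geometric : ∀ (f : ℕ → ℕ) H Y X c → Y ≤ X → 2 * c ≤ X → f 0 ≤ H * Y →
    (∀ q → f (suc q) ≤ H * Y ^ (2 + q) + c * f q) →
            ∀ q → f q ≤ 2 * (H * Y) * X ^ q
geometric f H Y X c Y≤X 2c≤X base step zero =
    ≤-trans base (≤-trans (m≤m+n (H * Y) _) (≤-reflexive (sym (*-identityʳ _))))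
geometric f H Y X c Y≤X 2c≤X base step (suc q) = begin
  f (suc q)                                          ≤⟨ step q ⟩
  H * (Y * Y ^ suc q) + c * f q                      ≤⟨ +-mono-≤
      (*-monoʳ-≤ H (*-monoʳ-≤ Y (^-monoˡ-≤ (suc q) Y≤X)))
                                                          (*-monoʳ-≤ c (geometric f H Y X c Y≤X
                                                              2c≤X base step q)) ⟩
  H * (Y * X ^ suc q) + c * (2 * (H * Y) * X ^ q)    ≡⟨ cong (H * (Y * X ^ suc q) +_)
      (reorder c (H * Y) (X ^ q)) ⟩
  H * (Y * X ^ suc q) + H * Y * (2 * c * X ^ q)      ≤⟨ +-monoʳ-≤ (H * (Y * X ^ suc q))
      (*-monoʳ-≤ (H * Y) (*-monoˡ-≤ (X ^ q) 2c≤X)) ⟩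
  H * (Y * X ^ suc q) + H * Y * X ^ suc q            ≡⟨ double H Y (X ^ suc q) ⟩
  2 * (H * Y) * X ^ suc q                            ∎
  where
  open ≤-Reasoning
  reorder : ∀ c h x → c * (2 * h * x) ≡ h * (2 * c * x)
  reorder = solve-∀
  double : ∀ H Y x → H * (Y * x) + H * Y * x ≡ 2 * (H * Y) * x
  double = solve-∀

Polynomial : (ℕ → ℕ) → Set
Polynomial f = ∃₂ λ c d → ∀ n → f n ≤ c * suc n ^ d

module _ where

  private
    raise : ∀ n {d e} → d ≤ e → suc n ^ d ≤ suc n ^ e
    raise n d≤e = ^-monoʳ-≤ (suc n) d≤e

  constant : ∀ c → Polynomial (λ _ → c)
  constant c = c , 0 , λ n → ≤-reflexive (sym (*-identityʳ c))

  argument : Polynomial (λ n → n)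
  argument = 1 , 1 , λ n →
      ≤-trans (n≤1+n n) (≤-reflexive (sym (trans (*-identityˡ _) (*-identityʳ (suc n)))))

  infixl 6 _⊕_
  infixl 7 _⊗_

  _⊕_ : ∀ {f g} → Polynomial f → Polynomial g → Polynomial (λ n → f n + g n)
  (c , d , f≤) ⊕ (c′ , d′ , g≤) = c + c′ , d + d′ , λ n → ≤-trans
    (+-mono-≤ (≤-trans (f≤ n) (*-monoʳ-≤ c (raise n (m≤m+n d d′))))
        (≤-trans (g≤ n) (*-monoʳ-≤ c′ (raise n (m≤n+m d′ d)))))
    (≤-reflexive (sym (*-distribʳ-+ (suc n ^ (d + d′)) c c′)))

  _⊗_ : ∀ {f g} → Polynomial f → Polynomial g → Polynomial (λ n → f n * g n)
  (c , d , f≤) ⊗ (c′ , d′ , g≤) = c * c′ , d + d′ , λ n → ≤-trans (*-mono-≤ (f≤ n) (g≤ n))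
    (≤-reflexive (trans ([m*n]*[o*p]≡[m*o]*[n*p] c (suc n ^ d) c′ (suc n ^ d′))
      (cong (c * c′ *_) (sym (^-distribˡ-+-* (suc n) d d′)))))

  power : ∀ {f} → Polynomial f → ∀ k → Polynomial (λ n → f n ^ k)
  power p zero    = constant 1
  power p (suc k) = p ⊗ power p k

  polynomial-≤ : ∀ {f g} → (∀ n → f n ≤ g n) → Polynomial g → Polynomial f
  polynomial-≤ f≤g (c , d , g≤) = c , d , λ n → ≤-trans (f≤g n) (g≤ n)

  polynomial-once : ∀ {f} → Polynomial f → Polynomial (λ n → once (f n))
  polynomial-once {f} p = polynomial-≤ (λ n → ≤-reflexive (once-def (f n))) (constant 64 ⊗ p)

  polynomial-level : ∀ {f g} → Polynomial f → Polynomial g → Polynomial (λ n → level (f n) (g n))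
  polynomial-level {f} {g} p q = polynomial-≤ (λ n → ≤-reflexive (level-def (f n) (g n)))
    ((constant 1 ⊕ p) ⊗ (constant 64 ⊗ q))

encodeCNF≡ : ∀ {n} (F : CNF n) → encodeCNF F ≡ encodeRaw (rawCNF F)
encodeCNF≡ F = go (clauses F)
  where
  go : ∀ Cs → encodeList (λ C → encodeList encodeLiteral (literals C)) Cs ≡ encodeRaw
      (List.map literals Cs)
  go []       = refl
  go (C ∷ Cs) = cong (encodeClause (literals C) ∙_) (go Cs)

-- Bounds all list lengths that occur; suc (2 * n) ^ k is for the number of
-- clauses.
inputSize : ℕ → ℕ → ℕ → ℕ
inputSize c k n = n + (c + suc (2 * n) ^ k)

unit : ℕ → ℕ
unit N = level N (level N (level N (level N 1)))

polynomial-unit : ∀ c k → Polynomial (λ n → once (unit (inputSize c k n)))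
polynomial-unit c k = polynomial-once (lev (lev (lev (lev (constant 1)))))
  where
  sz : Polynomial (inputSize c k)
  sz = argument ⊕ (constant c ⊕ power (constant 1 ⊕ (constant 2 ⊗ argument)) k)
  lev : ∀ {f} → Polynomial f → Polynomial (λ n → level (inputSize c k n) (f n))
  lev = polynomial-level sz

constant≤inputSize : ∀ c k n → c ≤ inputSize c k n
constant≤inputSize c k n = ≤-trans (m≤m+n c _) (m≤n+m _ n)

clauses≤inputSize : ∀ c k n → suc (2 * n) ^ k ≤ inputSize c k n
clauses≤inputSize c k n = ≤-trans (m≤n+m _ c) (m≤n+m _ n)

module TwoSAT where

  trivialCode : List (Word 2 0)
  trivialCode = [] ∷ []

  trivialCover : ∀ w* → ∃ λ w → w ∈ trivialCode × 2 * mismatches w w* + 0 ≤ 0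
  trivialCover [] = [] , here refl , z≤n

  open Table (encodeℕ 0) (encodeℕ 0) (encodeCode trivialCode) using (table)

  P : Program
  P = program table #main₂

  module _ {n} (F : CNF n) (width : WidthAtMost 2 F) where

    N = inputSize 3 2 n

    open Main 0 0 {1} trivialCode trivialCover N (m≤m+n n _) (rawCNF F)
      (≤-trans (m≤m+n 2 1) (constant≤inputSize 3 2 n))
      (≤-trans (length-rawCNF F width) (clauses≤inputSize 3 2 n))
      (All.map⁺ width)
      (≤-trans (m≤m+n 1 2) (constant≤inputSize 3 2 n))
      (≤-trans (m≤m+n 1 2) (constant≤inputSize 3 2 n))
      (≤-trans (m≤m+n 3 0) (constant≤inputSize 3 2 n)) public

    loopCost-closed : ∀ m →
        loopCost m ≡ once (unit N) + m *
            (once (unit N) + branchCost (unit N) 2 (searchCost (unit N) 1 n))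
    loopCost-closed zero    = sym (+-identityʳ _)
    loopCost-closed (suc m) = trans (cong (λ z → once (unit N) + (b + z)) (loopCost-closed m))
      (shuffle (once (unit N)) b (m * (once (unit N) + b)))
      where
      b = branchCost (unit N) 2 (searchCost (unit N) 1 n)
      shuffle : ∀ a b y → a + (b + (a + y)) ≡ a + (a + b + y)
      shuffle = solve-∀

  time : ℕ → ℕ
  time n = once (unit (inputSize 3 2 n)) + (a + n * (a + (a + 2 * (a + (a + n * (a + (a + a)))))))
    where a = once (unit (inputSize 3 2 n))

  polynomial-time : Polynomial time
  polynomial-time = a ⊕
      (a ⊕ argument ⊗ (a ⊕ (a ⊕ constant 2 ⊗ (a ⊕ (a ⊕ argument ⊗ (a ⊕ (a ⊕ a)))))))
    where a = polynomial-unit 3 2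

  solves : ∀ ε → 0ℚ ℚ.< ε → Polynomial time → ∃₂ λ (c d : ℕ) → SolvesPromiseBallSAT 2 P λ n r →
           fromℕ (c * suc n ^ d) ℚ.* (fromℕ 2 ℚ.- 1ℚ ℚ.+ ε) ^ℚ r
  solves ε 0<ε (c , d , time≤) = c , d , λ {n} F α r width (β , _ , βF) →
    let γ , γF , steps , run , steps≤ = main₂⇓ F width α (encodeℕ r) β (All.map⁺ βF)
    in γ , steps , subst
        (λ v → P on v ∙ encodeAssignment α ∙ encodeℕ r ⇓ encodeAssignment γ ∣ steps)
            (sym (encodeCNF≡ F)) run ,
       All.map⁻ γF , bound n r steps (≤-trans steps≤ (≤-reflexive (exact F width)))
    where
    exact : ∀ {n} (F : CNF n) (width : WidthAtMost 2 F) →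
        once (unit (inputSize 3 2 n)) + loopCost F width n ≡ time n
    exact {n} F width = cong (a +_)
        (trans (loopCost-closed F width n) (cong (λ z → a + n * (a + z))
      (trans (branchCost-closed U 2 (searchCost U 1 n))
          (cong (λ z → a + 2 * (a + z)) (searchCost-unary U n)))))
      where
      U = unit (inputSize 3 2 n)
      a = once U
    bound : ∀ n r steps → steps ≤ time n →
        fromℕ steps ℚ.≤ fromℕ (c * suc n ^ d) ℚ.* (fromℕ 2 ℚ.- 1ℚ ℚ.+ ε) ^ℚ r
    bound n r steps steps≤ = ℚ.≤-trans (ℚ.≤-reflexive (sym (ℚ.*-identityʳ (fromℕ steps))))
      (*-mono-≤ℚ (0≤fromℕ (c * suc n ^ d)) (fromℕ-mono {0} {1} z≤n)
          (fromℕ-mono (≤-trans steps≤ (time≤ n)))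
        (1≤^ r (1≤base 1 ε 0<ε ≤-refl)))

module ManySAT (κ : ℕ) (ε : ℚ) (0<ε : 0ℚ ℚ.< ε)
  (D : ℕ) (l≤Dε : fromℕ (2 + κ) ℚ.≤ fromℕ (suc D) ℚ.* ε) (s : ℕ) (s≢0 : NonZero s) where

  k l t Δ : ℕ
  k = 3 + κ
  l = 2 + κ
  t = s * k
  Δ = s * suc κ

  module Coded
    (scaled : 2 * (suc (k * t) * suc t) * suc D ^ s ≤ (2 + D) ^ s)
    (code : List (Word k t)) (code≤ : length code ≤ suc (k * t) * (suc t * l ^ Δ))
    (cover : ∀ w* → ∃ λ w → w ∈ code × 2 * mismatches w w* + Δ ≤ t)
    where

    open Table (encodeℕ t) (encodeℕ Δ) (encodeCode code) using (table)

    P : Program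
    P = program table #mainₖ

    instance
      Δ≢0 : NonZero Δ
      Δ≢0 = m*n≢0 s (suc κ) {{s≢0}}

    X : ℕ
    X = 2 * (suc (k * t) * suc t) * l ^ Δ

    X-≤ : X * suc D ^ Δ ≤ (suc (suc D) * l) ^ Δ
    X-≤ = begin
      p * l ^ Δ * suc D ^ Δ                           ≡⟨ cong (p * l ^ Δ *_) (split (suc D)) ⟩
      p * l ^ Δ * (suc D ^ s * suc D ^ (s * κ))       ≡⟨ reorder p (l ^ Δ) (suc D ^ s)
          (suc D ^ (s * κ)) ⟩
      p * suc D ^ s * suc D ^ (s * κ) * l ^ Δ         ≤⟨ *-monoˡ-≤ (l ^ Δ)
          (*-mono-≤ scaled (^-monoˡ-≤ (s * κ) (n≤1+n (suc D)))) ⟩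
      (2 + D) ^ s * (2 + D) ^ (s * κ) * l ^ Δ         ≡⟨ cong (_* l ^ Δ) (split (2 + D)) ⟨
      (2 + D) ^ Δ * l ^ Δ                             ≡⟨ ^-distribʳ-* (2 + D) l Δ ⟨
      ((2 + D) * l) ^ Δ                               ∎
      where
      open ≤-Reasoning
      p = 2 * (suc (k * t) * suc t)
      split : ∀ x → x ^ Δ ≡ x ^ s * x ^ (s * κ)
      split x = trans (cong (x ^_) (*-suc s κ)) (^-distribˡ-+-* x s (s * κ))
      reorder : ∀ p a b c → p * a * (b * c) ≡ p * b * c * a
      reorder = solve-∀

    size-t size-Δ size-code c₀ : ℕ
    size-t    = treeSize (encodeℕ t) + t
    size-Δ    = treeSize (encodeℕ Δ) + Δ
    size-code = treeSize (encodeCode code)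
    c₀ = k + (size-t + (size-Δ + size-code))

    module _ {n} (F : CNF n) (width : WidthAtMost k F) where

      N = inputSize c₀ k n

      private
        within : ∀ {x} → x ≤ size-t + (size-Δ + size-code) → x ≤ N
        within x≤ = ≤-trans (≤-trans x≤ (m≤n+m _ k)) (constant≤inputSize c₀ k n)

      open Main t Δ {l} code cover N (m≤m+n n _) (rawCNF F)
        (≤-trans (m≤m+n k _) (constant≤inputSize c₀ k n))
        (≤-trans (length-rawCNF F width) (clauses≤inputSize c₀ k n))
        (All.map⁺ width)
        (within (m≤m+n size-t _))
        (within (≤-trans (m≤m+n size-Δ size-code) (m≤n+m _ size-t)))
        (within (≤-trans (m≤n+m size-code size-Δ) (m≤n+m _ size-t))) public

    h Y : ℕ
    Y = l ^ Δ
    h = 3 + t + length code + t * (2 ^ (t * suc (suc l)) * 7)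

    module _ {n} (F : CNF n) (width : WidthAtMost k F) where

      private
        U = unit (inputSize c₀ k n)
        a = once U

      phaseCost-≤ : ∀ q → phaseCost F width q ≤ 2 * (h * a * Y) * X ^ q
      phaseCost-≤ = geometric (phaseCost F width) (h * a) Y X (length code)
        (m≤n*m Y (2 * (suc (k * t) * suc t)))
        (≤-trans (*-monoʳ-≤ 2 code≤) (≤-reflexive (reorder (suc (k * t)) (suc t) Y)))
        (≤-trans (round-≤ U (length code) 0 (cost F width Δ) t _ Y {{Y≢0}} (enumCost-≤ U κ Δ M))
          (≤-reflexive (trans (cong (h * a * Y +_) (*-zeroʳ (length code))) (+-identityʳ _))))
        λ q → ≤-trans (round-≤ U (length code) _ (cost F width ((2 + q) * Δ)) t _
            (l ^ ((2 + q) * Δ)) {{y≢0 q}} (enumCost-≤ U κ ((2 + q) * Δ) M))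
          (≤-reflexive (cong (λ z → h * a * z + length code * phaseCost F width q)
            (trans (cong (l ^_) (*-comm (2 + q) Δ)) (sym (^-*-assoc l Δ (2 + q))))))
        where
        M = t * suc (suc l)
        Y≢0 = >-nonZero (m^n>0 l Δ)
        y≢0 : ∀ q → NonZero (l ^ ((2 + q) * Δ))
        y≢0 q = >-nonZero (m^n>0 l ((2 + q) * Δ))
        reorder : ∀ x y z → 2 * (x * (y * z)) ≡ 2 * (x * y) * z
        reorder = solve-∀

      steps-≤ : ∀ q → a + phaseCost F width q ≤ (1 + 2 * (h * Y)) * a * X ^ q
      steps-≤ q = ≤-trans (+-mono-≤ (m≤m*n a (X ^ q) {{X^q≢0}}) (phaseCost-≤ q))
        (≤-reflexive (collect h a Y (X ^ q)))
        where
        X^q≢0 = >-nonZero (m^n>0 X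
            {{>-nonZero (*-mono-≤ {1} {2 * (suc (k * t) * suc t)} (s≤s z≤n) (m^n>0 l Δ))}} q)
        collect : ∀ h a Y x → a * x + 2 * (h * a * Y) * x ≡ (1 + 2 * (h * Y)) * a * x
        collect = solve-∀

    solves : Polynomial (λ n → (1 + 2 * (h * Y)) * once (unit (inputSize c₀ k n))) →
             ∃₂ λ (c d : ℕ) → SolvesPromiseBallSAT k P λ n r →
             fromℕ (c * suc n ^ d) ℚ.* (fromℕ k ℚ.- 1ℚ ℚ.+ ε) ^ℚ r
    solves (c , d , time≤) = c , d , λ {n} F α r width (β , close , βF) →
      let γ , γF , steps , run , steps≤ = mainₖ⇓ F width (r / Δ) α (replicate r leaf)
            (subst (_< suc (r / Δ) * Δ) (sym (length-replicate r)) (quotient r)) β (All.map⁺ βF)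
            (subst (hamming α β ≤_) (sym (length-replicate r)) close)
      in γ , steps , subst
          (λ v → P on v ∙ encodeAssignment α ∙ encodeℕ r ⇓ encodeAssignment γ ∣ steps)
              (sym (encodeCNF≡ F)) run ,
         All.map⁻ γF , bound n r steps (≤-trans steps≤ (steps-≤ F width (r / Δ)))
      where
      quotient : ∀ r → r < suc (r / Δ) * Δ
      quotient r = ≤-trans (s≤s (≤-reflexive (m≡m%n+[m/n]*n r Δ)))
          (+-monoˡ-≤ (r / Δ * Δ) (m%n<n r Δ))
      bound : ∀ n r steps →
          steps ≤ (1 + 2 * (h * Y)) * once (unit (inputSize c₀ k n)) * X ^ (r / Δ) →
              fromℕ steps ℚ.≤ fromℕ (c * suc n ^ d) ℚ.* (fromℕ k ℚ.- 1ℚ ℚ.+ ε) ^ℚ r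
      bound n r steps steps≤ =
          ℚ.≤-trans (fromℕ-mono (≤-trans steps≤ (*-monoˡ-≤ (X ^ (r / Δ)) (time≤ n))))
        (ℚ.≤-trans (ℚ.≤-reflexive (fromℕ-* (c * suc n ^ d) (X ^ (r / Δ))))
          (ℚ.*-monoˡ-≤-nonNeg (fromℕ (c * suc n ^ d)) {{ℚ.nonNegative (0≤fromℕ (c * suc n ^ d))}}
            (power-≤ l ε 0<ε (s≤s z≤n) l≤Dε {X} {Δ} {r / Δ} X-≤ (m/n*n≤m r Δ))))

manySAT : ∀ κ ε → 0ℚ ℚ.< ε → Σ Program λ P → ∃₂ λ (c d : ℕ) →
          SolvesPromiseBallSAT (3 + κ) P λ n r →
            fromℕ (c * suc n ^ d) ℚ.* (fromℕ (3 + κ) ℚ.- 1ℚ ℚ.+ ε) ^ℚ r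
manySAT κ ε 0<ε = build (archimedean ε 0<ε (2 + κ)) (λ D → scale (3 + κ) (suc D))
    (coveringCode (suc κ))
  where
  build : (∃ λ D → fromℕ (2 + κ) ℚ.≤ fromℕ (suc D) ℚ.* ε) →
          (∀ D → ∃ λ s → NonZero s × let t = s * (3 + κ) in
             2 * (suc ((3 + κ) * t) * suc t) * suc D ^ s ≤ suc (suc D) ^ s) →
          (∀ s → let t = s * (3 + κ) in ∃ λ (code : List (Word (3 + κ) t)) →
             length code ≤ suc ((3 + κ) * t) * (suc t * (2 + κ) ^ (s * suc κ)) ×
             (∀ w* → ∃ λ w → w ∈ code × 2 * mismatches w w* + s * suc κ ≤ t)) →
          _
  build (D , l≤Dε) scales codes =
      M.P , M.solves (constant (1 + 2 * (M.h * M.Y)) ⊗ polynomial-unit M.c₀ (3 + κ))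
    where
    module M = ManySAT.Coded κ ε 0<ε D l≤Dε (proj₁ (scales D)) (proj₁ (proj₂ (scales D)))
      (proj₂ (proj₂ (scales D))) (proj₁ (codes (proj₁ (scales D))))
      (proj₁ (proj₂ (codes (proj₁ (scales D))))) (proj₂ (proj₂ (codes (proj₁ (scales D)))))

theorem4 : (k : ℕ) → 2 ≤ k → (ε : ℚ) → 0ℚ ℚ.< ε →
           Σ Program λ P → ∃₂ λ (c d : ℕ) →
           SolvesPromiseBallSAT k P λ n r →
             fromℕ (c * suc n ^ d) ℚ.* (fromℕ k ℚ.- 1ℚ ℚ.+ ε) ^ℚ r
theorem4 (suc zero)          (s≤s ()) ε 0<ε
theorem4 (suc (suc zero))    2≤k ε 0<ε = TwoSAT.P , TwoSAT.solves ε 0<ε TwoSAT.polynomial-time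
theorem4 (suc (suc (suc κ))) 2≤k ε 0<ε = manySAT κ ε 0<ε
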